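{- Let $(x_n)_{n=1}^{\infty}$ be a sequence on $[0,1]$, let $0 < \alpha < 1$ and assume that for all real $s > 0$ $$ \lim_{N \rightarrow \infty} \frac{1}{N^{2-\alpha}} \# \left\{ (m,n): 1 \leq m \neq n \leq N,\ |x_m - x_n| \leq \frac{s}{N^{\alpha}} \right\} = 2s.$$ Then the sequence $(x_n)_{n=1}^\infty$ is uniformly distributed on $[0,1]$.
   Context: The count is over ordered pairs $(m,n)$ with $m\ne n$. A sequence on $[0,1]$ is uniformly distributed if for every interval $J\subset[0,1]$, $\lim_{N\to\infty}\frac1N\#\{1\le i\le N: x_i\in J\}=|J|$, where $|J|$ is the length of $J$. -}

module Defs where

open import Data.Bool using (Bool; if_then_else_)
open import Data.Integer as ℤ using (+_; -[1+_])
import Data.Integer.Properties as ℤₚ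
open import Data.List using (List; []; _∷_; length)
open import Data.List.Membership.Propositional using (_∈_)
open import Data.List.Membership.Propositional.Properties.WithK using (unique∧set⇒bag)
open import Data.List.Relation.Binary.BagAndSetEquality using (∼bag⇒↭)
open import Data.List.Relation.Binary.Permutation.Propositional.Properties using (↭-length)
open import Data.List.Relation.Unary.All as All using ([]; _∷_)
open import Data.List.Relation.Unary.AllPairs using ([]; _∷_)
open import Data.List.Relation.Unary.Any using (here; there)
open import Data.List.Relation.Unary.Unique.Propositional using (Unique)
open import Data.Nat as ℕ using (ℕ; zero; suc; NonZero; z≤n; s≤s)
import Data.Nat.Properties as ℕₚ
open import Data.Nat.Tactic.RingSolver using (solve-∀)
open import Data.Product using (∃-syntax; _×_; _,_; proj₁)
open import Data.Rational as ℚ using (ℚ; 0ℚ; 1ℚ; mkℚ)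
import Data.Rational.Properties as ℚₚ
open import Data.Rational.Solver using (module +-*-Solver)
open import Data.Rational.Unnormalised as ℚᵘ using (mkℚᵘ)
import Data.Rational.Unnormalised.Properties as ℚᵘₚ
open import Data.Sum using (inj₁; inj₂)
open import Function using (_∘_)
open import Function.Bundles using (_⇔_; mk⇔; Equivalence)
open import Level using (0ℓ)
open import Relation.Binary.PropositionalEquality
  using (_≡_; _≢_; refl; sym; trans; cong; cong₂; subst; subst₂)
open import Relation.Nullary using (¬_; yes; no; contradiction)
open import Relation.Unary using (Pred)

recip : ℚ → ℚ
recip p with p ℚ.≟ 0ℚ
... | yes _  = 0ℚ
... | no p≢0 = ℚ.1/_ p {{ℚ.≢-nonZero p≢0}}

module RationalLemmas where

  0<½ : 0ℚ ℚ.< ℚ.½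
  0<½ = ℚₚ.positive⁻¹ ℚ.½

  0<p*q : ∀ {p q} → 0ℚ ℚ.< p → 0ℚ ℚ.< q → 0ℚ ℚ.< p ℚ.* q
  0<p*q {p} {q} 0<p 0<q =
    ℚₚ.positive⁻¹ _ {{ℚₚ.pos*pos⇒pos p {{ℚ.positive 0<p}} q {{ℚ.positive 0<q}}}}

  ½+½ : ∀ ε → ε ℚ.* ℚ.½ ℚ.+ ε ℚ.* ℚ.½ ≡ ε
  ½+½ ε = trans (sym (ℚₚ.*-distribˡ-+ ε ℚ.½ ℚ.½)) (ℚₚ.*-identityʳ ε)

  swap-minus : ∀ p q → q ℚ.- p ≡ ℚ.- (p ℚ.- q)
  swap-minus = solve 2 (λ p q → q :- p := :- (p :- q)) refl
    where open +-*-Solver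

  q+[p-q] : ∀ p q → q ℚ.+ (p ℚ.- q) ≡ p
  q+[p-q] = solve 2 (λ p q → q :+ (p :- q) := p) refl
    where open +-*-Solver

  [q+ε]-q : ∀ q ε → (q ℚ.+ ε) ℚ.- q ≡ ε
  [q+ε]-q = solve 2 (λ q ε → (q :+ ε) :- q := ε) refl
    where open +-*-Solver

  p≤∣p∣ : ∀ p → p ℚ.≤ ℚ.∣ p ∣
  p≤∣p∣ p with ℚₚ.≤-total 0ℚ p
  ... | inj₁ 0≤p = ℚₚ.≤-reflexive (sym (ℚₚ.0≤p⇒∣p∣≡p 0≤p))
  ... | inj₂ p≤0 = ℚₚ.≤-trans p≤0 (ℚₚ.0≤∣p∣ p)

  ∣-∣-sym : ∀ p q → ℚ.∣ p ℚ.- q ∣ ≡ ℚ.∣ q ℚ.- p ∣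
  ∣-∣-sym p q = sym (trans (cong ℚ.∣_∣ (swap-minus p q)) (ℚₚ.∣-p∣≡∣p∣ _))

  close⇒≤ : ∀ {p q ε} → ℚ.∣ p ℚ.- q ∣ ℚ.≤ ε → p ℚ.≤ q ℚ.+ ε
  close⇒≤ {p} {q} {ε} h = subst (ℚ._≤ q ℚ.+ ε) (q+[p-q] p q)
    (ℚₚ.+-monoʳ-≤ q (ℚₚ.≤-trans (p≤∣p∣ _) h))

  ≤⇒close : ∀ {p q ε} → p ℚ.≤ q ℚ.+ ε → q ℚ.≤ p ℚ.+ ε → ℚ.∣ p ℚ.- q ∣ ℚ.≤ ε
  ≤⇒close {p} {q} {ε} h h′ with ℚₚ.∣p∣≡p∨∣p∣≡-p (p ℚ.- q)
  ... | inj₁ eq rewrite eq = subst (p ℚ.- q ℚ.≤_) ([q+ε]-q q ε) (ℚₚ.+-monoˡ-≤ (ℚ.- q) h)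
  ... | inj₂ eq rewrite eq = subst₂ ℚ._≤_ (swap-minus p q) ([q+ε]-q p ε)
                               (ℚₚ.+-monoˡ-≤ (ℚ.- p) h′)

  *-mono-≤ : ∀ {p q r s} → 0ℚ ℚ.≤ p → p ℚ.≤ q → 0ℚ ℚ.≤ r → r ℚ.≤ s → p ℚ.* r ℚ.≤ q ℚ.* s
  *-mono-≤ {p} {q} {r} {s} 0≤p p≤q 0≤r r≤s = ℚₚ.≤-trans
    (ℚₚ.*-monoʳ-≤-nonNeg r {{ℚ.nonNegative 0≤r}} p≤q)
    (ℚₚ.*-monoˡ-≤-nonNeg q {{ℚ.nonNegative (ℚₚ.≤-trans 0≤p p≤q)}} r≤s)

  fraction-≤ : ∀ r k r′ k′ e →
    r ℕ.* (suc k′ ℕ.* suc e) ℕ.≤ (r′ ℕ.* suc e ℕ.+ 1 ℕ.* suc k′) ℕ.* suc k →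
    (+ r ℚ./ suc k) ℚ.≤ (+ r′ ℚ./ suc k′) ℚ.+ (+ 1 ℚ./ suc e)
  fraction-≤ r k r′ k′ e h = ℚₚ.toℚᵘ-cancel-≤ (begin
    ℚ.toℚᵘ (+ r ℚ./ suc k)                      ≃⟨ ℚₚ.toℚᵘ-fromℚᵘ (mkℚᵘ (+ r) k) ⟩
    mkℚᵘ (+ r) k                                ≤⟨ ℚᵘ.*≤* (subst₂ ℤ._≤_ lhs rhs (ℤ.+≤+ h)) ⟩
    mkℚᵘ (+ r′) k′ ℚᵘ.+ mkℚᵘ (+ 1) e            ≃⟨ ℚᵘₚ.+-cong (ℚₚ.toℚᵘ-fromℚᵘ (mkℚᵘ (+ r′) k′))
                                                     (ℚₚ.toℚᵘ-fromℚᵘ (mkℚᵘ (+ 1) e)) ⟨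
    ℚ.toℚᵘ (+ r′ ℚ./ suc k′) ℚᵘ.+ ℚ.toℚᵘ (+ 1 ℚ./ suc e)
                                                ≃⟨ ℚₚ.toℚᵘ-homo-+ (+ r′ ℚ./ suc k′) (+ 1 ℚ./ suc e) ⟨
    ℚ.toℚᵘ ((+ r′ ℚ./ suc k′) ℚ.+ (+ 1 ℚ./ suc e)) ∎)
    where
    open ℚᵘₚ.≤-Reasoning
    lhs : + (r ℕ.* (suc k′ ℕ.* suc e)) ≡ + r ℤ.* + (suc k′ ℕ.* suc e)
    lhs = ℤₚ.pos-* r _
    rhs : + ((r′ ℕ.* suc e ℕ.+ 1 ℕ.* suc k′) ℕ.* suc k)
        ≡ (+ r′ ℤ.* + suc e ℤ.+ + 1 ℤ.* + suc k′) ℤ.* + suc k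
    rhs = trans (ℤₚ.pos-* (r′ ℕ.* suc e ℕ.+ 1 ℕ.* suc k′) (suc k)) (cong (ℤ._* + suc k)
            (cong₂ ℤ._+_ (ℤₚ.pos-* r′ (suc e)) (ℤₚ.pos-* 1 (suc k′))))

  fraction-≤⁻¹ : ∀ {p q} → 0ℚ ℚ.≤ p → 0ℚ ℚ.≤ q → ∀ e →
    p ℚ.≤ q ℚ.+ (+ 1 ℚ./ suc e) →
    ℤ.∣ ℚ.↥ p ∣ ℕ.* (ℚ.↧ₙ q ℕ.* suc e) ℕ.≤ (ℤ.∣ ℚ.↥ q ∣ ℕ.* suc e ℕ.+ 1 ℕ.* ℚ.↧ₙ q) ℕ.* ℚ.↧ₙ p
  fraction-≤⁻¹ {mkℚ -[1+ _ ] _ _} 0≤p _ _ _ with () ← ℚ.nonNegative 0≤p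
  fraction-≤⁻¹ {mkℚ (+ _) _ _} {mkℚ -[1+ _ ] _ _} _ 0≤q _ _ with () ← ℚ.nonNegative 0≤q
  fraction-≤⁻¹ {p@(mkℚ (+ r) k _)} {q@(mkℚ (+ r′) k′ _)} _ _ e p≤q+1/e =
    ℤₚ.drop‿+≤+ (subst₂ ℤ._≤_ (sym lhs) (sym rhs) (ℚᵘₚ.drop-*≤* ≤ᵘ))
    where
    ≤ᵘ : mkℚᵘ (+ r) k ℚᵘ.≤ mkℚᵘ (+ r′) k′ ℚᵘ.+ mkℚᵘ (+ 1) e
    ≤ᵘ = ℚᵘₚ.≤-respʳ-≃
           (ℚᵘₚ.≃-trans (ℚₚ.toℚᵘ-homo-+ q (+ 1 ℚ./ suc e))
             (ℚᵘₚ.+-congʳ (mkℚᵘ (+ r′) k′) (ℚₚ.toℚᵘ-fromℚᵘ (mkℚᵘ (+ 1) e))))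
           (ℚₚ.toℚᵘ-mono-≤ p≤q+1/e)
    lhs : + (r ℕ.* (suc k′ ℕ.* suc e)) ≡ + r ℤ.* + (suc k′ ℕ.* suc e)
    lhs = ℤₚ.pos-* r _
    rhs : + ((r′ ℕ.* suc e ℕ.+ 1 ℕ.* suc k′) ℕ.* suc k)
        ≡ (+ r′ ℤ.* + suc e ℤ.+ + 1 ℤ.* + suc k′) ℤ.* + suc k
    rhs = trans (ℤₚ.pos-* (r′ ℕ.* suc e ℕ.+ 1 ℕ.* suc k′) (suc k)) (cong (ℤ._* + suc k)
            (cong₂ ℤ._+_ (ℤₚ.pos-* r′ (suc e)) (ℤₚ.pos-* 1 (suc k′))))

  1/suc-positive : ∀ e → 0ℚ ℚ.< + 1 ℚ./ suc e
  1/suc-positive e = ℚₚ.positive⁻¹ _ {{ℚₚ.normalize-pos 1 (suc e)}}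

  archimedean : ∀ {ε} → 0ℚ ℚ.< ε → ∃[ e ] + 1 ℚ./ suc e ℚ.≤ ε
  archimedean {ε@(mkℚ -[1+ _ ] _ _)} 0<ε with () ← ℚ.positive 0<ε
  archimedean {ε@(mkℚ (+ zero) _ _)} 0<ε with () ← ℚ.positive 0<ε
  archimedean {ε@(mkℚ (+ suc n) d _)} _ = d , ℚₚ.toℚᵘ-cancel-≤
    (ℚᵘₚ.≤-respˡ-≃ (ℚᵘₚ.≃-sym (ℚₚ.toℚᵘ-fromℚᵘ (mkℚᵘ (+ 1) d)))
      (ℚᵘ.*≤* (ℤₚ.*-monoʳ-≤-nonNeg (+ suc d) {+ 1} {+ suc n} (ℤ.+≤+ (s≤s z≤n)))))

  recip-inverse : ∀ {p} → 0ℚ ℚ.< p → recip p ℚ.* p ≡ 1ℚ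
  recip-inverse {p} 0<p with p ℚ.≟ 0ℚ
  ... | yes refl = contradiction 0<p (ℚₚ.<-irrefl refl)
  ... | no p≢0   = ℚₚ.*-inverseˡ p {{ℚ.≢-nonZero p≢0}}

  recip-positive : ∀ {p} → 0ℚ ℚ.< p → 0ℚ ℚ.< recip p
  recip-positive {p} 0<p = ℚₚ.*-cancelʳ-<-nonNeg p {{ℚ.nonNegative (ℚₚ.<⇒≤ 0<p)}}
    (subst₂ ℚ._<_ (sym (ℚₚ.*-zeroˡ p)) (sym (recip-inverse 0<p)) (ℚₚ.positive⁻¹ 1ℚ))

  recip-antimono : ∀ {p q} → 0ℚ ℚ.< p → p ℚ.≤ q → recip q ℚ.≤ recip p
  recip-antimono {p} {q} 0<p p≤q = ℚₚ.*-cancelʳ-≤-pos q {{ℚ.positive 0<q}}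
    (subst (ℚ._≤ recip p ℚ.* q) (trans (recip-inverse 0<p) (sym (recip-inverse 0<q)))
      (ℚₚ.*-monoˡ-≤-nonNeg (recip p) {{ℚ.nonNegative (ℚₚ.<⇒≤ (recip-positive 0<p))}} p≤q))
    where 0<q = ℚₚ.<-≤-trans 0<p p≤q

  recip-minus : ∀ {p q} → 0ℚ ℚ.< p → 0ℚ ℚ.< q →
    recip p ℚ.- recip q ≡ (recip p ℚ.* recip q) ℚ.* (q ℚ.- p)
  recip-minus {p} {q} 0<p 0<q = sym (trans (expand p q (recip p) (recip q))
    (trans (cong₂ (λ a b → recip p ℚ.* a ℚ.- recip q ℚ.* b) (recip-inverse 0<q) (recip-inverse 0<p))
      (cong₂ (λ a b → a ℚ.- b) (ℚₚ.*-identityʳ (recip p)) (ℚₚ.*-identityʳ (recip q)))))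
    where
    expand : ∀ p q p⁻¹ q⁻¹ →
      (p⁻¹ ℚ.* q⁻¹) ℚ.* (q ℚ.- p) ≡ p⁻¹ ℚ.* (q⁻¹ ℚ.* q) ℚ.- q⁻¹ ℚ.* (p⁻¹ ℚ.* p)
    expand = solve 4 (λ p q p⁻¹ q⁻¹ →
      (p⁻¹ :* q⁻¹) :* (q :- p) := p⁻¹ :* (q⁻¹ :* q) :- q⁻¹ :* (p⁻¹ :* p)) refl
      where open +-*-Solver

open RationalLemmas

-- Real numbers are Cauchy sequences of rationals; algebraic operations act
-- termwise, and _≤_ and _<_ do not distinguish sequences whose difference
-- tends to 0.

Eventually : (ℕ → Set) → Set
Eventually P = ∃[ N ] ∀ n → N ℕ.≤ n → P n

Cauchy : (ℕ → ℚ) → Set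
Cauchy a = ∀ ε → 0ℚ ℚ.< ε →
  ∃[ N ] ∀ m n → N ℕ.≤ m → N ℕ.≤ n → ℚ.∣ a m ℚ.- a n ∣ ℚ.≤ ε

record ℝ : Set where
  no-eta-equality
  field
    seq    : ℕ → ℚ
    cauchy : Cauchy seq

open ℝ public

infix 4 _≤_ _<_

record _≤_ (x y : ℝ) : Set where
  constructor ≤-intro
  field
    eventually-≤ : ∀ ε → 0ℚ ℚ.< ε → Eventually λ n → seq x n ℚ.≤ seq y n ℚ.+ ε

open _≤_ public

record _<_ (x y : ℝ) : Set where
  constructor <-intro
  field
    gap          : ℚ
    gap-positive : 0ℚ ℚ.< gap
    eventually-< : Eventually λ n → seq x n ℚ.+ gap ℚ.≤ seq y n

open _<_ public

fromℚ : ℚ → ℝ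
seq    (fromℚ p) _ = p
cauchy (fromℚ p) ε 0<ε = 0 , λ _ _ _ _ →
  subst (ℚ._≤ ε) (sym (cong ℚ.∣_∣ (ℚₚ.+-inverseʳ p))) (ℚₚ.<⇒≤ 0<ε)

fromℕ : ℕ → ℝ
fromℕ n = fromℚ (+ n ℚ./ 1)

0ℝ 1ℝ 2ℝ : ℝ
0ℝ = fromℕ 0
1ℝ = fromℕ 1
2ℝ = fromℕ 2

infixl 6 _+_ _-_
infixl 7 _*_ _/_
infix  8 -_
infixr 8 _^_

_+_ : ℝ → ℝ → ℝ
seq    (x + y) n = seq x n ℚ.+ seq y n
cauchy (x + y) ε 0<ε =
  let 0<ε/2  = 0<p*q 0<ε 0<½
      M , hx = cauchy x _ 0<ε/2
      N , hy = cauchy y _ 0<ε/2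
  in M ℕ.⊔ N , λ m n M⊔N≤m M⊔N≤n →
    ℚₚ.≤-trans
      (subst (λ d → ℚ.∣ d ∣ ℚ.≤ ℚ.∣ seq x m ℚ.- seq x n ∣ ℚ.+ ℚ.∣ seq y m ℚ.- seq y n ∣)
        (regroup (seq x m) (seq x n) (seq y m) (seq y n))
        (ℚₚ.∣p+q∣≤∣p∣+∣q∣ (seq x m ℚ.- seq x n) (seq y m ℚ.- seq y n)))
      (subst (_ ℚ.≤_) (½+½ ε)
        (ℚₚ.+-mono-≤
          (hx m n (ℕₚ.m⊔n≤o⇒m≤o M N M⊔N≤m) (ℕₚ.m⊔n≤o⇒m≤o M N M⊔N≤n))
          (hy m n (ℕₚ.m⊔n≤o⇒n≤o M N M⊔N≤m) (ℕₚ.m⊔n≤o⇒n≤o M N M⊔N≤n))))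
  where
  regroup : ∀ a b c d → (a ℚ.- b) ℚ.+ (c ℚ.- d) ≡ (a ℚ.+ c) ℚ.- (b ℚ.+ d)
  regroup = solve 4 (λ a b c d → (a :- b) :+ (c :- d) := (a :+ c) :- (b :+ d)) refl
    where open +-*-Solver

-_ : ℝ → ℝ
seq    (- x) n = ℚ.- seq x n
cauchy (- x) ε 0<ε =
  let N , h = cauchy x ε 0<ε
  in N , λ m n N≤m N≤n → subst (ℚ._≤ ε)
       (trans (sym (ℚₚ.∣-p∣≡∣p∣ _)) (cong ℚ.∣_∣ (ℚₚ.neg-distrib-+ (seq x m) (ℚ.- seq x n))))
       (h m n N≤m N≤n)

_-_ : ℝ → ℝ → ℝ
x - y = x + (- y)

∣_∣ : ℝ → ℝ
seq    (∣ x ∣) n = ℚ.∣ seq x n ∣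
cauchy (∣ x ∣) ε 0<ε =
  let N , h = cauchy x ε 0<ε
  in N , λ m n N≤m N≤n → ≤⇒close (bound (seq x m) (seq x n) (h m n N≤m N≤n)) (bound (seq x n) (seq x m) (h n m N≤n N≤m))
  where
  bound : ∀ p q {ε} → ℚ.∣ p ℚ.- q ∣ ℚ.≤ ε → ℚ.∣ p ∣ ℚ.≤ ℚ.∣ q ∣ ℚ.+ ε
  bound p q {ε} h = ℚₚ.≤-trans
    (subst (λ r → ℚ.∣ r ∣ ℚ.≤ ℚ.∣ q ∣ ℚ.+ ℚ.∣ p ℚ.- q ∣) (q+[p-q] p q) (ℚₚ.∣p+q∣≤∣p∣+∣q∣ q _))
    (ℚₚ.+-monoʳ-≤ ℚ.∣ q ∣ h)

bounded : ∀ x → ∃[ B ] 0ℚ ℚ.< B × Eventually λ n → ℚ.∣ seq x n ∣ ℚ.≤ B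
bounded x =
  let N , h = cauchy ∣ x ∣ 1ℚ (ℚₚ.positive⁻¹ 1ℚ)
  in ℚ.∣ seq x N ∣ ℚ.+ 1ℚ
   , ℚₚ.+-mono-≤-< (ℚₚ.0≤∣p∣ (seq x N)) (ℚₚ.positive⁻¹ 1ℚ)
   , N , λ n N≤n → close⇒≤ (h n N N≤n ℕₚ.≤-refl)

_*_ : ℝ → ℝ → ℝ
seq    (x * y) n = seq x n ℚ.* seq y n
cauchy (x * y) ε 0<ε =
  let A , 0<A , K , hA = bounded x
      B , 0<B , L , hB = bounded y
      0<ε/2  = 0<p*q 0<ε 0<½
      0<ε/2A = 0<p*q 0<ε/2 (recip-positive 0<A)
      0<ε/2B = 0<p*q 0<ε/2 (recip-positive 0<B)
      M , hx = cauchy x _ 0<ε/2B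
      N , hy = cauchy y _ 0<ε/2A
  in (K ℕ.⊔ L) ℕ.⊔ (M ℕ.⊔ N) , λ m n ≤m ≤n →
    let KL≤m = ℕₚ.m⊔n≤o⇒m≤o (K ℕ.⊔ L) (M ℕ.⊔ N) ≤m
        KL≤n = ℕₚ.m⊔n≤o⇒m≤o (K ℕ.⊔ L) (M ℕ.⊔ N) ≤n
        MN≤m = ℕₚ.m⊔n≤o⇒n≤o (K ℕ.⊔ L) (M ℕ.⊔ N) ≤m
        MN≤n = ℕₚ.m⊔n≤o⇒n≤o (K ℕ.⊔ L) (M ℕ.⊔ N) ≤n
    in begin
      ℚ.∣ seq x m ℚ.* seq y m ℚ.- seq x n ℚ.* seq y n ∣
        ≡⟨ cong ℚ.∣_∣ (regroup (seq x m) (seq x n) (seq y m) (seq y n)) ⟩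
      ℚ.∣ seq x m ℚ.* (seq y m ℚ.- seq y n) ℚ.+ (seq x m ℚ.- seq x n) ℚ.* seq y n ∣
        ≤⟨ ℚₚ.∣p+q∣≤∣p∣+∣q∣ (seq x m ℚ.* (seq y m ℚ.- seq y n)) _ ⟩
      ℚ.∣ seq x m ℚ.* (seq y m ℚ.- seq y n) ∣ ℚ.+ ℚ.∣ (seq x m ℚ.- seq x n) ℚ.* seq y n ∣
        ≡⟨ cong₂ ℚ._+_ (ℚₚ.∣p*q∣≡∣p∣*∣q∣ (seq x m) _) (ℚₚ.∣p*q∣≡∣p∣*∣q∣ (seq x m ℚ.- seq x n) (seq y n)) ⟩
      ℚ.∣ seq x m ∣ ℚ.* ℚ.∣ seq y m ℚ.- seq y n ∣ ℚ.+ ℚ.∣ seq x m ℚ.- seq x n ∣ ℚ.* ℚ.∣ seq y n ∣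
        ≤⟨ ℚₚ.+-mono-≤
             (*-mono-≤ (ℚₚ.0≤∣p∣ _) (hA m (ℕₚ.m⊔n≤o⇒m≤o K L KL≤m)) (ℚₚ.0≤∣p∣ _)
               (hy m n (ℕₚ.m⊔n≤o⇒n≤o M N MN≤m) (ℕₚ.m⊔n≤o⇒n≤o M N MN≤n)))
             (*-mono-≤ (ℚₚ.0≤∣p∣ _) (hx m n (ℕₚ.m⊔n≤o⇒m≤o M N MN≤m) (ℕₚ.m⊔n≤o⇒m≤o M N MN≤n))
               (ℚₚ.0≤∣p∣ _) (hB n (ℕₚ.m⊔n≤o⇒n≤o K L KL≤n))) ⟩
      A ℚ.* (ε ℚ.* ℚ.½ ℚ.* recip A) ℚ.+ ε ℚ.* ℚ.½ ℚ.* recip B ℚ.* B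
        ≡⟨ cong₂ ℚ._+_ (trans (ℚₚ.*-comm A _) (cancel (ε ℚ.* ℚ.½) 0<A)) (cancel (ε ℚ.* ℚ.½) 0<B) ⟩
      ε ℚ.* ℚ.½ ℚ.+ ε ℚ.* ℚ.½
        ≡⟨ ½+½ ε ⟩
      ε ∎
  where
  open ℚₚ.≤-Reasoning
  regroup : ∀ a b c d → a ℚ.* c ℚ.- b ℚ.* d ≡ a ℚ.* (c ℚ.- d) ℚ.+ (a ℚ.- b) ℚ.* d
  regroup = solve 4 (λ a b c d → a :* c :- b :* d := a :* (c :- d) :+ (a :- b) :* d) refl
    where open +-*-Solver
  cancel : ∀ p {q} → 0ℚ ℚ.< q → p ℚ.* recip q ℚ.* q ≡ p
  cancel p {q} 0<q = trans (ℚₚ.*-assoc p _ q)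
    (trans (cong (p ℚ.*_) (recip-inverse 0<q)) (ℚₚ.*-identityʳ p))

record ℝ⁺ : Set where
  constructor _,>0_
  field
    value    : ℝ
    positive : 0ℝ < value

open ℝ⁺ public

-- Since y is eventually bounded away from 0, only finitely many terms of
-- the sequence of reciprocals take the junk value recip 0 = 0.
_⁻¹ : ℝ⁺ → ℝ
seq    (y ⁻¹) n = recip (seq (value y) n)
cauchy ((y ,>0 <-intro c 0<c (K , c≤y)) ⁻¹) ε 0<ε =
  let N , h = cauchy y (ε ℚ.* (c ℚ.* c)) (0<p*q 0<ε (0<p*q 0<c 0<c))
  in K ℕ.⊔ N , λ m n ≤m ≤n →
    let c≤ym  = c≤ (c≤y m (ℕₚ.m⊔n≤o⇒m≤o K N ≤m))
        c≤yn  = c≤ (c≤y n (ℕₚ.m⊔n≤o⇒m≤o K N ≤n))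
        0<ym  = ℚₚ.<-≤-trans 0<c c≤ym
        0<yn  = ℚₚ.<-≤-trans 0<c c≤yn
        0≤1/m = ℚₚ.<⇒≤ (recip-positive 0<ym)
        0≤1/n = ℚₚ.<⇒≤ (recip-positive 0<yn)
        0≤1/c = ℚₚ.<⇒≤ (recip-positive 0<c)
        0≤1/mn = ℚₚ.<⇒≤ (0<p*q (recip-positive 0<ym) (recip-positive 0<yn))
    in begin
      ℚ.∣ recip (seq y m) ℚ.- recip (seq y n) ∣
        ≡⟨ cong ℚ.∣_∣ (recip-minus 0<ym 0<yn) ⟩
      ℚ.∣ (recip (seq y m) ℚ.* recip (seq y n)) ℚ.* (seq y n ℚ.- seq y m) ∣
        ≡⟨ ℚₚ.∣p*q∣≡∣p∣*∣q∣ (recip (seq y m) ℚ.* recip (seq y n)) _ ⟩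
      ℚ.∣ recip (seq y m) ℚ.* recip (seq y n) ∣ ℚ.* ℚ.∣ seq y n ℚ.- seq y m ∣
        ≡⟨ cong (ℚ._* ℚ.∣ seq y n ℚ.- seq y m ∣) (ℚₚ.0≤p⇒∣p∣≡p 0≤1/mn) ⟩
      (recip (seq y m) ℚ.* recip (seq y n)) ℚ.* ℚ.∣ seq y n ℚ.- seq y m ∣
        ≤⟨ *-mono-≤ 0≤1/mn
             (*-mono-≤ 0≤1/m (recip-antimono 0<c c≤ym) 0≤1/n (recip-antimono 0<c c≤yn))
             (ℚₚ.0≤∣p∣ _)
             (h n m (ℕₚ.m⊔n≤o⇒n≤o K N ≤n) (ℕₚ.m⊔n≤o⇒n≤o K N ≤m)) ⟩
      (recip c ℚ.* recip c) ℚ.* (ε ℚ.* (c ℚ.* c))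
        ≡⟨ regroup ε c (recip c) ⟩
      ε ℚ.* ((recip c ℚ.* c) ℚ.* (recip c ℚ.* c))
        ≡⟨ cong (λ t → ε ℚ.* (t ℚ.* t)) (recip-inverse 0<c) ⟩
      ε ℚ.* (1ℚ ℚ.* 1ℚ)
        ≡⟨ ℚₚ.*-identityʳ ε ⟩
      ε ∎
  where
  open ℚₚ.≤-Reasoning
  c≤ : ∀ {p} → 0ℚ ℚ.+ c ℚ.≤ p → c ℚ.≤ p
  c≤ = subst (ℚ._≤ _) (ℚₚ.+-identityˡ c)
  regroup : ∀ ε c c⁻¹ →
    (c⁻¹ ℚ.* c⁻¹) ℚ.* (ε ℚ.* (c ℚ.* c)) ≡ ε ℚ.* ((c⁻¹ ℚ.* c) ℚ.* (c⁻¹ ℚ.* c))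
  regroup = solve 3 (λ ε c c⁻¹ →
    (c⁻¹ :* c⁻¹) :* (ε :* (c :* c)) := ε :* ((c⁻¹ :* c) :* (c⁻¹ :* c))) refl
    where open +-*-Solver

_/_ : ℝ → ℝ⁺ → ℝ
x / y = x * y ⁻¹

fromℕ⁺ : (n : ℕ) .{{_ : NonZero n}} → ℝ⁺
value    (fromℕ⁺ n) = fromℕ n
positive (fromℕ⁺ n@(suc _)) = <-intro 1ℚ (ℚₚ.positive⁻¹ 1ℚ)
  (0 , λ _ _ → ℚₚ.toℚᵘ-cancel-≤ (ℚᵘₚ.≤-respʳ-≃
    (ℚᵘₚ.≃-sym (ℚₚ.toℚᵘ-fromℚᵘ (mkℚᵘ (+ n) 0)))
    (ℚᵘ.*≤* (ℤ.+≤+ (s≤s z≤n)))))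

-- The largest r ≤ bound with r ^ q ≤ M.
searchRoot : (q M bound : ℕ) → ℕ
searchRoot q M zero = 0
searchRoot q M (suc r) with suc r ℕ.^ q ℕ.≤? M
... | yes _ = suc r
... | no  _ = searchRoot q M r

floorRoot : (q M : ℕ) → ℕ
floorRoot q M = searchRoot q M M

-- For a = p/q ≥ 0, powApprox N a k = ⌊ K N^(p/q) ⌋ / K with K = k + 1:
-- the floor is the largest r with r^q ≤ N^p K^q.
powNumerator : (N : ℕ) (a : ℚ) (k : ℕ) → ℕ
powNumerator N a k = floorRoot (ℚ.↧ₙ a) (N ℕ.^ ℤ.∣ ℚ.↥ a ∣ ℕ.* suc k ℕ.^ ℚ.↧ₙ a)

powApprox : (N : ℕ) (a : ℚ) (k : ℕ) → ℚ
powApprox N a k = + powNumerator N a k ℚ./ suc k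

module PowerLemmas where

  floorRoot-upper : ∀ q .{{_ : NonZero q}} M → floorRoot q M ℕ.^ q ℕ.≤ M
  floorRoot-upper q@(suc _) M = go M
    where
    go : ∀ b → searchRoot q M b ℕ.^ q ℕ.≤ M
    go zero = z≤n
    go (suc b) with suc b ℕ.^ q ℕ.≤? M
    ... | yes b^q≤M = b^q≤M
    ... | no  _     = go b

  floorRoot-lower : ∀ q .{{_ : NonZero q}} M → M ℕ.< suc (floorRoot q M) ℕ.^ q
  floorRoot-lower q@(suc q-1) M = go M
    (ℕₚ.m≤m*n (suc M) (suc M ℕ.^ q-1) {{ℕₚ.m^n≢0 (suc M) q-1}})
    where
    go : ∀ b → M ℕ.< suc b ℕ.^ q → M ℕ.< suc (searchRoot q M b) ℕ.^ q
    go zero M< = M<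
    go (suc b) M< with suc b ℕ.^ q ℕ.≤? M
    ... | yes _    = M<
    ... | no b^q≰M = go b (ℕₚ.≰⇒> b^q≰M)

  ^-cancelˡ-≤ : ∀ n .{{_ : NonZero n}} {a b} → a ℕ.^ n ℕ.≤ b ℕ.^ n → a ℕ.≤ b
  ^-cancelˡ-≤ n {a} {b} a^n≤b^n with a ℕ.≤? b
  ... | yes a≤b = a≤b
  ... | no  a≰b = contradiction (ℕₚ.^-monoˡ-< n (ℕₚ.≰⇒> a≰b)) (ℕₚ.≤⇒≯ a^n≤b^n)

  ^-cancelˡ-< : ∀ n {a b} → a ℕ.^ n ℕ.< b ℕ.^ n → a ℕ.< b
  ^-cancelˡ-< n {a} {b} a^n<b^n with b ℕ.≤? a
  ... | yes b≤a = contradiction (ℕₚ.^-monoˡ-≤ n b≤a) (ℕₚ.<⇒≱ a^n<b^n)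
  ... | no  b≰a = ℕₚ.≰⇒> b≰a

  ^-distribʳ-* : ∀ n a b → (a ℕ.* b) ℕ.^ n ≡ a ℕ.^ n ℕ.* b ℕ.^ n
  ^-distribʳ-* zero    a b = refl
  ^-distribʳ-* (suc n) a b = trans (cong (a ℕ.* b ℕ.*_) (^-distribʳ-* n a b))
    (regroup a b (a ℕ.^ n) (b ℕ.^ n))
    where
    regroup : ∀ a b c d → a ℕ.* b ℕ.* (c ℕ.* d) ≡ a ℕ.* c ℕ.* (b ℕ.* d)
    regroup = solve-∀

  bernoulli : ∀ h .{{_ : NonZero h}} N → N ℕ.* h ℕ.^ h ℕ.≤ (h ℕ.+ N) ℕ.^ h
  bernoulli h N = ℕₚ.≤-trans (ℕₚ.m≤n+m _ (h ℕ.^ h)) (ℕₚ.*-cancelˡ-≤ h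
    (subst (ℕ._≤ h ℕ.* (h ℕ.+ N) ℕ.^ h) (factor h N (h ℕ.^ h)) (go h)))
    where
    factor : ∀ h N t → (h ℕ.+ h ℕ.* N) ℕ.* t ≡ h ℕ.* (t ℕ.+ N ℕ.* t)
    factor = solve-∀
    expand : ∀ h N j t →
      (h ℕ.+ N) ℕ.* ((h ℕ.+ j ℕ.* N) ℕ.* t) ≡ (h ℕ.+ (1 ℕ.+ j) ℕ.* N) ℕ.* (h ℕ.* t) ℕ.+ j ℕ.* N ℕ.* N ℕ.* t
    expand = solve-∀
    go : ∀ j → (h ℕ.+ j ℕ.* N) ℕ.* h ℕ.^ j ℕ.≤ h ℕ.* (h ℕ.+ N) ℕ.^ j
    go zero    = ℕₚ.≤-reflexive (cong (ℕ._* 1) (ℕₚ.+-identityʳ h))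
    go (suc j) = begin
      (h ℕ.+ suc j ℕ.* N) ℕ.* (h ℕ.* h ℕ.^ j)       ≤⟨ ℕₚ.m≤m+n _ _ ⟩
      (h ℕ.+ suc j ℕ.* N) ℕ.* (h ℕ.* h ℕ.^ j) ℕ.+ j ℕ.* N ℕ.* N ℕ.* h ℕ.^ j
                                                     ≡⟨ expand h N j (h ℕ.^ j) ⟨
      (h ℕ.+ N) ℕ.* ((h ℕ.+ j ℕ.* N) ℕ.* h ℕ.^ j)   ≤⟨ ℕₚ.*-monoʳ-≤ (h ℕ.+ N) (go j) ⟩
      (h ℕ.+ N) ℕ.* (h ℕ.* (h ℕ.+ N) ℕ.^ j)         ≡⟨ swap (h ℕ.+ N) h ((h ℕ.+ N) ℕ.^ j) ⟩
      h ℕ.* ((h ℕ.+ N) ℕ.* (h ℕ.+ N) ℕ.^ j)         ∎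
      where
      open ℕₚ.≤-Reasoning
      swap : ∀ a b c → a ℕ.* (b ℕ.* c) ≡ b ℕ.* (a ℕ.* c)
      swap = solve-∀

  module _ (N : ℕ) .{{_ : NonZero N}} where

    compare : ∀ h q q′ .{{_ : NonZero h}} .{{_ : NonZero q}} .{{_ : NonZero q′}}
      p p′ K K′ r S →
      r ℕ.^ q ℕ.≤ N ℕ.^ p ℕ.* K ℕ.^ q →
      N ℕ.^ p′ ℕ.* K′ ℕ.^ q′ ℕ.≤ S ℕ.^ q′ →
      p ℕ.* (q′ ℕ.* h) ℕ.≤ (p′ ℕ.* h ℕ.+ 1 ℕ.* q′) ℕ.* q →
      h ℕ.* (r ℕ.* K′) ℕ.≤ (h ℕ.+ N) ℕ.* (S ℕ.* K)
    compare h q q′ p p′ K K′ r S r≤ ≤S p≤p′ = ^-cancelˡ-≤ h (begin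
      (h ℕ.* (r ℕ.* K′)) ℕ.^ h              ≡⟨ ^-distribʳ-* h h _ ⟩
      h ℕ.^ h ℕ.* (r ℕ.* K′) ℕ.^ h          ≤⟨ ℕₚ.*-monoʳ-≤ (h ℕ.^ h) step ⟩
      h ℕ.^ h ℕ.* ((S ℕ.* K) ℕ.^ h ℕ.* N)   ≡⟨ regroup₁ (h ℕ.^ h) _ N ⟩
      N ℕ.* h ℕ.^ h ℕ.* (S ℕ.* K) ℕ.^ h     ≤⟨ ℕₚ.*-monoˡ-≤ _ (bernoulli h N) ⟩
      (h ℕ.+ N) ℕ.^ h ℕ.* (S ℕ.* K) ℕ.^ h   ≡⟨ ^-distribʳ-* h (h ℕ.+ N) _ ⟨
      ((h ℕ.+ N) ℕ.* (S ℕ.* K)) ℕ.^ h       ∎)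
      where
      open ℕₚ.≤-Reasoning
      t = h ℕ.* (q ℕ.* q′)

      regroup₁ : ∀ a b c → a ℕ.* (b ℕ.* c) ≡ c ℕ.* a ℕ.* b
      regroup₁ = solve-∀
      regroup₂ : ∀ a b c d → a ℕ.* b ℕ.* c ℕ.* d ≡ a ℕ.* d ℕ.* (b ℕ.* c)
      regroup₂ = solve-∀
      regroup₃ : ∀ a b c → a ℕ.* (b ℕ.* c) ≡ a ℕ.* c ℕ.* b
      regroup₃ = solve-∀
      exponent₁ : ∀ q q′ h → q ℕ.* (q′ ℕ.* h) ≡ h ℕ.* (q ℕ.* q′)
      exponent₁ = solve-∀
      exponent₂ : ∀ q q′ h → q′ ℕ.* (h ℕ.* q) ≡ h ℕ.* (q ℕ.* q′)
      exponent₂ = solve-∀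
      exponent₃ : ∀ p′ h q′ q →
        (p′ ℕ.* h ℕ.+ 1 ℕ.* q′) ℕ.* q ≡ p′ ℕ.* (h ℕ.* q) ℕ.+ q ℕ.* q′
      exponent₃ = solve-∀

      power : ∀ a b c {n} → b ℕ.* c ≡ n → (a ℕ.^ b) ℕ.^ c ≡ a ℕ.^ n
      power a b c eq = trans (ℕₚ.^-*-assoc a b c) (cong (a ℕ.^_) eq)

      r^t≤ : r ℕ.^ t ℕ.≤ N ℕ.^ (p ℕ.* (q′ ℕ.* h)) ℕ.* K ℕ.^ t
      r^t≤ = begin
        r ℕ.^ t                                                 ≡⟨ power r q _ (exponent₁ q q′ h) ⟨
        (r ℕ.^ q) ℕ.^ (q′ ℕ.* h)                                ≤⟨ ℕₚ.^-monoˡ-≤ (q′ ℕ.* h) r≤ ⟩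
        (N ℕ.^ p ℕ.* K ℕ.^ q) ℕ.^ (q′ ℕ.* h)                    ≡⟨ ^-distribʳ-* (q′ ℕ.* h) _ _ ⟩
        (N ℕ.^ p) ℕ.^ (q′ ℕ.* h) ℕ.* (K ℕ.^ q) ℕ.^ (q′ ℕ.* h)   ≡⟨ cong₂ ℕ._*_ (ℕₚ.^-*-assoc N p _)
                                                                     (power K q _ (exponent₁ q q′ h)) ⟩
        N ℕ.^ (p ℕ.* (q′ ℕ.* h)) ℕ.* K ℕ.^ t                    ∎

      N^p≤ : N ℕ.^ (p ℕ.* (q′ ℕ.* h)) ℕ.≤ N ℕ.^ (p′ ℕ.* (h ℕ.* q)) ℕ.* N ℕ.^ (q ℕ.* q′)
      N^p≤ = begin
        N ℕ.^ (p ℕ.* (q′ ℕ.* h))                             ≤⟨ ℕₚ.^-monoʳ-≤ N p≤p′ ⟩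
        N ℕ.^ ((p′ ℕ.* h ℕ.+ 1 ℕ.* q′) ℕ.* q)                ≡⟨ cong (N ℕ.^_) (exponent₃ p′ h q′ q) ⟩
        N ℕ.^ (p′ ℕ.* (h ℕ.* q) ℕ.+ q ℕ.* q′)                ≡⟨ ℕₚ.^-distribˡ-+-* N (p′ ℕ.* (h ℕ.* q)) _ ⟩
        N ℕ.^ (p′ ℕ.* (h ℕ.* q)) ℕ.* N ℕ.^ (q ℕ.* q′)        ∎

      ≤S^t : N ℕ.^ (p′ ℕ.* (h ℕ.* q)) ℕ.* K′ ℕ.^ t ℕ.≤ S ℕ.^ t
      ≤S^t = begin
        N ℕ.^ (p′ ℕ.* (h ℕ.* q)) ℕ.* K′ ℕ.^ t                    ≡⟨ cong₂ ℕ._*_ (ℕₚ.^-*-assoc N p′ _)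
                                                                     (power K′ q′ _ (exponent₂ q q′ h)) ⟨
        (N ℕ.^ p′) ℕ.^ (h ℕ.* q) ℕ.* (K′ ℕ.^ q′) ℕ.^ (h ℕ.* q)   ≡⟨ ^-distribʳ-* (h ℕ.* q) _ _ ⟨
        (N ℕ.^ p′ ℕ.* K′ ℕ.^ q′) ℕ.^ (h ℕ.* q)                   ≤⟨ ℕₚ.^-monoˡ-≤ (h ℕ.* q) ≤S ⟩
        (S ℕ.^ q′) ℕ.^ (h ℕ.* q)                                 ≡⟨ power S q′ _ (exponent₂ q q′ h) ⟩
        S ℕ.^ t                                                  ∎

      step : (r ℕ.* K′) ℕ.^ h ℕ.≤ (S ℕ.* K) ℕ.^ h ℕ.* N
      step = ^-cancelˡ-≤ (q ℕ.* q′) {{ℕₚ.m*n≢0 q q′}} (begin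
        ((r ℕ.* K′) ℕ.^ h) ℕ.^ (q ℕ.* q′)          ≡⟨ ℕₚ.^-*-assoc _ h _ ⟩
        (r ℕ.* K′) ℕ.^ t                           ≡⟨ ^-distribʳ-* t r K′ ⟩
        r ℕ.^ t ℕ.* K′ ℕ.^ t                       ≤⟨ ℕₚ.*-monoˡ-≤ (K′ ℕ.^ t)
                                                        (ℕₚ.≤-trans r^t≤ (ℕₚ.*-monoˡ-≤ (K ℕ.^ t) N^p≤)) ⟩
        N ℕ.^ (p′ ℕ.* (h ℕ.* q)) ℕ.* N ℕ.^ (q ℕ.* q′) ℕ.* K ℕ.^ t ℕ.* K′ ℕ.^ t
                                                   ≡⟨ regroup₂ (N ℕ.^ (p′ ℕ.* (h ℕ.* q))) _ _ _ ⟩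
        N ℕ.^ (p′ ℕ.* (h ℕ.* q)) ℕ.* K′ ℕ.^ t ℕ.* (N ℕ.^ (q ℕ.* q′) ℕ.* K ℕ.^ t)
                                                   ≤⟨ ℕₚ.*-monoˡ-≤ _ ≤S^t ⟩
        S ℕ.^ t ℕ.* (N ℕ.^ (q ℕ.* q′) ℕ.* K ℕ.^ t) ≡⟨ regroup₃ (S ℕ.^ t) _ _ ⟩
        S ℕ.^ t ℕ.* K ℕ.^ t ℕ.* N ℕ.^ (q ℕ.* q′)   ≡⟨ cong (ℕ._* N ℕ.^ (q ℕ.* q′)) (^-distribʳ-* t S K) ⟨
        (S ℕ.* K) ℕ.^ t ℕ.* N ℕ.^ (q ℕ.* q′)       ≡⟨ cong (ℕ._* N ℕ.^ (q ℕ.* q′)) (ℕₚ.^-*-assoc _ h _) ⟨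
        ((S ℕ.* K) ℕ.^ h) ℕ.^ (q ℕ.* q′) ℕ.* N ℕ.^ (q ℕ.* q′)
                                                   ≡⟨ ^-distribʳ-* (q ℕ.* q′) _ N ⟨
        ((S ℕ.* K) ℕ.^ h ℕ.* N) ℕ.^ (q ℕ.* q′)     ∎)

    root-bound : ∀ q .{{_ : NonZero q}} p K r A →
      r ℕ.^ q ℕ.≤ N ℕ.^ p ℕ.* K ℕ.^ q → p ℕ.≤ A ℕ.* q → r ℕ.≤ N ℕ.^ A ℕ.* K
    root-bound q p K r A r≤ p≤ = ^-cancelˡ-≤ q (begin
      r ℕ.^ q                          ≤⟨ r≤ ⟩
      N ℕ.^ p ℕ.* K ℕ.^ q              ≤⟨ ℕₚ.*-monoˡ-≤ (K ℕ.^ q) (ℕₚ.^-monoʳ-≤ N p≤) ⟩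
      N ℕ.^ (A ℕ.* q) ℕ.* K ℕ.^ q      ≡⟨ cong (ℕ._* K ℕ.^ q) (ℕₚ.^-*-assoc N A q) ⟨
      (N ℕ.^ A) ℕ.^ q ℕ.* K ℕ.^ q      ≡⟨ ^-distribʳ-* q (N ℕ.^ A) K ⟨
      (N ℕ.^ A ℕ.* K) ℕ.^ q            ∎)
      where open ℕₚ.≤-Reasoning

    fineness : (A e : ℕ) → ℕ
    fineness A e = 2 ℕ.* suc (suc (N ℕ.^ A) ℕ.* N) ℕ.* suc e

    combine : ∀ A e r r′ K K′ .{{_ : NonZero K′}} →
      fineness A e ℕ.* (r ℕ.* K′) ℕ.≤ (fineness A e ℕ.+ N) ℕ.* (suc r′ ℕ.* K) →
      r′ ℕ.≤ N ℕ.^ A ℕ.* K′ →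
      2 ℕ.* suc e ℕ.≤ K′ →
      r ℕ.* (K′ ℕ.* suc e) ℕ.≤ (r′ ℕ.* suc e ℕ.+ 1 ℕ.* K′) ℕ.* K
    combine A e r r′ K K′ main r′≤ e≤K′ = ℕₚ.*-cancelˡ-≤ (2 ℕ.* C) (begin
      2 ℕ.* C ℕ.* (r ℕ.* (K′ ℕ.* suc e))     ≡⟨ regroup₁ C r K′ (suc e) ⟩
      2 ℕ.* C ℕ.* suc e ℕ.* (r ℕ.* K′)       ≤⟨ main ⟩
      (2 ℕ.* C ℕ.* suc e ℕ.+ N) ℕ.* (suc r′ ℕ.* K)
                                             ≡⟨ regroup₂ C (suc e) N r′ K ⟩
      2 ℕ.* C ℕ.* suc e ℕ.* r′ ℕ.* K ℕ.+ C ℕ.* (2 ℕ.* suc e) ℕ.* K ℕ.+ (suc r′ ℕ.* N) ℕ.* K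
                                             ≤⟨ ℕₚ.+-mono-≤
                                                  (ℕₚ.+-monoʳ-≤ (2 ℕ.* C ℕ.* suc e ℕ.* r′ ℕ.* K)
                                                    (ℕₚ.*-monoˡ-≤ K (ℕₚ.*-monoʳ-≤ C e≤K′)))
                                                  (ℕₚ.*-monoˡ-≤ K SN≤CK′) ⟩
      2 ℕ.* C ℕ.* suc e ℕ.* r′ ℕ.* K ℕ.+ C ℕ.* K′ ℕ.* K ℕ.+ C ℕ.* K′ ℕ.* K
                                             ≡⟨ regroup₃ C (suc e) r′ K K′ ⟩
      2 ℕ.* C ℕ.* ((r′ ℕ.* suc e ℕ.+ 1 ℕ.* K′) ℕ.* K) ∎)
      where
      open ℕₚ.≤-Reasoning
      C = suc (suc (N ℕ.^ A) ℕ.* N)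
      regroup₁ : ∀ C r K′ e → 2 ℕ.* C ℕ.* (r ℕ.* (K′ ℕ.* e)) ≡ 2 ℕ.* C ℕ.* e ℕ.* (r ℕ.* K′)
      regroup₁ = solve-∀
      regroup₂ : ∀ C e N r′ K → (2 ℕ.* C ℕ.* e ℕ.+ N) ℕ.* ((1 ℕ.+ r′) ℕ.* K)
        ≡ 2 ℕ.* C ℕ.* e ℕ.* r′ ℕ.* K ℕ.+ C ℕ.* (2 ℕ.* e) ℕ.* K ℕ.+ ((1 ℕ.+ r′) ℕ.* N) ℕ.* K
      regroup₂ = solve-∀
      regroup₃ : ∀ C e r′ K K′ → 2 ℕ.* C ℕ.* e ℕ.* r′ ℕ.* K ℕ.+ C ℕ.* K′ ℕ.* K ℕ.+ C ℕ.* K′ ℕ.* K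
        ≡ 2 ℕ.* C ℕ.* ((r′ ℕ.* e ℕ.+ 1 ℕ.* K′) ℕ.* K)
      regroup₃ = solve-∀
      swap : ∀ a b c → a ℕ.* b ℕ.* c ≡ a ℕ.* c ℕ.* b
      swap = solve-∀
      SN≤CK′ : suc r′ ℕ.* N ℕ.≤ C ℕ.* K′
      SN≤CK′ = begin
        suc r′ ℕ.* N                        ≤⟨ ℕₚ.*-monoˡ-≤ N (ℕₚ.+-mono-≤ (ℕ.>-nonZero⁻¹ K′) r′≤) ⟩
        suc (N ℕ.^ A) ℕ.* K′ ℕ.* N          ≡⟨ swap (suc (N ℕ.^ A)) K′ N ⟩
        suc (N ℕ.^ A) ℕ.* N ℕ.* K′          ≤⟨ ℕₚ.*-monoˡ-≤ K′ (ℕₚ.n≤1+n (suc (N ℕ.^ A) ℕ.* N)) ⟩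
        C ℕ.* K′                            ∎

    powApprox-close : ∀ A e {a b} → 0ℚ ℚ.≤ a → 0ℚ ℚ.≤ b → ∀ k l →
      a ℚ.≤ b ℚ.+ (+ 1 ℚ./ suc (ℕ.pred (fineness A e))) →
      ℤ.∣ ℚ.↥ b ∣ ℕ.≤ A ℕ.* ℚ.↧ₙ b →
      2 ℕ.* suc e ℕ.≤ suc l →
      powApprox N a k ℚ.≤ powApprox N b l ℚ.+ (+ 1 ℚ./ suc e)
    powApprox-close A e {a@record{}} {b@record{}} 0≤a 0≤b k l a≤b+ b≤A e≤l =
      fraction-≤ r k r′ l e (combine A e r r′ (suc k) (suc l)
        (compare (fineness A e) q q′ p p′ (suc k) (suc l) r (suc r′)
          (floorRoot-upper q (N ℕ.^ p ℕ.* suc k ℕ.^ q))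
          (ℕₚ.<⇒≤ (floorRoot-lower q′ (N ℕ.^ p′ ℕ.* suc l ℕ.^ q′)))
          (fraction-≤⁻¹ 0≤a 0≤b (ℕ.pred (fineness A e)) a≤b+))
        (root-bound q′ p′ (suc l) r′ A (floorRoot-upper q′ (N ℕ.^ p′ ℕ.* suc l ℕ.^ q′)) b≤A)
        e≤l)
      where
      p  = ℤ.∣ ℚ.↥ a ∣
      q  = ℚ.↧ₙ a
      p′ = ℤ.∣ ℚ.↥ b ∣
      q′ = ℚ.↧ₙ b
      r  = powNumerator N a k
      r′ = powNumerator N b l

    1≤powApprox : ∀ a k → 1ℚ ℚ.≤ powApprox N a k
    1≤powApprox a k = ℚₚ.toℚᵘ-cancel-≤ (ℚᵘₚ.≤-respʳ-≃
      (ℚᵘₚ.≃-sym (ℚₚ.toℚᵘ-fromℚᵘ (mkℚᵘ (+ r) k)))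
      (ℚᵘ.*≤* (subst₂ ℤ._≤_ (sym (ℤₚ.*-identityˡ (+ suc k))) (sym (ℤₚ.*-identityʳ (+ r)))
        (ℤ.+≤+ (ℕ.s≤s⁻¹ (^-cancelˡ-< q K^q<))))))
      where
      p = ℤ.∣ ℚ.↥ a ∣
      q = ℚ.↧ₙ a
      M = N ℕ.^ p ℕ.* suc k ℕ.^ q
      r = floorRoot q M
      K^q< : suc k ℕ.^ q ℕ.< suc r ℕ.^ q
      K^q< = ℕₚ.≤-<-trans (ℕₚ.m≤n*m _ (N ℕ.^ p) {{ℕₚ.m^n≢0 N p}}) (floorRoot-lower q M)

open PowerLemmas

-- N^x as the limit of rational powers, for exponents x ≥ 0 (a positive
-- exponent may have finitely many negative terms, which are clipped).
powSeq : (N : ℕ) → ℝ → ℕ → ℚ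
powSeq N x k = powApprox N (seq x k ℚ.⊔ 0ℚ) k

powSeq-cauchy : ∀ N .{{_ : NonZero N}} x → Cauchy (powSeq N x)
powSeq-cauchy N x ε 0<ε =
  let e , 1/e≤ε = archimedean 0<ε
      N₁ , h₁   = cauchy x (+ 1 ℚ./ 1) (1/suc-positive 0)
      c         = clip N₁
      A         = ℤ.∣ ℚ.↥ c ∣ ℕ.+ ℚ.↧ₙ c
      δ         = + 1 ℚ./ suc (ℕ.pred (fineness N A e))
      N₂ , h₂   = cauchy x δ (1/suc-positive (ℕ.pred (fineness N A e)))
      N₃        = 2 ℕ.* suc e
      oneSided  : ∀ m n → (N₁ ℕ.⊔ N₂) ℕ.⊔ N₃ ℕ.≤ m → (N₁ ℕ.⊔ N₂) ℕ.⊔ N₃ ℕ.≤ n →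
                  powSeq N x m ℚ.≤ powSeq N x n ℚ.+ ε
      oneSided m n ≤m ≤n =
        let ≤m₁₂ = ℕₚ.m⊔n≤o⇒m≤o (N₁ ℕ.⊔ N₂) N₃ ≤m
            ≤n₁₂ = ℕₚ.m⊔n≤o⇒m≤o (N₁ ℕ.⊔ N₂) N₃ ≤n
        in ℚₚ.≤-trans
          (powApprox-close N A e (0≤clip m) (0≤clip n) m n
            (clip-≤ m n (1/suc-positive (ℕ.pred (fineness N A e)))
              (h₂ m n (ℕₚ.m⊔n≤o⇒n≤o N₁ N₂ ≤m₁₂) (ℕₚ.m⊔n≤o⇒n≤o N₁ N₂ ≤n₁₂)))
            (bound (clip n) c (0≤clip n) (0≤clip N₁)
              (clip-≤ n N₁ (1/suc-positive 0) (h₁ n N₁ (ℕₚ.m⊔n≤o⇒m≤o N₁ N₂ ≤n₁₂) ℕₚ.≤-refl)))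
            (ℕₚ.m≤n⇒m≤1+n (ℕₚ.m⊔n≤o⇒n≤o (N₁ ℕ.⊔ N₂) N₃ ≤n)))
          (ℚₚ.+-monoʳ-≤ (powSeq N x n) 1/e≤ε)
  in (N₁ ℕ.⊔ N₂) ℕ.⊔ N₃ , λ m n ≤m ≤n → ≤⇒close (oneSided m n ≤m ≤n) (oneSided n m ≤n ≤m)
  where
  clip : ℕ → ℚ
  clip k = seq x k ℚ.⊔ 0ℚ

  0≤clip : ∀ k → 0ℚ ℚ.≤ clip k
  0≤clip k = ℚₚ.p≤q⊔p (seq x k) 0ℚ

  clip-≤ : ∀ m n {δ} → 0ℚ ℚ.< δ → ℚ.∣ seq x m ℚ.- seq x n ∣ ℚ.≤ δ → clip m ℚ.≤ clip n ℚ.+ δ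
  clip-≤ m n {δ} 0<δ h = ℚₚ.⊔-lub
    (ℚₚ.≤-trans (close⇒≤ {seq x m} {seq x n} h) (ℚₚ.+-monoˡ-≤ δ (ℚₚ.p≤p⊔q (seq x n) 0ℚ)))
    (ℚₚ.+-mono-≤ (0≤clip n) (ℚₚ.<⇒≤ 0<δ))

  bound : ∀ a c → 0ℚ ℚ.≤ a → 0ℚ ℚ.≤ c → a ℚ.≤ c ℚ.+ (+ 1 ℚ./ 1) →
    ℤ.∣ ℚ.↥ a ∣ ℕ.≤ (ℤ.∣ ℚ.↥ c ∣ ℕ.+ ℚ.↧ₙ c) ℕ.* ℚ.↧ₙ a
  bound a c@record{} 0≤a 0≤c h = ℕₚ.≤-trans
    (ℕₚ.m≤m*n p q′)
    (subst₂ ℕ._≤_ (cong (p ℕ.*_) (ℕₚ.*-identityʳ q′))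
      (cong (ℕ._* ℚ.↧ₙ a) (cong₂ ℕ._+_ (ℕₚ.*-identityʳ p′) (ℕₚ.*-identityˡ q′)))
      (fraction-≤⁻¹ 0≤a 0≤c 0 h))
    where
    p  = ℤ.∣ ℚ.↥ a ∣
    p′ = ℤ.∣ ℚ.↥ c ∣
    q′ = ℚ.↧ₙ c

_^_ : (N : ℕ) .{{_ : NonZero N}} → ℝ⁺ → ℝ⁺
seq      (value (N ^ x)) = powSeq N (value x)
cauchy   (value (N ^ x)) = powSeq-cauchy N (value x)
positive (N ^ x) = <-intro 1ℚ (ℚₚ.positive⁻¹ 1ℚ)
  (0 , λ k _ → 1≤powApprox N (seq (value x) k ℚ.⊔ 0ℚ) k)

0<2-α : ∀ {α} → α < 1ℝ → 0ℝ < 2ℝ - α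
0<2-α {α} (<-intro ε 0<ε (N , α+ε≤1)) = <-intro ε 0<ε (N , λ n N≤n → begin
  0ℚ ℚ.+ ε                                     ≡⟨ rearrange ε (seq α n) ⟩
  seq α n ℚ.+ ε ℚ.+ (ℚ.- seq α n)              ≤⟨ ℚₚ.+-monoˡ-≤ _ (ℚₚ.≤-trans (α+ε≤1 n N≤n) 1≤2) ⟩
  (+ 2 ℚ./ 1) ℚ.+ (ℚ.- seq α n)                ∎)
  where
  open ℚₚ.≤-Reasoning
  1≤2 : 1ℚ ℚ.≤ + 2 ℚ./ 1
  1≤2 = ℚ.*≤* (ℤ.+≤+ (s≤s z≤n))
  rearrange : ∀ ε a → 0ℚ ℚ.+ ε ≡ a ℚ.+ ε ℚ.+ (ℚ.- a)
  rearrange = solve 2 (λ ε a → con 0ℚ :+ ε := a :+ ε :+ (:- a)) refl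
    where open +-*-Solver

HasCardinality : {A : Set} → Pred A 0ℓ → ℕ → Set
HasCardinality S k = ∃[ xs ] Unique xs × length xs ≡ k × (∀ a → S a ⇔ a ∈ xs)

cardinality-unique : ∀ {A : Set} {S : Pred A 0ℓ} {k l} →
  HasCardinality S k → HasCardinality S l → k ≡ l
cardinality-unique (xs , xs! , refl , S⇔xs) (ys , ys! , refl , S⇔ys) =
  ↭-length (∼bag⇒↭ (unique∧set⇒bag xs! ys! λ {a} → mk⇔
    (to (S⇔ys a) ∘ from (S⇔xs a))
    (to (S⇔xs a) ∘ from (S⇔ys a))))
  where open Equivalence

-- A subset of a finite set cannot fail to have a cardinality, although
-- finding it requires deciding membership.
cardinality-exists : ∀ {A : Set} {S : Pred A 0ℓ} (xs : List A) → Unique xs →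
  (∀ a → S a → a ∈ xs) → ¬ ¬ (∃[ k ] HasCardinality S k)
cardinality-exists {A} {S} xs xs! S⊆xs none =
  go xs xs! λ (ys , ys! , _ , S⇔ys) → none (length ys , ys , ys! , refl , λ a →
    mk⇔ (λ Sa → from (S⇔ys a) (Sa , S⊆xs a Sa)) (proj₁ ∘ to (S⇔ys a)))
  where
  open Equivalence
  go : ∀ xs → Unique xs → ¬ ¬ (∃[ ys ] Unique ys × (∀ a → a ∈ ys → a ∈ xs) ×
         (∀ a → a ∈ ys ⇔ (S a × a ∈ xs)))
  go [] [] k = k ([] , [] , (λ _ ()) , λ a → mk⇔ (λ ()) λ ())
  go (x ∷ xs) (x∉xs ∷ xs!) k = go xs xs! λ (ys , ys! , ys⊆xs , ys⇔) →
    (λ ¬Sx → k (ys , ys! , (λ a a∈ → there (ys⊆xs a a∈)) , λ a → mk⇔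
       (λ a∈ → let Sa , a∈xs = to (ys⇔ a) a∈ in Sa , there a∈xs)
       λ where (Sa , here refl)  → contradiction Sa ¬Sx
               (Sa , there a∈xs) → from (ys⇔ a) (Sa , a∈xs)))
    λ Sx → k (x ∷ ys , All.tabulate (λ {a} a∈ → All.lookup x∉xs (ys⊆xs a a∈)) ∷ ys!
      , (λ where a (here refl) → here refl
                 a (there a∈)  → there (ys⊆xs a a∈))
      , λ a → mk⇔
          (λ where (here refl) → Sx , here refl
                   (there a∈)  → let Sa , a∈xs = to (ys⇔ a) a∈ in Sa , there a∈xs)
          λ where (Sa , here refl)  → here refl
                  (Sa , there a∈xs) → there (from (ys⇔ a) (Sa , a∈xs)))

-- # (S N) / w N tends to L as N → ∞.  The count enters relationally: it is
-- the k with HasCardinality (S N) k, which is unique and, for bounded S N,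
-- exists in the sense of cardinality-exists; membership in S N need not be
-- decidable.  With excluded middle this is the usual limit of a function.
CountingLimit : {A : Set} →
  (S : (N : ℕ) .{{_ : NonZero N}} → Pred A 0ℓ) →
  (w : (N : ℕ) .{{_ : NonZero N}} → ℝ⁺) → ℝ → Set
CountingLimit S w L = ∀ ε → 0ℝ < ε →
  ∃[ N₀ ] ∀ N .{{_ : NonZero N}} → N₀ ℕ.≤ N →
    ∀ k → HasCardinality (S N) k → ∣ fromℕ k / w N - L ∣ < ε

-- Sequences are indexed from 1; the value at index 0 is ignored.
OnUnitInterval : (ℕ → ℝ) → Set
OnUnitInterval x = ∀ n → 1 ℕ.≤ n → 0ℝ ≤ x n × x n ≤ 1ℝ

record Interval : Set where
  field
    lower upper                 : ℝ
    lowerIncluded upperIncluded : Bool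
    0≤lower                     : 0ℝ ≤ lower
    lower≤upper                 : lower ≤ upper
    upper≤1                     : upper ≤ 1ℝ

open Interval public

infix 4 _∈ᴵ_

_∈ᴵ_ : ℝ → Interval → Set
y ∈ᴵ J = (if lowerIncluded J then lower J ≤ y else lower J < y)
       × (if upperIncluded J then y ≤ upper J else y < upper J)

intervalLength : Interval → ℝ
intervalLength J = upper J - lower J

UniformlyDistributed : (ℕ → ℝ) → Set
UniformlyDistributed x = ∀ (J : Interval) →
  CountingLimit (λ N i → 1 ℕ.≤ i × i ℕ.≤ N × x i ∈ᴵ J) (λ N → fromℕ⁺ N) (intervalLength J)

ClosePairs : (ℕ → ℝ) → ℕ → ℝ → Pred (ℕ × ℕ) 0ℓ
ClosePairs x N d (m , n) =
  1 ℕ.≤ m × m ℕ.≤ N × 1 ℕ.≤ n × n ℕ.≤ N × m ≢ n × ∣ x m - x n ∣ ≤ d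

{-# OPTIONS --safe #-}
-- Cover [0,1] by bins of width 1/L with L ≈ H N^α, and for every window of H
-- consecutive bins count the points among x₁, …, x_N that it contains.  The mean
-- window count is about N H / L.  The sum of the squared counts is
-- Σ_{h<H} #{(m,n) : bins of x_m, x_n at distance ≤ h}, which the hypothesis, used
-- only as an upper bound at s = (h+2)/H, and the diagonal, negligible as α < 1,
-- bound by the square of the mean up to a relative error O(1/H) per window.  So
-- the variance is small, and a run of consecutive windows contains the expected
-- number of points up to a small multiple of N H; applied to the windows meeting
-- J, resp. contained in J, this gives both bounds for #{i ≤ N : x_i ∈ J}.

module Submission where

open import Data.Bool using (true; false; if_then_else_)
import Data.Integer as ℤ
import Data.Integer.Properties as ℤₚ
open import Data.List using (List; []; _∷_; _++_; length; map; applyUpTo; cartesianProduct; downFrom)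
open import Data.List.Membership.Propositional using (_∈_)
open import Data.List.Membership.Propositional.Properties
  using (∈-∃++; ∈-++⁺ˡ; ∈-++⁺ʳ; ∈-++⁻; ∈-map⁺; ∈-applyUpTo⁺; ∈-applyUpTo⁻; ∈-cartesianProduct⁺;
         ∈-cartesianProduct⁻; ∈-downFrom⁻)
import Data.List.Properties as Listₚ
open import Data.List.Relation.Unary.All as All using ([]; _∷_)
open import Data.List.Relation.Unary.AllPairs using ([]; _∷_)
open import Data.List.Relation.Unary.Any using (here; there)
open import Data.List.Relation.Unary.Unique.Propositional using (Unique)
open import Data.List.Relation.Unary.Unique.Propositional.Properties using (applyUpTo⁺₁; cartesianProduct⁺)
open import Data.Nat as ℕ using (ℕ; zero; suc; NonZero; z≤n; s≤s)
import Data.Nat.DivMod as ℕᵈ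
open import Data.Nat.ListAction using (sum)
open import Data.Nat.ListAction.Properties using (sum-++)
import Data.Nat.Properties as ℕₚ
open import Data.Nat.Tactic.RingSolver using (solve-∀)
open import Data.Product using (∃-syntax; _×_; _,_; proj₁; proj₂)
open import Data.Rational as ℚ using (ℚ; 0ℚ; 1ℚ; mkℚ)
import Data.Rational.Properties as ℚₚ
open import Data.Rational.Solver using (module +-*-Solver)
open import Data.Rational.Unnormalised as ℚᵘ using (mkℚᵘ)
import Data.Rational.Unnormalised.Properties as ℚᵘₚ
open import Data.Sum using (inj₁; inj₂)
import Defs as R
open import Function using (_∘_)
open import Function.Bundles using (Equivalence)
open import Relation.Binary.PropositionalEquality
  using (_≡_; _≢_; refl; sym; trans; cong; cong₂; subst; subst₂; module ≡-Reasoning)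
open import Relation.Nullary using (¬_; Dec; yes; no; contradiction)
open import Relation.Nullary.Decidable using (_×-dec_; decidable-stable)

-- An upper bound for the second moment suffices because the first moment is exact: every point lies
-- in precisely `H` windows, so the counts add up to `N * H`, shared by about `L` windows. A sum of
-- squares close to the minimum allowed by this total forces nearly equal counts. The diagonal
-- contributes `N * H` against a main term `N² H² / L`, a relative error of about `N ^ (α - 1)`, so
-- `N` must be large in terms of `H` before it drops to order `1 / H`. The accuracy parameter is
-- `e`: frequencies come out within `2 / e`, and `H` has order `e²` because a relative deviation
-- `1 / e` costs `1 / e²` in a square. The shape of the proof is dictated by the order on the reals
-- being undecidable: neither exact bins nor lists of close pairs can be computed. Approximate bins
-- cost shifts by 3, and the combinatorial part stays in ℕ, multiplied out so that neither division
-- nor negative numbers occur; its conclusions are decidable there.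

module WindowCounts where

  open import Data.Nat using (_+_; _*_; _∸_; _≤_; _<_; _≤?_; _<?_; _⊔_; _⊓_; ∣_-_∣)

  -- Finite sums over lists.

  ∑ : {A : Set} → List A → (A → ℕ) → ℕ
  ∑ xs f = sum (map f xs)

  module _ {A : Set} where

    ∑-cong : ∀ (xs : List A) {f g} → (∀ a → f a ≡ g a) → ∑ xs f ≡ ∑ xs g
    ∑-cong xs f≗g = cong sum (Listₚ.map-cong f≗g xs)

    ∑-mono : ∀ (xs : List A) {f g} → (∀ a → a ∈ xs → f a ≤ g a) → ∑ xs f ≤ ∑ xs g
    ∑-mono []       f≤g = z≤n
    ∑-mono (x ∷ xs) f≤g = ℕₚ.+-mono-≤ (f≤g x (here refl)) (∑-mono xs λ a → f≤g a ∘ there)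

    ∑-+ : ∀ (xs : List A) f g → ∑ xs (λ a → f a + g a) ≡ ∑ xs f + ∑ xs g
    ∑-+ []       f g = refl
    ∑-+ (x ∷ xs) f g = trans (cong (f x + g x +_) (∑-+ xs f g)) (interchange (f x) (g x) _ _)
      where
      interchange : ∀ a b c d → a + b + (c + d) ≡ a + c + (b + d)
      interchange = solve-∀

    ∑-*ˡ : ∀ (xs : List A) c f → ∑ xs (λ a → c * f a) ≡ c * ∑ xs f
    ∑-*ˡ []       c f = sym (ℕₚ.*-zeroʳ c)
    ∑-*ˡ (x ∷ xs) c f = trans (cong (c * f x +_) (∑-*ˡ xs c f)) (sym (ℕₚ.*-distribˡ-+ c (f x) _))

    ∑-*ʳ : ∀ (xs : List A) c f → ∑ xs (λ a → f a * c) ≡ ∑ xs f * c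
    ∑-*ʳ xs c f = trans (∑-cong xs λ a → ℕₚ.*-comm (f a) c) (trans (∑-*ˡ xs c f) (ℕₚ.*-comm c _))

    ∑-const : ∀ (xs : List A) c → ∑ xs (λ _ → c) ≡ length xs * c
    ∑-const []       c = refl
    ∑-const (x ∷ xs) c = cong (c +_) (∑-const xs c)

    ∑-++ : ∀ (xs ys : List A) f → ∑ (xs ++ ys) f ≡ ∑ xs f + ∑ ys f
    ∑-++ xs ys f = trans (cong sum (Listₚ.map-++ f xs ys)) (sum-++ (map f xs) (map f ys))

    -- Each entry of `xs` with nonzero weight is cut out of `ys`; distinctness of `xs` ensures that
    -- no later entry needs the removed position. Asking only for the support of `f` lets the same
    -- lemma discard pairs that are not close and points outside a run of windows.
    ∑-⊆ : ∀ {xs} → Unique xs → ∀ ys {f : A → ℕ} →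
      (∀ {a} → a ∈ xs → f a ≢ 0 → a ∈ ys) → ∑ xs f ≤ ∑ ys f
    ∑-⊆ [] ys xs⊆ys = z≤n
    ∑-⊆ {x ∷ xs} (x∉xs ∷ xs!) ys {f} xs⊆ys with f x ℕ.≟ 0
    ... | yes fx≡0 rewrite fx≡0 = ∑-⊆ xs! ys (xs⊆ys ∘ there)
    ... | no  fx≢0 with us , vs , refl ← ∈-∃++ (xs⊆ys (here refl) fx≢0) = begin
      f x + ∑ xs f                 ≤⟨ ℕₚ.+-monoʳ-≤ (f x) (∑-⊆ xs! (us ++ vs) rest) ⟩
      f x + ∑ (us ++ vs) f         ≡⟨ cong (f x +_) (∑-++ us vs f) ⟩
      f x + (∑ us f + ∑ vs f)      ≡⟨ swap (f x) (∑ us f) (∑ vs f) ⟩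
      ∑ us f + (f x + ∑ vs f)      ≡⟨ ∑-++ us (x ∷ vs) f ⟨
      ∑ (us ++ x ∷ vs) f           ∎
      where
      open ℕₚ.≤-Reasoning
      swap : ∀ a b c → a + (b + c) ≡ b + (a + c)
      swap = solve-∀
      rest : ∀ {a} → a ∈ xs → f a ≢ 0 → a ∈ us ++ vs
      rest a∈xs fa≢0 with ∈-++⁻ us (xs⊆ys (there a∈xs) fa≢0)
      ... | inj₁ a∈us         = ∈-++⁺ˡ a∈us
      ... | inj₂ (here refl)  = contradiction refl (All.lookup x∉xs a∈xs)
      ... | inj₂ (there a∈vs) = ∈-++⁺ʳ us a∈vs

  module _ {A B : Set} where

    ∑-swap : ∀ (xs : List A) (ys : List B) (f : A → B → ℕ) →
      ∑ xs (λ a → ∑ ys (f a)) ≡ ∑ ys (λ b → ∑ xs (λ a → f a b))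
    ∑-swap []       ys f = sym (trans (∑-const ys 0) (ℕₚ.*-zeroʳ (length ys)))
    ∑-swap (x ∷ xs) ys f = trans (cong (∑ ys (f x) +_) (∑-swap xs ys f))
      (sym (∑-+ ys (f x) λ b → ∑ xs (λ a → f a b)))

    ∑-cartesianProduct : ∀ (xs : List A) (ys : List B) (f : A → B → ℕ) →
      ∑ (cartesianProduct xs ys) (λ (a , b) → f a b) ≡ ∑ xs (λ a → ∑ ys (f a))
    ∑-cartesianProduct []       ys f = refl
    ∑-cartesianProduct (x ∷ xs) ys f = trans (∑-++ (map (x ,_) ys) _ _)
      (cong₂ _+_ (cong sum (sym (Listₚ.map-∘ ys))) (∑-cartesianProduct xs ys f))

    ∑-product : ∀ (xs : List A) (ys : List B) (f : A → ℕ) (g : B → ℕ) →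
      ∑ xs f * ∑ ys g ≡ ∑ (cartesianProduct xs ys) (λ (a , b) → f a * g b)
    ∑-product xs ys f g = trans (sym (∑-*ʳ xs (∑ ys g) f))
      (trans (∑-cong xs λ a → sym (∑-*ˡ ys (f a) g)) (sym (∑-cartesianProduct xs ys λ a b → f a * g b)))

  -- Indicators of half-open ranges.

  𝟙 : ∀ {P : Set} → Dec P → ℕ
  𝟙 (yes _) = 1
  𝟙 (no _)  = 0

  𝟙-cong : ∀ {P Q : Set} (p? : Dec P) (q? : Dec Q) → (P → Q) → (Q → P) → 𝟙 p? ≡ 𝟙 q?
  𝟙-cong (yes _) (yes _) _   _   = refl
  𝟙-cong (yes p) (no ¬q) P⇒Q _   = contradiction (P⇒Q p) ¬q
  𝟙-cong (no ¬p) (yes q) _   Q⇒P = contradiction (Q⇒P q) ¬p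
  𝟙-cong (no _)  (no _)  _   _   = refl

  𝟙-× : ∀ {P Q : Set} (p? : Dec P) (q? : Dec Q) → 𝟙 p? * 𝟙 q? ≡ 𝟙 (p? ×-dec q?)
  𝟙-× (yes _) (yes _) = refl
  𝟙-× (yes _) (no _)  = refl
  𝟙-× (no _)  _       = refl

  𝟙≤1 : ∀ {P : Set} (p? : Dec P) → 𝟙 p? ≤ 1
  𝟙≤1 (yes _) = ℕₚ.≤-refl
  𝟙≤1 (no _)  = z≤n

  𝟙-idem : ∀ {P : Set} (p? : Dec P) → 𝟙 p? * 𝟙 p? ≡ 𝟙 p?
  𝟙-idem (yes _) = refl
  𝟙-idem (no _)  = refl

  𝟙≢0 : ∀ {P : Set} (p? : Dec P) → 𝟙 p? ≢ 0 → P
  𝟙≢0 (yes p) _  = p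
  𝟙≢0 (no _)  ≢0 = contradiction refl ≢0

  range? : ∀ p q j → Dec (p ≤ j × j < q)
  range? p q j = p ≤? j ×-dec j <? q

  range : ℕ → ℕ → ℕ → ℕ
  range p q j = 𝟙 (range? p q j)

  range-∩ : ∀ p q p′ q′ j → range p q j * range p′ q′ j ≡ range (p ⊔ p′) (q ⊓ q′) j
  range-∩ p q p′ q′ j = trans (𝟙-× (range? p q j) (range? p′ q′ j))
    (𝟙-cong (range? p q j ×-dec range? p′ q′ j) (range? (p ⊔ p′) (q ⊓ q′) j)
      (λ ((p≤j , j<q) , p′≤j , j<q′) → ℕₚ.⊔-lub p≤j p′≤j , ℕₚ.⊓-glb j<q j<q′)
      (λ (p⊔p′≤j , j<q⊓q′) →
        (ℕₚ.m⊔n≤o⇒m≤o p p′ p⊔p′≤j , ℕₚ.m≤n⊓o⇒m≤n q q′ j<q⊓q′) ,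
        ℕₚ.m⊔n≤o⇒n≤o p p′ p⊔p′≤j , ℕₚ.m≤n⊓o⇒m≤o q q′ j<q⊓q′))

  ∑-range : ∀ T p q → ∑ (downFrom T) (range p q) ≡ q ⊓ T ∸ p
  ∑-range zero    p q = sym (trans (cong (_∸ p) (ℕₚ.⊓-zeroʳ q)) (ℕₚ.0∸n≡0 p))
  ∑-range (suc T) p q with p ≤? T | T <? q
  ... | yes p≤T | yes T<q = trans (cong suc (trans (∑-range T p q) (cong (_∸ p) (ℕₚ.m≥n⇒m⊓n≡n (ℕₚ.<⇒≤ T<q)))))
                              (trans (sym (ℕₚ.+-∸-assoc 1 p≤T)) (cong (_∸ p) (sym (ℕₚ.m≥n⇒m⊓n≡n T<q))))
  ... | yes _   | no T≮q  = trans (∑-range T p q) (cong (_∸ p) (trans (ℕₚ.m≤n⇒m⊓n≡m q≤T)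
                              (sym (ℕₚ.m≤n⇒m⊓n≡m (ℕₚ.m≤n⇒m≤1+n q≤T)))))
    where q≤T = ℕₚ.≮⇒≥ T≮q
  ... | no p≰T  | _       = trans (∑-range T p q) (trans
                              (ℕₚ.m≤n⇒m∸n≡0 (ℕₚ.≤-trans (ℕₚ.m⊓n≤n q T) (ℕₚ.<⇒≤ (ℕₚ.≰⇒> p≰T))))
                              (sym (ℕₚ.m≤n⇒m∸n≡0 (ℕₚ.≤-trans (ℕₚ.m⊓n≤n q (suc T)) (ℕₚ.≰⇒> p≰T)))))

  -- The left side is the length of the intersection of `[m, m + H)` and `[n, n + H)`, that is, the
  -- number of windows shared by points in bins `m` and `n`.
  ⊓+∸⊔ : ∀ m n H → (m + H) ⊓ (n + H) ∸ (m ⊔ n) ≡ H ∸ ∣ m - n ∣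
  ⊓+∸⊔ m n H with ℕₚ.≤-total m n
  ... | inj₁ m≤n = trans (cong₂ _∸_ (ℕₚ.m≤n⇒m⊓n≡m (ℕₚ.+-monoˡ-≤ H m≤n)) (ℕₚ.m≤n⇒m⊔n≡n m≤n))
    (trans (lemma m≤n) (cong (H ∸_) (sym (ℕₚ.m≤n⇒∣m-n∣≡n∸m m≤n))))
    where
    lemma : m ≤ n → m + H ∸ n ≡ H ∸ (n ∸ m)
    lemma m≤n = trans (cong (m + H ∸_) (sym (ℕₚ.m+[n∸m]≡n m≤n))) (ℕₚ.[m+n]∸[m+o]≡n∸o m H (n ∸ m))
  ... | inj₂ n≤m = trans (cong₂ _∸_ (ℕₚ.m≥n⇒m⊓n≡n (ℕₚ.+-monoˡ-≤ H n≤m)) (ℕₚ.m≥n⇒m⊔n≡m n≤m))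
    (trans (lemma n≤m) (cong (H ∸_) (sym (ℕₚ.m≤n⇒∣n-m∣≡n∸m n≤m))))
    where
    lemma : n ≤ m → n + H ∸ m ≡ H ∸ (m ∸ n)
    lemma n≤m = trans (cong (n + H ∸_) (sym (ℕₚ.m+[n∸m]≡n n≤m))) (ℕₚ.[m+n]∸[m+o]≡n∸o n H (m ∸ n))

  2uv≤u²+v² : ∀ u v → 2 * (u * v) ≤ u * u + v * v
  2uv≤u²+v² u v with ℕₚ.≤-total u v
  ... | inj₁ u≤v with k , refl ← ℕₚ.m≤n⇒∃[o]m+o≡n u≤v =
    subst (2 * (u * (u + k)) ≤_) (sym (expand u k)) (ℕₚ.m≤m+n _ _)
    where
    expand : ∀ u k → u * u + (u + k) * (u + k) ≡ 2 * (u * (u + k)) + k * k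
    expand = solve-∀
  ... | inj₂ v≤u with k , refl ← ℕₚ.m≤n⇒∃[o]m+o≡n v≤u =
    subst (2 * ((v + k) * v) ≤_) (sym (expand v k)) (ℕₚ.m≤m+n _ _)
    where
    expand : ∀ v k → (v + k) * (v + k) + v * v ≡ 2 * ((v + k) * v) + k * k
    expand = solve-∀

  -- Moments of the window counts.

  module Windows (is : List ℕ) (is! : Unique is) (z : ℕ → ℕ) (H T : ℕ)
    (z+H≤T : ∀ i → z i + H ≤ T) where

    -- A window is named by its last bin: the condition `z i ≤ j < z i + H` says that the bin of `i`
    -- is among the `H` bins ending at `j`. Thus the windows containing a given point again form a
    -- range.
    windowCount : ℕ → ℕ
    windowCount j = ∑ is λ i → range (z i) (z i + H) j

    -- Double counting: after exchanging the sums, point `i` contributes the number of windows with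
    -- index in `[p, q)` that contain it. The cut-off `T` disappears since no window containing a
    -- point reaches it.
    ∑-windowCount-range : ∀ p q →
      ∑ (downFrom T) (λ j → range p q j * windowCount j) ≡ ∑ is (λ i → q ⊓ (z i + H) ∸ (p ⊔ z i))
    ∑-windowCount-range p q = begin
      ∑ js (λ j → range p q j * windowCount j)
        ≡⟨ ∑-cong js (λ j → sym (∑-*ˡ is (range p q j) λ i → range (z i) (z i + H) j)) ⟩
      ∑ js (λ j → ∑ is λ i → range p q j * range (z i) (z i + H) j)
        ≡⟨ ∑-swap js is (λ j i → range p q j * range (z i) (z i + H) j) ⟩
      ∑ is (λ i → ∑ js λ j → range p q j * range (z i) (z i + H) j)
        ≡⟨ ∑-cong is (λ i → trans (∑-cong js (range-∩ p q (z i) (z i + H)))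
             (trans (∑-range T (p ⊔ z i) (q ⊓ (z i + H))) (cong (_∸ (p ⊔ z i))
               (ℕₚ.m≤n⇒m⊓n≡m (ℕₚ.≤-trans (ℕₚ.m⊓n≤n q _) (z+H≤T i)))))) ⟩
      ∑ is (λ i → q ⊓ (z i + H) ∸ (p ⊔ z i)) ∎
      where
      open ≡-Reasoning
      js = downFrom T

    ∑-windowCount : ∑ (downFrom T) windowCount ≡ length is * H
    ∑-windowCount = begin
      ∑ js windowCount
        ≡⟨ ∑-swap js is (λ j i → range (z i) (z i + H) j) ⟩
      ∑ is (λ i → ∑ js λ j → range (z i) (z i + H) j)
        ≡⟨ ∑-cong is (λ i → trans (∑-range T (z i) (z i + H))
             (trans (cong (_∸ z i) (ℕₚ.m≤n⇒m⊓n≡m (z+H≤T i))) (ℕₚ.m+n∸m≡n (z i) H))) ⟩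
      ∑ is (λ _ → H)
        ≡⟨ ∑-const is H ⟩
      length is * H ∎
      where
      open ≡-Reasoning
      js = downFrom T

    -- Two points at distance d lie in H ∸ d common windows, and H ∸ d counts the
    -- h < H with d ≤ h.
    ∑-windowCount² : ∑ (downFrom T) (λ j → windowCount j * windowCount j)
      ≡ ∑ (downFrom H) (λ h → ∑ (cartesianProduct is is) λ (m , n) → range ∣ z m - z n ∣ H h)
    ∑-windowCount² = begin
      ∑ js (λ j → windowCount j * windowCount j)
        ≡⟨ ∑-cong js (λ j → ∑-product is is (λ m → w m j) (λ n → w n j)) ⟩
      ∑ js (λ j → ∑ is² λ (m , n) → w m j * w n j)
        ≡⟨ ∑-swap js is² (λ j (m , n) → w m j * w n j) ⟩
      ∑ is² (λ (m , n) → ∑ js λ j → w m j * w n j)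
        ≡⟨ ∑-cong is² (λ (m , n) → trans (∑-cong js (range-∩ (z m) (z m + H) (z n) (z n + H)))
             (trans (∑-range T (z m ⊔ z n) ((z m + H) ⊓ (z n + H)))
             (trans (cong (_∸ (z m ⊔ z n)) (ℕₚ.m≤n⇒m⊓n≡m (ℕₚ.≤-trans (ℕₚ.m⊓n≤m (z m + H) (z n + H)) (z+H≤T m))))
             (trans (⊓+∸⊔ (z m) (z n) H)
               (sym (trans (∑-range H ∣ z m - z n ∣ H) (cong (_∸ ∣ z m - z n ∣) (ℕₚ.⊓-idem H)))))))) ⟩
      ∑ is² (λ (m , n) → ∑ (downFrom H) (range ∣ z m - z n ∣ H))
        ≡⟨ ∑-swap is² (downFrom H) (λ (m , n) → range ∣ z m - z n ∣ H) ⟩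
      ∑ (downFrom H) (λ h → ∑ is² λ (m , n) → range ∣ z m - z n ∣ H h) ∎
      where
      open ≡-Reasoning
      js = downFrom T
      is² = cartesianProduct is is
      w : ℕ → ℕ → ℕ
      w i = range (z i) (z i + H)

    -- The diagonal is within every distance `h` and costs `length is`; all other counted pairs lie
    -- in `ps`. Only an upper bound is wanted, so `ps` may contain further pairs, which leaves room
    -- for the imprecision of the bins.
    closePairs-bound : ∀ h (ps : List (ℕ × ℕ)) →
      (∀ m n → m ∈ is → n ∈ is → m ≢ n → ∣ z m - z n ∣ ≤ h → (m , n) ∈ ps) →
      ∑ (cartesianProduct is is) (λ (m , n) → range ∣ z m - z n ∣ H h) ≤ length is + length ps
    closePairs-bound h ps close⇒∈ps = begin
      ∑ is² f                             ≤⟨ ∑-⊆ (cartesianProduct⁺ is! is!) (map diagonal is ++ ps) covered ⟩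
      ∑ (map diagonal is ++ ps) f         ≤⟨ ∑-mono (map diagonal is ++ ps) (λ (m , n) _ → 𝟙≤1 (range? ∣ z m - z n ∣ H h)) ⟩
      ∑ (map diagonal is ++ ps) (λ _ → 1) ≡⟨ trans (∑-const (map diagonal is ++ ps) 1) (ℕₚ.*-identityʳ _) ⟩
      length (map diagonal is ++ ps)      ≡⟨ Listₚ.length-++ (map diagonal is) ⟩
      length (map diagonal is) + length ps ≡⟨ cong (_+ length ps) (Listₚ.length-map diagonal is) ⟩
      length is + length ps               ∎
      where
      open ℕₚ.≤-Reasoning
      is² = cartesianProduct is is
      diagonal : ℕ → ℕ × ℕ
      diagonal i = i , i
      f : ℕ × ℕ → ℕ
      f (m , n) = range ∣ z m - z n ∣ H h
      covered : ∀ {a} → a ∈ is² → f a ≢ 0 → a ∈ map diagonal is ++ ps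
      covered {m , n} mn∈ f≢0 with ∈-cartesianProduct⁻ is is mn∈ | m ℕ.≟ n
      ... | m∈ , _  | yes refl = ∈-++⁺ˡ (∈-map⁺ diagonal m∈)
      ... | m∈ , n∈ | no m≢n   = ∈-++⁺ʳ (map diagonal is)
        (close⇒∈ps m n m∈ n∈ m≢n (proj₁ (𝟙≢0 (range? ∣ z m - z n ∣ H h) f≢0)))

  -- Variance bound and its consequences for runs of windows.

  open ℕₚ.≤-Reasoning

  -- This adds up the pair bounds of all `h < H`. The term `H * H` matches the square of the mean
  -- window count; `5 * H` is the relative error of order `1 / H`.
  ∑-2h+6 : ∀ H → ∑ (downFrom H) (λ h → 2 * h + 6) ≡ H * H + 5 * H
  ∑-2h+6 zero    = refl
  ∑-2h+6 (suc H) = trans (cong (2 * H + 6 +_) (∑-2h+6 H)) (expand H)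
    where
    expand : ∀ H → 2 * H + 6 + (H * H + 5 * H) ≡ (1 + H) * (1 + H) + 5 * (1 + H)
    expand = solve-∀

  -- The part of the argument that is free of real numbers. `LH≤` makes the diagonal negligible,
  -- `H²≤L` does the same for the windows overhanging the unit interval, and `10e²≤H` makes the
  -- variance small at scale `1 / e`.
  module Estimate {N : ℕ} (is : List ℕ) (is! : Unique is) (∣is∣≡N : length is ≡ N) (z : ℕ → ℕ) (e H L : ℕ)
    (z≤L+2 : ∀ i → z i ≤ L + 2) (1≤H : 1 ≤ H) (10e²≤H : 10 * (e * e) ≤ H) (3≤H : 3 ≤ H) (H²≤L : H * H ≤ L)
    (1≤N : 1 ≤ N) (LH≤ : L * H ≤ (1 + H) * N)
    (fewPairs : ∀ h → h < H → ∃[ ps ]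
      (∀ m n → m ∈ is → n ∈ is → m ≢ n → ∣ z m - z n ∣ ≤ h → (m , n) ∈ ps) ×
      L * length ps ≤ N * N * (2 * h + 6))
    where

    -- Bins are at most `L + 2`, so windows containing a point have index below `L + 2 + H`. The
    -- further 3 accommodate the run ending at `b + 3 + H` for `b ≤ L + 2`.
    T = L + H + 5
    js = downFrom T

    z+H≤T : ∀ i → z i + H ≤ T
    z+H≤T i = begin
      z i + H     ≤⟨ ℕₚ.+-monoˡ-≤ H (z≤L+2 i) ⟩
      L + 2 + H   ≤⟨ ℕₚ.m≤m+n (L + 2 + H) 3 ⟩
      L + 2 + H + 3 ≡⟨ reorder L H ⟩
      T           ∎
      where
      reorder : ∀ L H → L + 2 + H + 3 ≡ L + H + 5
      reorder = solve-∀

    open Windows is is! z H T z+H≤T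

    total : ∑ js windowCount ≡ N * H
    total = trans ∑-windowCount (cong (_* H) ∣is∣≡N)

    S₂ : ℕ
    S₂ = ∑ js (λ j → windowCount j * windowCount j)

    second-moment : L * S₂ ≤ H * (L * N) + N * N * (H * H + 5 * H)
    second-moment = begin
      L * S₂
        ≡⟨ cong (L *_) ∑-windowCount² ⟩
      L * ∑ (downFrom H) pairs
        ≡⟨ ∑-*ˡ (downFrom H) L pairs ⟨
      ∑ (downFrom H) (λ h → L * pairs h)
        ≤⟨ ∑-mono (downFrom H) bound ⟩
      ∑ (downFrom H) (λ h → L * N + N * N * (2 * h + 6))
        ≡⟨ ∑-+ (downFrom H) (λ _ → L * N) (λ h → N * N * (2 * h + 6)) ⟩
      ∑ (downFrom H) (λ _ → L * N) + ∑ (downFrom H) (λ h → N * N * (2 * h + 6))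
        ≡⟨ cong₂ _+_ (trans (∑-const (downFrom H) (L * N)) (cong (_* (L * N)) (Listₚ.length-downFrom H)))
             (trans (∑-*ˡ (downFrom H) (N * N) (λ h → 2 * h + 6)) (cong (N * N *_) (∑-2h+6 H))) ⟩
      H * (L * N) + N * N * (H * H + 5 * H) ∎
      where
      pairs : ℕ → ℕ
      pairs h = ∑ (cartesianProduct is is) λ (m , n) → range ∣ z m - z n ∣ H h
      bound : ∀ h → h ∈ downFrom H → L * pairs h ≤ L * N + N * N * (2 * h + 6)
      bound h h∈ with ps , close⇒∈ps , ps≤ ← fewPairs h (∈-downFrom⁻ h∈) = begin
        L * pairs h                   ≤⟨ ℕₚ.*-monoʳ-≤ L (closePairs-bound h ps close⇒∈ps) ⟩
        L * (length is + length ps)   ≡⟨ cong (λ t → L * (t + length ps)) ∣is∣≡N ⟩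
        L * (N + length ps)           ≡⟨ ℕₚ.*-distribˡ-+ L N (length ps) ⟩
        L * N + L * length ps         ≤⟨ ℕₚ.+-monoʳ-≤ (L * N) ps≤ ⟩
        L * N + N * N * (2 * h + 6)   ∎

    H²+5H≤3L : (H + 5) * H ≤ 3 * L
    H²+5H≤3L = begin
      (H + 5) * H       ≤⟨ ℕₚ.*-monoˡ-≤ H (ℕₚ.+-monoʳ-≤ H 5≤2H) ⟩
      (H + 2 * H) * H   ≡⟨ collect H ⟩
      3 * (H * H)       ≤⟨ ℕₚ.*-monoʳ-≤ 3 H²≤L ⟩
      3 * L             ∎
      where
      5≤2H : 5 ≤ 2 * H
      5≤2H = ℕₚ.≤-trans (ℕₚ.n≤1+n 5) (ℕₚ.*-monoʳ-≤ 2 3≤H)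
      collect : ∀ H → (H + 2 * H) * H ≡ 3 * (H * H)
      collect = solve-∀

    T≤2L : T ≤ 2 * L
    T≤2L = begin
      L + H + 5           ≡⟨ ℕₚ.+-assoc L H 5 ⟩
      L + (H + 5)         ≤⟨ ℕₚ.+-monoʳ-≤ L H+5≤L ⟩
      L + L               ≡⟨ cong (L +_) (ℕₚ.+-identityʳ L) ⟨
      2 * L               ∎
      where
      collect : ∀ H → (H + 2 * H) ≡ 3 * H
      collect = solve-∀
      H+5≤L : H + 5 ≤ L
      H+5≤L = begin
        H + 5        ≤⟨ ℕₚ.+-monoʳ-≤ H (ℕₚ.≤-trans (ℕₚ.n≤1+n 5) (ℕₚ.*-monoʳ-≤ 2 3≤H)) ⟩
        H + 2 * H    ≡⟨ collect H ⟩
        3 * H        ≤⟨ ℕₚ.*-monoˡ-≤ H 3≤H ⟩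
        H * H        ≤⟨ H²≤L ⟩
        L            ∎

    -- Since the counts `f j` add up to `N * H`, the sum of `(L * f j - N * H)²` is the left side
    -- minus the first term on the right, which has been moved across to stay in ℕ. The constant is
    -- 10 = 2 + 3 + 5: 2 from the diagonal, 3 from the `H + 5` windows beyond `L`, and 5 from the
    -- `5 * H` in the second moment.
    variance : L * (L * S₂) + N * N * (H * H) * T ≤ 2 * (L * (N * N * (H * H))) + 10 * (L * (N * N * H))
    variance = begin
      L * (L * S₂) + N * N * (H * H) * T
        ≤⟨ ℕₚ.+-monoˡ-≤ (N * N * (H * H) * T) (ℕₚ.*-monoʳ-≤ L second-moment) ⟩
      L * (H * (L * N) + N * N * (H * H + 5 * H)) + N * N * (H * H) * (L + H + 5)
        ≡⟨ regroup₁ L H N ⟩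
      L * N * (L * H) + N * N * H * ((H + 5) * H) + (2 * (L * (N * N * (H * H))) + 5 * (L * (N * N * H)))
        ≤⟨ ℕₚ.+-monoˡ-≤ _ (ℕₚ.+-mono-≤ (ℕₚ.*-monoʳ-≤ (L * N)
             (ℕₚ.≤-trans LH≤ (ℕₚ.*-monoˡ-≤ N (ℕₚ.+-monoˡ-≤ H 1≤H))))
             (ℕₚ.*-monoʳ-≤ (N * N * H) H²+5H≤3L)) ⟩
      L * N * ((H + H) * N) + N * N * H * (3 * L) + (2 * (L * (N * N * (H * H))) + 5 * (L * (N * N * H)))
        ≡⟨ regroup₂ L H N ⟩
      2 * (L * (N * N * (H * H))) + 10 * (L * (N * N * H)) ∎
      where
      regroup₁ : ∀ L H N → L * (H * (L * N) + N * N * (H * H + 5 * H)) + N * N * (H * H) * (L + H + 5)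
        ≡ L * N * (L * H) + N * N * H * ((H + 5) * H) + (2 * (L * (N * N * (H * H))) + 5 * (L * (N * N * H)))
      regroup₁ = solve-∀
      regroup₂ : ∀ L H N → L * N * ((H + H) * N) + N * N * H * (3 * L) + (2 * (L * (N * N * (H * H))) + 5 * (L * (N * N * H)))
        ≡ 2 * (L * (N * N * (H * H))) + 10 * (L * (N * N * H))
      regroup₂ = solve-∀

    -- The window counts have mean close to N H / L; the AM-GM inequality compares
    -- them with the multiples c j / e of that mean.
    weighted : ∀ (c : ℕ → ℕ) →
      2 * (e * L * (N * H) * ∑ js (λ j → c j * windowCount j)) + e * e * (N * N * (H * H) * T)
        ≤ 2 * (e * e * (L * (N * N * (H * H)))) + L * (N * N * (H * H)) + N * N * (H * H) * ∑ js (λ j → c j * c j)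
    weighted c = begin
      2 * (e * L * (N * H) * ∑ js (λ j → c j * f j)) + e * e * (N * N * (H * H) * T)
        ≡⟨ cong (λ t → 2 * t + e * e * (N * N * (H * H) * T)) (∑-*ˡ js (e * L * (N * H)) (λ j → c j * f j)) ⟨
      2 * ∑ js (λ j → e * L * (N * H) * (c j * f j)) + e * e * (N * N * (H * H) * T)
        ≡⟨ cong (_+ e * e * (N * N * (H * H) * T)) (∑-*ˡ js 2 (λ j → e * L * (N * H) * (c j * f j))) ⟨
      ∑ js (λ j → 2 * (e * L * (N * H) * (c j * f j))) + e * e * (N * N * (H * H) * T)
        ≤⟨ ℕₚ.+-monoˡ-≤ _ (∑-mono js λ j _ → am-gm (c j) (f j)) ⟩
      ∑ js (λ j → e * e * (L * L) * (f j * f j) + N * N * (H * H) * (c j * c j)) + e * e * (N * N * (H * H) * T)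
        ≡⟨ cong (_+ e * e * (N * N * (H * H) * T)) (trans
             (∑-+ js (λ j → e * e * (L * L) * (f j * f j)) (λ j → N * N * (H * H) * (c j * c j)))
             (cong₂ _+_ (∑-*ˡ js (e * e * (L * L)) (λ j → f j * f j))
               (∑-*ˡ js (N * N * (H * H)) (λ j → c j * c j)))) ⟩
      e * e * (L * L) * S₂ + N * N * (H * H) * C + e * e * (N * N * (H * H) * T)
        ≡⟨ regroup₁ (e * e) L S₂ (N * N * (H * H)) C T ⟩
      e * e * (L * (L * S₂) + N * N * (H * H) * T) + N * N * (H * H) * C
        ≤⟨ ℕₚ.+-monoˡ-≤ (N * N * (H * H) * C) (ℕₚ.*-monoʳ-≤ (e * e) variance) ⟩
      e * e * (2 * (L * (N * N * (H * H))) + 10 * (L * (N * N * H))) + N * N * (H * H) * C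
        ≡⟨ regroup₂ (e * e) (L * (N * N * (H * H))) (L * (N * N * H)) (N * N * (H * H) * C) ⟩
      2 * (e * e * (L * (N * N * (H * H)))) + L * (N * N * H) * (10 * (e * e)) + N * N * (H * H) * C
        ≤⟨ ℕₚ.+-monoˡ-≤ (N * N * (H * H) * C) (ℕₚ.+-monoʳ-≤ (2 * (e * e * (L * (N * N * (H * H)))))
             (ℕₚ.≤-trans (ℕₚ.*-monoʳ-≤ (L * (N * N * H)) 10e²≤H) (ℕₚ.≤-reflexive (regroup₃ L N H)))) ⟩
      2 * (e * e * (L * (N * N * (H * H)))) + L * (N * N * (H * H)) + N * N * (H * H) * C ∎
      where
      f = windowCount
      C = ∑ js (λ j → c j * c j)
      regroup₁ : ∀ e² L S₂ M C T → e² * (L * L) * S₂ + M * C + e² * (M * T) ≡ e² * (L * (L * S₂) + M * T) + M * C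
      regroup₁ = solve-∀
      regroup₂ : ∀ e² a b c → e² * (2 * a + 10 * b) + c ≡ 2 * (e² * a) + b * (10 * e²) + c
      regroup₂ = solve-∀
      regroup₃ : ∀ L N H → L * (N * N * H) * H ≡ L * (N * N * (H * H))
      regroup₃ = solve-∀
      am-gm : ∀ cⱼ fⱼ → 2 * (e * L * (N * H) * (cⱼ * fⱼ)) ≤ e * e * (L * L) * (fⱼ * fⱼ) + N * N * (H * H) * (cⱼ * cⱼ)
      am-gm cⱼ fⱼ = subst₂ _≤_ (lhs e L N H cⱼ fⱼ) (rhs e L N H cⱼ fⱼ) (2uv≤u²+v² (e * L * fⱼ) (N * H * cⱼ))
        where
        lhs : ∀ e L N H c f → 2 * ((e * L * f) * (N * H * c)) ≡ 2 * (e * L * (N * H) * (c * f))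
        lhs = solve-∀
        rhs : ∀ e L N H c f → (e * L * f) * (e * L * f) + (N * H * c) * (N * H * c)
          ≡ e * e * (L * L) * (f * f) + N * N * (H * H) * (c * c)
        rhs = solve-∀

    module _ (p q : ℕ) where

      S I : ℕ
      S = ∑ js (λ j → range p q j * windowCount j)
      I = ∑ js (range p q)

      I≤2L : I ≤ 2 * L
      I≤2L = begin
        I             ≡⟨ ∑-range T p q ⟩
        q ⊓ T ∸ p     ≤⟨ ℕₚ.m∸n≤m (q ⊓ T) p ⟩
        q ⊓ T         ≤⟨ ℕₚ.m⊓n≤n q T ⟩
        T             ≤⟨ T≤2L ⟩
        2 * L         ∎

      -- Divided by `2 e L N H` this reads `S / (N H) ≤ I / L + 3 / (2 e)`. The weight is `e` plus
      -- the indicator of the run: its constant part reproduces the exact first moment and cancels,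
      -- leaving the part linear in the indicator. Of the error `3 * L`, one `L` is the variance and
      -- `2 * L` bounds the square of the indicator.
      range-upper : 2 * (e * L) * S ≤ N * H * (3 * L + 2 * e * I)
      range-upper = ℕₚ.*-cancelˡ-≤ (N * H) {{ℕ.>-nonZero (ℕₚ.*-mono-≤ 1≤N 1≤H)}}
        (ℕₚ.+-cancelˡ-≤ (2 * (e * L * (N * H) * (e * (N * H))) + e * e * (N * N * (H * H) * T)) _ _ (begin
        2 * (e * L * (N * H) * (e * (N * H))) + e * e * (N * N * (H * H) * T) + N * H * (2 * (e * L) * S)
          ≡⟨ regroup₁ e L (N * H) S (e * e * (N * N * (H * H) * T)) ⟩
        2 * (e * L * (N * H) * (e * (N * H) + S)) + e * e * (N * N * (H * H) * T)
          ≡⟨ cong (λ t → 2 * (e * L * (N * H) * t) + e * e * (N * N * (H * H) * T)) ∑cf ⟨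
        2 * (e * L * (N * H) * ∑ js (λ j → c j * windowCount j)) + e * e * (N * N * (H * H) * T)
          ≤⟨ weighted c ⟩
        2 * (e * e * (L * (N * N * (H * H)))) + L * (N * N * (H * H)) + N * N * (H * H) * ∑ js (λ j → c j * c j)
          ≡⟨ cong (λ t → 2 * (e * e * (L * (N * N * (H * H)))) + L * (N * N * (H * H)) + N * N * (H * H) * t) ∑c² ⟩
        2 * (e * e * (L * (N * N * (H * H)))) + L * (N * N * (H * H)) + N * N * (H * H) * (e * e * T + (2 * e * I + I))
          ≤⟨ ℕₚ.+-monoʳ-≤ (2 * (e * e * (L * (N * N * (H * H)))) + L * (N * N * (H * H))) (ℕₚ.*-monoʳ-≤ (N * N * (H * H))
               (ℕₚ.+-monoʳ-≤ (e * e * T) (ℕₚ.+-monoʳ-≤ (2 * e * I) I≤2L))) ⟩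
        2 * (e * e * (L * (N * N * (H * H)))) + L * (N * N * (H * H)) + N * N * (H * H) * (e * e * T + (2 * e * I + 2 * L))
          ≡⟨ regroup₂ e L N H T I ⟩
        2 * (e * L * (N * H) * (e * (N * H))) + e * e * (N * N * (H * H) * T) + N * H * (N * H * (3 * L + 2 * e * I)) ∎))
        where
        c : ℕ → ℕ
        c j = e + range p q j
        ∑cf : ∑ js (λ j → c j * windowCount j) ≡ e * (N * H) + S
        ∑cf = trans (∑-cong js λ j → ℕₚ.*-distribʳ-+ (windowCount j) e (range p q j))
          (trans (∑-+ js (λ j → e * windowCount j) (λ j → range p q j * windowCount j))
            (cong (_+ S) (trans (∑-*ˡ js e windowCount) (cong (e *_) total))))
        ∑c² : ∑ js (λ j → c j * c j) ≡ e * e * T + (2 * e * I + I)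
        ∑c² = trans (∑-cong js λ j → trans (square e (range p q j))
                (cong (λ t → e * e + (2 * e * range p q j + t)) (𝟙-idem (range? p q j))))
          (trans (∑-+ js (λ _ → e * e) (λ j → 2 * e * range p q j + range p q j))
            (cong₂ _+_ (trans (∑-const js (e * e)) (trans (cong (_* (e * e)) (Listₚ.length-downFrom T)) (ℕₚ.*-comm T (e * e))))
              (trans (∑-+ js (λ j → 2 * e * range p q j) (range p q))
                (cong (_+ I) (∑-*ˡ js (2 * e) (range p q))))))
          where
          square : ∀ e g → (e + g) * (e + g) ≡ e * e + (2 * e * g + g * g)
          square = solve-∀
        regroup₁ : ∀ e L M S t → 2 * (e * L * M * (e * M)) + t + M * (2 * (e * L) * S) ≡ 2 * (e * L * M * (e * M + S)) + t
        regroup₁ = solve-∀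
        regroup₂ : ∀ e L N H T I →
          2 * (e * e * (L * (N * N * (H * H)))) + L * (N * N * (H * H)) + N * N * (H * H) * (e * e * T + (2 * e * I + 2 * L))
          ≡ 2 * (e * L * (N * H) * (e * (N * H))) + e * e * (N * N * (H * H) * T) + N * H * (N * H * (3 * L + 2 * e * I))
        regroup₂ = solve-∀

      -- The mirror image of `range-upper`, with the indicator subtracted from the weight `e`. The
      -- assumption `1 ≤ e` makes this truncated subtraction exact.
      range-lower : 1 ≤ e → N * H * (2 * e * I) ≤ 2 * (e * L) * S + N * H * (3 * L)
      range-lower 1≤e = ℕₚ.*-cancelˡ-≤ (N * H) {{ℕ.>-nonZero (ℕₚ.*-mono-≤ 1≤N 1≤H)}}
        (ℕₚ.+-cancelˡ-≤ (2 * (e * L * (N * H) * (e * (N * H))) + e * e * (N * N * (H * H) * T)) _ _ (begin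
        2 * (e * L * (N * H) * (e * (N * H))) + e * e * (N * N * (H * H) * T) + N * H * (N * H * (2 * e * I))
          ≡⟨ cong (λ t → 2 * (e * L * (N * H) * t) + e * e * (N * N * (H * H) * T) + N * H * (N * H * (2 * e * I))) ∑cf ⟨
        2 * (e * L * (N * H) * (Cf + S)) + e * e * (N * N * (H * H) * T) + N * H * (N * H * (2 * e * I))
          ≡⟨ regroup₁ (e * L * (N * H)) Cf S (e * e * (N * N * (H * H) * T)) (N * H * (N * H * (2 * e * I))) ⟩
        2 * (e * L * (N * H) * Cf) + e * e * (N * N * (H * H) * T) + (2 * (e * L * (N * H) * S) + N * H * (N * H * (2 * e * I)))
          ≤⟨ ℕₚ.+-monoˡ-≤ (2 * (e * L * (N * H) * S) + N * H * (N * H * (2 * e * I))) (weighted c) ⟩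
        2 * (e * e * (L * (N * N * (H * H)))) + L * (N * N * (H * H)) + N * N * (H * H) * C² + (2 * (e * L * (N * H) * S) + N * H * (N * H * (2 * e * I)))
          ≡⟨ regroup₂ e L N H C² S I ⟩
        2 * (e * e * (L * (N * N * (H * H)))) + L * (N * N * (H * H)) + N * N * (H * H) * (C² + 2 * e * I) + 2 * (e * L * (N * H) * S)
          ≡⟨ cong (λ t → 2 * (e * e * (L * (N * N * (H * H)))) + L * (N * N * (H * H)) + N * N * (H * H) * t + 2 * (e * L * (N * H) * S)) ∑c² ⟩
        2 * (e * e * (L * (N * N * (H * H)))) + L * (N * N * (H * H)) + N * N * (H * H) * (e * e * T + I) + 2 * (e * L * (N * H) * S)
          ≤⟨ ℕₚ.+-monoˡ-≤ _ (ℕₚ.+-monoʳ-≤ (2 * (e * e * (L * (N * N * (H * H)))) + L * (N * N * (H * H)))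
               (ℕₚ.*-monoʳ-≤ (N * N * (H * H)) (ℕₚ.+-monoʳ-≤ (e * e * T) I≤2L))) ⟩
        2 * (e * e * (L * (N * N * (H * H)))) + L * (N * N * (H * H)) + N * N * (H * H) * (e * e * T + 2 * L) + 2 * (e * L * (N * H) * S)
          ≡⟨ regroup₃ e L N H T S ⟩
        2 * (e * L * (N * H) * (e * (N * H))) + e * e * (N * N * (H * H) * T) + N * H * (2 * (e * L) * S + N * H * (3 * L)) ∎))
        where
        c : ℕ → ℕ
        c j = e ∸ range p q j
        Cf C² : ℕ
        Cf = ∑ js (λ j → c j * windowCount j)
        C² = ∑ js (λ j → c j * c j)
        c+g≡e : ∀ j → c j + range p q j ≡ e
        c+g≡e j = ℕₚ.m∸n+n≡m (ℕₚ.≤-trans (𝟙≤1 (range? p q j)) 1≤e)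
        ∑cf : Cf + S ≡ e * (N * H)
        ∑cf = trans (sym (∑-+ js (λ j → c j * windowCount j) (λ j → range p q j * windowCount j)))
          (trans (∑-cong js λ j → trans (sym (ℕₚ.*-distribʳ-+ (windowCount j) (c j) (range p q j)))
            (cong (_* windowCount j) (c+g≡e j)))
            (trans (∑-*ˡ js e windowCount) (cong (e *_) total)))
        ∑c² : C² + 2 * e * I ≡ e * e * T + I
        ∑c² = trans (trans (cong (C² +_) (sym (∑-*ˡ js (2 * e) (range p q))))
                (sym (∑-+ js (λ j → c j * c j) (λ j → 2 * e * range p q j))))
          (trans (∑-cong js λ j → trans (square (c j) (range p q j) e (c+g≡e j)) (cong (e * e +_) (𝟙-idem (range? p q j))))
            (trans (∑-+ js (λ _ → e * e) (range p q))
              (cong (_+ I) (trans (∑-const js (e * e)) (trans (cong (_* (e * e)) (Listₚ.length-downFrom T)) (ℕₚ.*-comm T (e * e)))))))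
          where
          expand : ∀ c g → c * c + 2 * (c + g) * g ≡ (c + g) * (c + g) + g * g
          expand = solve-∀
          square : ∀ c g e → c + g ≡ e → c * c + 2 * e * g ≡ e * e + g * g
          square c g e refl = expand c g
        regroup₁ : ∀ M Cf S t u → 2 * (M * (Cf + S)) + t + u ≡ 2 * (M * Cf) + t + (2 * (M * S) + u)
        regroup₁ = solve-∀
        regroup₂ : ∀ e L N H C² S I →
          2 * (e * e * (L * (N * N * (H * H)))) + L * (N * N * (H * H)) + N * N * (H * H) * C² + (2 * (e * L * (N * H) * S) + N * H * (N * H * (2 * e * I)))
          ≡ 2 * (e * e * (L * (N * N * (H * H)))) + L * (N * N * (H * H)) + N * N * (H * H) * (C² + 2 * e * I) + 2 * (e * L * (N * H) * S)
        regroup₂ = solve-∀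
        regroup₃ : ∀ e L N H T S →
          2 * (e * e * (L * (N * N * (H * H)))) + L * (N * N * (H * H)) + N * N * (H * H) * (e * e * T + 2 * L) + 2 * (e * L * (N * H) * S)
          ≡ 2 * (e * L * (N * H) * (e * (N * H))) + e * e * (N * N * (H * H) * T) + N * H * (2 * (e * L) * S + N * H * (3 * L))
        regroup₃ = solve-∀

    module _ (xs : List ℕ) (xs! : Unique xs) (xs⊆is : ∀ {i} → i ∈ xs → i ∈ is) (a b : ℕ) where

      -- The run from `a ∸ 3` up to `b + 3 + H` is long enough to include all `H` windows around
      -- each point of `xs`, so `length xs * H` is at most the total count of the run.
      count-upper : a ≤ b + 6 → b ≤ L + 2 →
        (∀ i → i ∈ xs → a ≤ z i + 3 × z i ≤ b + 3) →
        2 * e * L * length xs + 2 * e * a * N ≤ 3 * L * N + 2 * e * (b + H + 6) * N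
      count-upper a≤b+6 b≤L+2 near = ℕₚ.*-cancelʳ-≤ _ _ H {{ℕ.>-nonZero 1≤H}} (begin
        (2 * e * L * length xs + 2 * e * a * N) * H
          ≡⟨ regroup₁ e L (length xs) a N H ⟩
        2 * (e * L) * (length xs * H) + N * H * (2 * e * a)
          ≤⟨ ℕₚ.+-monoˡ-≤ (N * H * (2 * e * a)) (ℕₚ.≤-trans (ℕₚ.*-monoʳ-≤ (2 * (e * L)) xs≤S) (range-upper p q)) ⟩
        N * H * (3 * L + 2 * e * I p q) + N * H * (2 * e * a)
          ≡⟨ regroup₂ N H L e (I p q) a ⟩
        N * H * (3 * L + 2 * e * (I p q + a))
          ≤⟨ ℕₚ.*-monoʳ-≤ (N * H) (ℕₚ.+-monoʳ-≤ (3 * L) (ℕₚ.*-monoʳ-≤ (2 * e) I+a≤)) ⟩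
        N * H * (3 * L + 2 * e * (b + H + 6))
          ≡⟨ regroup₃ N H L e (b + H + 6) ⟩
        (3 * L * N + 2 * e * (b + H + 6) * N) * H ∎)
        where
        p = a ∸ 3
        q = b + 3 + H
        regroup₁ : ∀ e L A a N H → (2 * e * L * A + 2 * e * a * N) * H ≡ 2 * (e * L) * (A * H) + N * H * (2 * e * a)
        regroup₁ = solve-∀
        regroup₂ : ∀ N H L e I a → N * H * (3 * L + 2 * e * I) + N * H * (2 * e * a) ≡ N * H * (3 * L + 2 * e * (I + a))
        regroup₂ = solve-∀
        regroup₃ : ∀ N H L e t → N * H * (3 * L + 2 * e * t) ≡ (3 * L * N + 2 * e * t * N) * H
        regroup₃ = solve-∀
        regroup₄ : ∀ b H → b + 3 + H + 3 ≡ b + H + 6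
        regroup₄ = solve-∀
        p≤q : p ≤ q
        p≤q = begin
          a ∸ 3       ≤⟨ ℕₚ.∸-monoˡ-≤ 3 a≤b+6 ⟩
          b + 6 ∸ 3   ≡⟨ ℕₚ.+-∸-assoc b {6} {3} (s≤s (s≤s (s≤s z≤n))) ⟩
          b + 3       ≤⟨ ℕₚ.m≤m+n (b + 3) H ⟩
          q           ∎
        I+a≤ : I p q + a ≤ b + H + 6
        I+a≤ = begin
          I p q + a           ≡⟨ cong (_+ a) (∑-range T p q) ⟩
          q ⊓ T ∸ p + a       ≤⟨ ℕₚ.+-mono-≤ (ℕₚ.∸-monoˡ-≤ p (ℕₚ.m⊓n≤m q T)) (ℕₚ.m≤n+m∸n a 3) ⟩
          q ∸ p + (3 + p)     ≡⟨ cong (q ∸ p +_) (ℕₚ.+-comm 3 p) ⟩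
          q ∸ p + (p + 3)     ≡⟨ ℕₚ.+-assoc (q ∸ p) p 3 ⟨
          q ∸ p + p + 3       ≡⟨ cong (_+ 3) (ℕₚ.m∸n+n≡m p≤q) ⟩
          q + 3               ≡⟨ regroup₄ b H ⟩
          b + H + 6           ∎
        full : ∀ i → i ∈ xs → H ≤ q ⊓ (z i + H) ∸ (p ⊔ z i)
        full i i∈ with a≤z+3 , z≤b+3 ← near i i∈ = ℕₚ.≤-reflexive (sym (trans
          (cong₂ _∸_ (ℕₚ.m≥n⇒m⊓n≡n (ℕₚ.+-monoˡ-≤ H z≤b+3))
            (ℕₚ.m≤n⇒m⊔n≡n (subst (p ≤_) (ℕₚ.m+n∸n≡m (z i) 3) (ℕₚ.∸-monoˡ-≤ 3 a≤z+3))))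
          (ℕₚ.m+n∸m≡n (z i) H)))
        xs≤S : length xs * H ≤ S p q
        xs≤S = begin
          length xs * H                                    ≡⟨ ∑-const xs H ⟨
          ∑ xs (λ _ → H)                                   ≤⟨ ∑-mono xs full ⟩
          ∑ xs (λ i → q ⊓ (z i + H) ∸ (p ⊔ z i))           ≤⟨ ∑-⊆ xs! is (λ i∈ _ → xs⊆is i∈) ⟩
          ∑ is (λ i → q ⊓ (z i + H) ∸ (p ⊔ z i))           ≡⟨ ∑-windowCount-range p q ⟨
          S p q                                            ∎

      -- Here the run is shortened instead: a window with index in `[a + 3 + H, b ∸ 3)` consists of
      -- bins strictly between `a + 3` and `b ∸ 3`, so it contains points of `xs` only, and each of
      -- these is counted at most `H` times.
      count-lower : 1 ≤ e → b ≤ L + 2 →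
        (∀ i → i ∈ is → a + 3 ≤ z i → z i + 3 ≤ b → i ∈ xs) →
        2 * e * b * N ≤ 2 * e * L * length xs + 3 * L * N + 2 * e * (a + H + 6) * N
      count-lower 1≤e b≤L+2 inner = ℕₚ.*-cancelʳ-≤ _ _ H {{ℕ.>-nonZero 1≤H}} (begin
        2 * e * b * N * H
          ≡⟨ regroup₁ e b N H ⟩
        N * H * (2 * e * b)
          ≤⟨ ℕₚ.*-monoʳ-≤ (N * H) (ℕₚ.*-monoʳ-≤ (2 * e) b≤) ⟩
        N * H * (2 * e * (I p q + (a + H + 6)))
          ≡⟨ regroup₂ N H e (I p q) (a + H + 6) ⟩
        N * H * (2 * e * I p q) + N * H * (2 * e * (a + H + 6))
          ≤⟨ ℕₚ.+-monoˡ-≤ _ (ℕₚ.≤-trans (range-lower p q 1≤e)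
               (ℕₚ.+-monoˡ-≤ (N * H * (3 * L)) (ℕₚ.*-monoʳ-≤ (2 * (e * L)) S≤xs))) ⟩
        2 * (e * L) * (length xs * H) + N * H * (3 * L) + N * H * (2 * e * (a + H + 6))
          ≡⟨ regroup₃ N H L e (length xs) (a + H + 6) ⟩
        (2 * e * L * length xs + 3 * L * N + 2 * e * (a + H + 6) * N) * H ∎)
        where
        p = a + 3 + H
        q = b ∸ 3
        regroup₁ : ∀ e b N H → 2 * e * b * N * H ≡ N * H * (2 * e * b)
        regroup₁ = solve-∀
        regroup₂ : ∀ N H e I t → N * H * (2 * e * (I + t)) ≡ N * H * (2 * e * I) + N * H * (2 * e * t)
        regroup₂ = solve-∀
        regroup₃ : ∀ N H L e A t → 2 * (e * L) * (A * H) + N * H * (3 * L) + N * H * (2 * e * t)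
          ≡ (2 * e * L * A + 3 * L * N + 2 * e * t * N) * H
        regroup₃ = solve-∀
        regroup₄ : ∀ a H I → 3 + (a + 3 + H + I) ≡ I + (a + H + 6)
        regroup₄ = solve-∀
        q≤T : q ≤ T
        q≤T = begin
          b ∸ 3       ≤⟨ ℕₚ.m∸n≤m b 3 ⟩
          b           ≤⟨ b≤L+2 ⟩
          L + 2       ≤⟨ ℕₚ.+-mono-≤ (ℕₚ.m≤m+n L H) (s≤s (s≤s z≤n)) ⟩
          T           ∎
        b≤ : b ≤ I p q + (a + H + 6)
        b≤ = begin
          b                        ≤⟨ ℕₚ.m≤n+m∸n b 3 ⟩
          3 + q                    ≤⟨ ℕₚ.+-monoʳ-≤ 3 (ℕₚ.m≤n+m∸n q p) ⟩
          3 + (p + (q ∸ p))        ≡⟨ cong (λ t → 3 + (p + t)) (trans (∑-range T p q) (cong (_∸ p) (ℕₚ.m≤n⇒m⊓n≡m q≤T))) ⟨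
          3 + (p + I p q)          ≡⟨ regroup₄ a H (I p q) ⟩
          I p q + (a + H + 6)      ∎
        nonzero⇒∈ : ∀ {i} → i ∈ is → q ⊓ (z i + H) ∸ (p ⊔ z i) ≢ 0 → i ∈ xs
        nonzero⇒∈ {i} i∈ ≢0 = inner i i∈ a+3≤z z+3≤b
          where
          p⊔z<q⊓z+H : p ⊔ z i < q ⊓ (z i + H)
          p⊔z<q⊓z+H = ℕₚ.≰⇒> λ h → ≢0 (ℕₚ.m≤n⇒m∸n≡0 h)
          a+3≤z : a + 3 ≤ z i
          a+3≤z = ℕₚ.<⇒≤ (ℕₚ.+-cancelʳ-< H (a + 3) (z i)
            (ℕₚ.≤-<-trans (ℕₚ.m≤m⊔n p (z i)) (ℕₚ.<-≤-trans p⊔z<q⊓z+H (ℕₚ.m⊓n≤n q (z i + H)))))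
          z<q : z i < q
          z<q = ℕₚ.≤-<-trans (ℕₚ.m≤n⊔m p (z i)) (ℕₚ.<-≤-trans p⊔z<q⊓z+H (ℕₚ.m⊓n≤m q (z i + H)))
          z+3≤b : z i + 3 ≤ b
          z+3≤b = ℕₚ.m≤o∸n⇒m+n≤o (z i) (ℕₚ.<⇒≤ (ℕₚ.m∸n≢0⇒n<m (ℕₚ.m<n⇒n≢0 z<q))) (ℕₚ.<⇒≤ z<q)
        S≤xs : S p q ≤ length xs * H
        S≤xs = begin
          S p q                                            ≡⟨ ∑-windowCount-range p q ⟩
          ∑ is (λ i → q ⊓ (z i + H) ∸ (p ⊔ z i))           ≤⟨ ∑-⊆ is! xs nonzero⇒∈ ⟩
          ∑ xs (λ i → q ⊓ (z i + H) ∸ (p ⊔ z i))           ≤⟨ ∑-mono xs (λ i _ → ℕₚ.∸-mono (ℕₚ.m⊓n≤n q (z i + H)) (ℕₚ.m≤n⊔m p (z i))) ⟩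
          ∑ xs (λ i → z i + H ∸ z i)                       ≡⟨ ∑-cong xs (λ i → ℕₚ.m+n∸m≡n (z i) H) ⟩
          ∑ xs (λ _ → H)                                   ≡⟨ ∑-const xs H ⟩
          length xs * H                                    ∎

-- Natural numbers inside ℚ, and bounds for the approximate powers of `N`.

module Powers where

  open R using (powApprox; powNumerator)
  open R.RationalLemmas
  open R.PowerLemmas
  open import Data.Integer using (+_; -[1+_])
  open import Data.Rational using (_+_; _*_; _≤_; _<_)
  open +-*-Solver using (solve; _:+_; _:*_; _:=_; con)

  -- Opaque, since unification cannot invert the normalisation hidden in ℚ._/_.
  opaque
    ⟦_⟧ : ℕ → ℚ
    ⟦ n ⟧ = + n ℚ./ 1

    ⟦⟧-def : ∀ n → + n ℚ./ 1 ≡ ⟦ n ⟧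
    ⟦⟧-def n = refl

    ⟦0⟧ : ⟦ 0 ⟧ ≡ 0ℚ
    ⟦0⟧ = refl

    ⟦1⟧ : ⟦ 1 ⟧ ≡ 1ℚ
    ⟦1⟧ = refl

  toℚᵘ-⟦⟧ : ∀ n → ℚ.toℚᵘ ⟦ n ⟧ ℚᵘ.≃ mkℚᵘ (+ n) 0
  toℚᵘ-⟦⟧ n = subst (λ p → ℚ.toℚᵘ p ℚᵘ.≃ mkℚᵘ (+ n) 0) (⟦⟧-def n) (ℚₚ.toℚᵘ-fromℚᵘ (mkℚᵘ (+ n) 0))

  ⟦⟧-+ : ∀ m n → ⟦ m ℕ.+ n ⟧ ≡ ⟦ m ⟧ + ⟦ n ⟧
  ⟦⟧-+ m n = ℚₚ.toℚᵘ-injective (ℚᵘₚ.≃-trans (toℚᵘ-⟦⟧ (m ℕ.+ n)) (ℚᵘₚ.≃-sym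
    (ℚᵘₚ.≃-trans (ℚₚ.toℚᵘ-homo-+ ⟦ m ⟧ ⟦ n ⟧) (ℚᵘₚ.≃-trans (ℚᵘₚ.+-cong (toℚᵘ-⟦⟧ m) (toℚᵘ-⟦⟧ n))
      (ℚᵘ.*≡* (cong (ℤ._* + 1) (cong₂ ℤ._+_ (ℤₚ.*-identityʳ (+ m)) (ℤₚ.*-identityʳ (+ n)))))))))

  ⟦⟧-* : ∀ m n → ⟦ m ℕ.* n ⟧ ≡ ⟦ m ⟧ * ⟦ n ⟧
  ⟦⟧-* m n = ℚₚ.toℚᵘ-injective (ℚᵘₚ.≃-trans (toℚᵘ-⟦⟧ (m ℕ.* n)) (ℚᵘₚ.≃-sym
    (ℚᵘₚ.≃-trans (ℚₚ.toℚᵘ-homo-* ⟦ m ⟧ ⟦ n ⟧) (ℚᵘₚ.≃-trans (ℚᵘₚ.*-cong (toℚᵘ-⟦⟧ m) (toℚᵘ-⟦⟧ n))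
      (ℚᵘ.*≡* (cong (ℤ._* + 1) (sym (ℤₚ.pos-* m n))))))))

  ⟦⟧-mono-≤ : ∀ {m n} → m ℕ.≤ n → ⟦ m ⟧ ≤ ⟦ n ⟧
  ⟦⟧-mono-≤ {m} {n} m≤n = ℚₚ.toℚᵘ-cancel-≤ (ℚᵘₚ.≤-respˡ-≃ (ℚᵘₚ.≃-sym (toℚᵘ-⟦⟧ m))
    (ℚᵘₚ.≤-respʳ-≃ (ℚᵘₚ.≃-sym (toℚᵘ-⟦⟧ n)) (ℚᵘ.*≤* (ℤₚ.*-monoʳ-≤-nonNeg (+ 1) (ℤ.+≤+ m≤n)))))

  ⟦⟧-cancel-≤ : ∀ {m n} → ⟦ m ⟧ ≤ ⟦ n ⟧ → m ℕ.≤ n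
  ⟦⟧-cancel-≤ {m} {n} h = ℤₚ.drop‿+≤+ (subst₂ ℤ._≤_ (ℤₚ.*-identityʳ (+ m)) (ℤₚ.*-identityʳ (+ n))
    (ℚᵘₚ.drop-*≤* (ℚᵘₚ.≤-respˡ-≃ (toℚᵘ-⟦⟧ m) (ℚᵘₚ.≤-respʳ-≃ (toℚᵘ-⟦⟧ n) (ℚₚ.toℚᵘ-mono-≤ h)))))

  ⟦⟧-injective : ∀ {m n} → ⟦ m ⟧ ≡ ⟦ n ⟧ → m ≡ n
  ⟦⟧-injective eq = ℕₚ.≤-antisym (⟦⟧-cancel-≤ (ℚₚ.≤-reflexive eq)) (⟦⟧-cancel-≤ (ℚₚ.≤-reflexive (sym eq)))

  0≤⟦⟧ : ∀ n → 0ℚ ≤ ⟦ n ⟧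
  0≤⟦⟧ n = subst (_≤ ⟦ n ⟧) ⟦0⟧ (⟦⟧-mono-≤ z≤n)

  0<⟦⟧ : ∀ {n} → 1 ℕ.≤ n → 0ℚ < ⟦ n ⟧
  0<⟦⟧ {n} 1≤n = ℚₚ.<-≤-trans (ℚₚ.positive⁻¹ 1ℚ) (subst (_≤ ⟦ n ⟧) ⟦1⟧ (⟦⟧-mono-≤ 1≤n))

  /-*-⟦⟧ : ∀ n d .{{_ : NonZero d}} → (+ n ℚ./ d) * ⟦ d ⟧ ≡ ⟦ n ⟧
  /-*-⟦⟧ n d@(suc d-1) = ℚₚ.toℚᵘ-injective (ℚᵘₚ.≃-trans (ℚₚ.toℚᵘ-homo-* (+ n ℚ./ d) ⟦ d ⟧)
    (ℚᵘₚ.≃-trans (ℚᵘₚ.*-cong (ℚₚ.toℚᵘ-fromℚᵘ (mkℚᵘ (+ n) d-1)) (toℚᵘ-⟦⟧ d))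
      (ℚᵘₚ.≃-trans (ℚᵘ.*≡* (regroup (+ n) (+ d))) (ℚᵘₚ.≃-sym (toℚᵘ-⟦⟧ n)))))
    where
    regroup : ∀ n d → n ℤ.* d ℤ.* + 1 ≡ n ℤ.* (d ℤ.* + 1)
    regroup n d = ℤₚ.*-assoc n d (+ 1)

  *-⟦↧⟧ : ∀ {a} → 0ℚ ≤ a → a * ⟦ ℚ.↧ₙ a ⟧ ≡ ⟦ ℤ.∣ ℚ.↥ a ∣ ⟧
  *-⟦↧⟧ {mkℚ -[1+ _ ] _ _} 0≤a with () ← ℚ.nonNegative 0≤a
  *-⟦↧⟧ {a@(mkℚ (+ p) q-1 _)} _ = trans (cong (_* ⟦ suc q-1 ⟧) (sym (ℚₚ.↥p/↧p≡p a))) (/-*-⟦⟧ p (suc q-1))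

  1≤⟦suc⟧*⇐ : ∀ {ε} e → + 1 ℚ./ suc e ≤ ε → 1ℚ ≤ ε * ⟦ suc e ⟧
  1≤⟦suc⟧*⇐ {ε} e h = subst (_≤ ε * ⟦ suc e ⟧) (trans (/-*-⟦⟧ 1 (suc e)) ⟦1⟧)
    (ℚₚ.*-monoʳ-≤-nonNeg ⟦ suc e ⟧ {{ℚ.nonNegative (0≤⟦⟧ (suc e))}} h)

  *-cancelʳ-≤ : ∀ {p q} r → 0ℚ < r → p * r ≤ q * r → p ≤ q
  *-cancelʳ-≤ r 0<r = ℚₚ.*-cancelʳ-≤-pos r {{ℚ.positive 0<r}}

  *-monoʳ-≤ : ∀ r → 0ℚ ≤ r → ∀ {p q} → p ≤ q → p * r ≤ q * r
  *-monoʳ-≤ r 0≤r = ℚₚ.*-monoʳ-≤-nonNeg r {{ℚ.nonNegative 0≤r}}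

  *-monoˡ-≤ : ∀ r → 0ℚ ≤ r → ∀ {p q} → p ≤ q → r * p ≤ r * q
  *-monoˡ-≤ r 0≤r = ℚₚ.*-monoˡ-≤-nonNeg r {{ℚ.nonNegative 0≤r}}

  -- The surplus `c ≥ 1 / E` in the exponent is worth a factor `A`, because `A ^ E ≤ N`. Rounding
  -- loses nothing: `N ^ m * A * suc k` is an integer, hence itself a candidate for the rounded
  -- root.
  powApprox-≥ : ∀ N .{{_ : NonZero N}} m A E .{{_ : NonZero E}} {a c} k →
    0ℚ ≤ a → ⟦ m ⟧ + c ≤ a → 1ℚ ≤ c * ⟦ E ⟧ → A ℕ.^ E ℕ.≤ N →
    ⟦ N ℕ.^ m ℕ.* A ⟧ ≤ powApprox N a k
  powApprox-≥ N m A E {a} {c} k 0≤a m+c≤a 1≤cE A^E≤N =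
    *-cancelʳ-≤ ⟦ suc k ⟧ (0<⟦⟧ (s≤s z≤n)) (subst₂ _≤_ (⟦⟧-* (N ℕ.^ m ℕ.* A) (suc k)) (sym (/-*-⟦⟧ r (suc k)))
      (⟦⟧-mono-≤ (ℕ.s≤s⁻¹ (^-cancelˡ-< q (begin-strict
        (N ℕ.^ m ℕ.* A ℕ.* suc k) ℕ.^ q              ≡⟨ ^-distribʳ-* q (N ℕ.^ m ℕ.* A) (suc k) ⟩
        (N ℕ.^ m ℕ.* A) ℕ.^ q ℕ.* suc k ℕ.^ q        ≤⟨ ℕₚ.*-monoˡ-≤ (suc k ℕ.^ q) base ⟩
        N ℕ.^ p ℕ.* suc k ℕ.^ q                      <⟨ floorRoot-lower q (N ℕ.^ p ℕ.* suc k ℕ.^ q) ⟩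
        suc r ℕ.^ q                                  ∎)))))
    where
    open ℕₚ.≤-Reasoning
    p = ℤ.∣ ℚ.↥ a ∣
    q = ℚ.↧ₙ a
    r = powNumerator N a k
    exponents : m ℕ.* q ℕ.* E ℕ.+ q ℕ.≤ p ℕ.* E
    exponents = ⟦⟧-cancel-≤ (subst₂ _≤_
      (sym (trans (⟦⟧-+ (m ℕ.* q ℕ.* E) q) (cong (_+ ⟦ q ⟧) (trans (⟦⟧-* (m ℕ.* q) E) (cong (_* ⟦ E ⟧) (⟦⟧-* m q))))))
      (trans (cong (_* ⟦ E ⟧) (*-⟦↧⟧ 0≤a)) (sym (⟦⟧-* p E)))
      (ℚₚ.≤-trans (subst₂ _≤_ (lhs ⟦ m ⟧ ⟦ q ⟧ ⟦ E ⟧) (rhs ⟦ m ⟧ ⟦ q ⟧ ⟦ E ⟧ c)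
        (ℚₚ.+-monoʳ-≤ (⟦ m ⟧ * ⟦ q ⟧ * ⟦ E ⟧) (*-monoʳ-≤ ⟦ q ⟧ (0≤⟦⟧ q) 1≤cE)))
        (*-monoʳ-≤ ⟦ E ⟧ (0≤⟦⟧ E) (*-monoʳ-≤ ⟦ q ⟧ (0≤⟦⟧ q) m+c≤a))))
      where
      lhs : ∀ m q E → m * q * E + 1ℚ * q ≡ m * q * E + q
      lhs = solve 3 (λ m q E → m :* q :* E :+ con 1ℚ :* q := m :* q :* E :+ q) refl
      rhs : ∀ m q E c → m * q * E + c * E * q ≡ (m + c) * q * E
      rhs = solve 4 (λ m q E c → m :* q :* E :+ c :* E :* q := (m :+ c) :* q :* E) refl
    base : (N ℕ.^ m ℕ.* A) ℕ.^ q ℕ.≤ N ℕ.^ p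
    base = ^-cancelˡ-≤ E (begin
      ((N ℕ.^ m ℕ.* A) ℕ.^ q) ℕ.^ E                   ≡⟨ ℕₚ.^-*-assoc (N ℕ.^ m ℕ.* A) q E ⟩
      (N ℕ.^ m ℕ.* A) ℕ.^ (q ℕ.* E)                   ≡⟨ ^-distribʳ-* (q ℕ.* E) (N ℕ.^ m) A ⟩
      (N ℕ.^ m) ℕ.^ (q ℕ.* E) ℕ.* A ℕ.^ (q ℕ.* E)     ≡⟨ cong₂ ℕ._*_
                                                           (trans (ℕₚ.^-*-assoc N m (q ℕ.* E)) (cong (N ℕ.^_) (sym (ℕₚ.*-assoc m q E))))
                                                           (trans (cong (A ℕ.^_) (ℕₚ.*-comm q E)) (sym (ℕₚ.^-*-assoc A E q))) ⟩
      N ℕ.^ (m ℕ.* q ℕ.* E) ℕ.* (A ℕ.^ E) ℕ.^ q       ≤⟨ ℕₚ.*-monoʳ-≤ (N ℕ.^ (m ℕ.* q ℕ.* E)) (ℕₚ.^-monoˡ-≤ q A^E≤N) ⟩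
      N ℕ.^ (m ℕ.* q ℕ.* E) ℕ.* N ℕ.^ q               ≡⟨ ℕₚ.^-distribˡ-+-* N (m ℕ.* q ℕ.* E) q ⟨
      N ℕ.^ (m ℕ.* q ℕ.* E ℕ.+ q)                     ≤⟨ ℕₚ.^-monoʳ-≤ N exponents ⟩
      N ℕ.^ (p ℕ.* E)                                 ≡⟨ ℕₚ.^-*-assoc N p E ⟨
      (N ℕ.^ p) ℕ.^ E                                 ∎)

  -- Both approximations round down, so the law `N ^ a * N ^ b = N ^ 2` survives as an inequality at
  -- every single stage `k`. Raising to the power `q * q′` clears both roots.
  powApprox-product : ∀ N {a b} k → 0ℚ ≤ a → 0ℚ ≤ b → a + b ≡ ⟦ 2 ⟧ →
    powApprox N a k * powApprox N b k ≤ ⟦ N ℕ.* N ⟧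
  powApprox-product N {a@record{}} {b@record{}} k 0≤a 0≤b a+b≡2 =
    *-cancelʳ-≤ (⟦ K ⟧ * ⟦ K ⟧) (0<p*q (0<⟦⟧ {K} (s≤s z≤n)) (0<⟦⟧ {K} (s≤s z≤n)))
      (subst₂ _≤_ lhs rhs (⟦⟧-mono-≤ (^-cancelˡ-≤ (q ℕ.* q′) {{ℕₚ.m*n≢0 q q′}} (begin
        (r ℕ.* r′) ℕ.^ (q ℕ.* q′)
          ≡⟨ ^-distribʳ-* (q ℕ.* q′) r r′ ⟩
        r ℕ.^ (q ℕ.* q′) ℕ.* r′ ℕ.^ (q ℕ.* q′)
          ≡⟨ cong₂ ℕ._*_ (sym (ℕₚ.^-*-assoc r q q′)) (trans (cong (r′ ℕ.^_) (ℕₚ.*-comm q q′)) (sym (ℕₚ.^-*-assoc r′ q′ q))) ⟩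
        (r ℕ.^ q) ℕ.^ q′ ℕ.* (r′ ℕ.^ q′) ℕ.^ q
          ≤⟨ ℕₚ.*-mono-≤ (ℕₚ.^-monoˡ-≤ q′ (floorRoot-upper q (N ℕ.^ p ℕ.* K ℕ.^ q)))
               (ℕₚ.^-monoˡ-≤ q (floorRoot-upper q′ (N ℕ.^ p′ ℕ.* K ℕ.^ q′))) ⟩
        (N ℕ.^ p ℕ.* K ℕ.^ q) ℕ.^ q′ ℕ.* (N ℕ.^ p′ ℕ.* K ℕ.^ q′) ℕ.^ q
          ≡⟨ cong₂ ℕ._*_ (expand p q q′ refl) (expand p′ q′ q {q ℕ.* q′} (ℕₚ.*-comm q′ q)) ⟩
        N ℕ.^ (p ℕ.* q′) ℕ.* K ℕ.^ (q ℕ.* q′) ℕ.* (N ℕ.^ (p′ ℕ.* q) ℕ.* K ℕ.^ (q ℕ.* q′))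
          ≡⟨ interchange (N ℕ.^ (p ℕ.* q′)) _ (N ℕ.^ (p′ ℕ.* q)) _ ⟩
        N ℕ.^ (p ℕ.* q′) ℕ.* N ℕ.^ (p′ ℕ.* q) ℕ.* (K ℕ.^ (q ℕ.* q′) ℕ.* K ℕ.^ (q ℕ.* q′))
          ≡⟨ cong₂ ℕ._*_ N-power (sym (^-distribʳ-* (q ℕ.* q′) K K)) ⟩
        (N ℕ.* N) ℕ.^ (q ℕ.* q′) ℕ.* (K ℕ.* K) ℕ.^ (q ℕ.* q′)
          ≡⟨ ^-distribʳ-* (q ℕ.* q′) (N ℕ.* N) (K ℕ.* K) ⟨
        (N ℕ.* N ℕ.* (K ℕ.* K)) ℕ.^ (q ℕ.* q′) ∎))))
    where
    open ℕₚ.≤-Reasoning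
    K = suc k
    p = ℤ.∣ ℚ.↥ a ∣
    q = ℚ.↧ₙ a
    r = powNumerator N a k
    p′ = ℤ.∣ ℚ.↥ b ∣
    q′ = ℚ.↧ₙ b
    r′ = powNumerator N b k
    lhs : ⟦ r ℕ.* r′ ⟧ ≡ powApprox N a k * powApprox N b k * (⟦ K ⟧ * ⟦ K ⟧)
    lhs = trans (⟦⟧-* r r′) (trans (cong₂ _*_ (sym (/-*-⟦⟧ r K)) (sym (/-*-⟦⟧ r′ K)))
      (regroup (powApprox N a k) ⟦ K ⟧ (powApprox N b k)))
      where
      regroup : ∀ a K b → (a * K) * (b * K) ≡ a * b * (K * K)
      regroup = solve 3 (λ a K b → (a :* K) :* (b :* K) := a :* b :* (K :* K)) refl
    rhs : ⟦ N ℕ.* N ℕ.* (K ℕ.* K) ⟧ ≡ ⟦ N ℕ.* N ⟧ * (⟦ K ⟧ * ⟦ K ⟧)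
    rhs = trans (⟦⟧-* (N ℕ.* N) (K ℕ.* K)) (cong (⟦ N ℕ.* N ⟧ *_) (⟦⟧-* K K))
    exponents : p ℕ.* q′ ℕ.+ p′ ℕ.* q ≡ q ℕ.* q′ ℕ.+ q ℕ.* q′
    exponents = ⟦⟧-injective (trans (⟦⟧-+ (p ℕ.* q′) (p′ ℕ.* q)) (trans
      (cong₂ _+_ (trans (⟦⟧-* p q′) (cong (_* ⟦ q′ ⟧) (sym (*-⟦↧⟧ 0≤a))))
                 (trans (⟦⟧-* p′ q) (cong (_* ⟦ q ⟧) (sym (*-⟦↧⟧ 0≤b)))))
      (trans (factor a b ⟦ q ⟧ ⟦ q′ ⟧) (trans (cong (_* (⟦ q ⟧ * ⟦ q′ ⟧)) a+b≡2)
        (trans (double (⟦ q ⟧ * ⟦ q′ ⟧)) (sym (trans (⟦⟧-+ (q ℕ.* q′) (q ℕ.* q′)) (cong₂ _+_ (⟦⟧-* q q′) (⟦⟧-* q q′)))))))))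
      where
      factor : ∀ a b q q′ → a * q * q′ + b * q′ * q ≡ (a + b) * (q * q′)
      factor = solve 4 (λ a b q q′ → a :* q :* q′ :+ b :* q′ :* q := (a :+ b) :* (q :* q′)) refl
      double : ∀ t → ⟦ 2 ⟧ * t ≡ t + t
      double t = trans (cong (_* t) (trans (⟦⟧-+ 1 1) (cong₂ _+_ ⟦1⟧ ⟦1⟧)))
        (solve 1 (λ t → (con 1ℚ :+ con 1ℚ) :* t := t :+ t) refl t)
    expand : ∀ p q q′ {t} → q ℕ.* q′ ≡ t → (N ℕ.^ p ℕ.* K ℕ.^ q) ℕ.^ q′ ≡ N ℕ.^ (p ℕ.* q′) ℕ.* K ℕ.^ t
    expand p q q′ refl = trans (^-distribʳ-* q′ (N ℕ.^ p) (K ℕ.^ q)) (cong₂ ℕ._*_ (ℕₚ.^-*-assoc N p q′) (ℕₚ.^-*-assoc K q q′))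
    interchange : ∀ a b c d → a ℕ.* b ℕ.* (c ℕ.* d) ≡ a ℕ.* c ℕ.* (b ℕ.* d)
    interchange = solve-∀
    N-power : N ℕ.^ (p ℕ.* q′) ℕ.* N ℕ.^ (p′ ℕ.* q) ≡ (N ℕ.* N) ℕ.^ (q ℕ.* q′)
    N-power = trans (sym (ℕₚ.^-distribˡ-+-* N (p ℕ.* q′) (p′ ℕ.* q))) (trans (cong (N ℕ.^_) exponents)
      (trans (ℕₚ.^-distribˡ-+-* N (q ℕ.* q′) (q ℕ.* q′)) (sym (^-distribʳ-* (q ℕ.* q′) N N))))

  -- Reified sums and products, so that an inequality moves between ℕ and ℚ by naming its two sides
  -- once.
  data Expr : Set where
    [_]     : ℕ → Expr
    _⊕_ _⊗_ : Expr → Expr → Expr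

  infixl 6 _⊕_
  infixl 7 _⊗_

  evalℕ : Expr → ℕ
  evalℕ [ n ]   = n
  evalℕ (s ⊕ t) = evalℕ s ℕ.+ evalℕ t
  evalℕ (s ⊗ t) = evalℕ s ℕ.* evalℕ t

  evalℚ : Expr → ℚ
  evalℚ [ n ]   = ⟦ n ⟧
  evalℚ (s ⊕ t) = evalℚ s + evalℚ t
  evalℚ (s ⊗ t) = evalℚ s * evalℚ t

  ⟦⟧-eval : ∀ t → ⟦ evalℕ t ⟧ ≡ evalℚ t
  ⟦⟧-eval [ n ]   = refl
  ⟦⟧-eval (s ⊕ t) = trans (⟦⟧-+ (evalℕ s) (evalℕ t)) (cong₂ _+_ (⟦⟧-eval s) (⟦⟧-eval t))
  ⟦⟧-eval (s ⊗ t) = trans (⟦⟧-* (evalℕ s) (evalℕ t)) (cong₂ _*_ (⟦⟧-eval s) (⟦⟧-eval t))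

  lift-≤ : ∀ s t → evalℕ s ℕ.≤ evalℕ t → evalℚ s ≤ evalℚ t
  lift-≤ s t h = subst₂ _≤_ (⟦⟧-eval s) (⟦⟧-eval t) (⟦⟧-mono-≤ h)

  lower-≤ : ∀ s t → evalℚ s ≤ evalℚ t → evalℕ s ℕ.≤ evalℕ t
  lower-≤ s t h = ⟦⟧-cancel-≤ (subst₂ _≤_ (sym (⟦⟧-eval s)) (sym (⟦⟧-eval t)) h)

  ⟦2⟧ : ⟦ 2 ⟧ ≡ 1ℚ + 1ℚ
  ⟦2⟧ = trans (⟦⟧-+ 1 1) (cong₂ _+_ ⟦1⟧ ⟦1⟧)


-- Approximate bins of real numbers.

module Binning where

  open R using (ℝ; seq; cauchy; Eventually; fromℚ; recip; 0ℝ; 1ℝ; ≤-intro; <-intro; eventually-≤)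
  open R.RationalLemmas
  open Powers
  open import Data.Rational using (_+_; _*_; _≤_; _<_)
  open +-*-Solver using (solve; _:+_; _:*_; _:-_; _:=_; con)
  open ℚₚ.≤-Reasoning

  p≤p+q : ∀ p {q} → 0ℚ ≤ q → p ≤ p + q
  p≤p+q p {q} 0≤q = subst (_≤ p + q) (ℚₚ.+-identityʳ p) (ℚₚ.+-monoʳ-≤ p 0≤q)

  infixr 4 _∧_

  _∧_ : ∀ {P Q : ℕ → Set} → Eventually P → Eventually Q → Eventually λ n → P n × Q n
  (M , p) ∧ (N , q) = M ℕ.⊔ N , λ n ≤n → p n (ℕₚ.m⊔n≤o⇒m≤o M N ≤n) , q n (ℕₚ.m⊔n≤o⇒n≤o M N ≤n)

  eventually-map : ∀ {P Q : ℕ → Set} → (∀ n → P n → Q n) → Eventually P → Eventually Q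
  eventually-map f (N , p) = N , λ n N≤n → f n (p n N≤n)

  sometime : ∀ {P : ℕ → Set} → Eventually P → ∃[ n ] P n
  sometime (N , p) = N , p N ℕₚ.≤-refl

  floor : ∀ {p} → 0ℚ ≤ p → ∃[ z ] ⟦ z ⟧ ≤ p × p ≤ ⟦ z ⟧ + 1ℚ
  floor {p@record{}} 0≤p = z , *-cancelʳ-≤ ⟦ d ⟧ (0<⟦⟧ (s≤s z≤n)) below , *-cancelʳ-≤ ⟦ d ⟧ (0<⟦⟧ (s≤s z≤n)) above
    where
    n = ℤ.∣ ℚ.↥ p ∣
    d = ℚ.↧ₙ p
    z = n ℕᵈ./ d
    below : ⟦ z ⟧ * ⟦ d ⟧ ≤ p * ⟦ d ⟧
    below = subst₂ _≤_ (⟦⟧-* z d) (sym (*-⟦↧⟧ 0≤p)) (⟦⟧-mono-≤ (ℕᵈ.m/n*n≤m n d))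
    above : p * ⟦ d ⟧ ≤ (⟦ z ⟧ + 1ℚ) * ⟦ d ⟧
    above = subst₂ _≤_ (sym (*-⟦↧⟧ 0≤p))
      (trans (⟦⟧-* (z ℕ.+ 1) d) (cong (_* ⟦ d ⟧) (trans (⟦⟧-+ z 1) (cong (⟦ z ⟧ +_) ⟦1⟧))))
      (⟦⟧-mono-≤ (ℕₚ.<⇒≤ (subst (ℕ._< (z ℕ.+ 1) ℕ.* d) (sym (ℕᵈ.m≡m%n+[m/n]*n n d))
        (subst (n ℕᵈ.% d ℕ.+ z ℕ.* d ℕ.<_) (expand z d) (ℕₚ.+-monoˡ-< (z ℕ.* d) (ℕᵈ.m%n<n n d))))))
      where
      expand : ∀ z d → d ℕ.+ z ℕ.* d ≡ (z ℕ.+ 1) ℕ.* d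
      expand = solve-∀

  -- The floor of a real number is not computable, so the bins overlap: z is only
  -- required to be within 1 of L x.
  Bin : ℕ → ℝ → ℕ → Set
  Bin L x z = Eventually λ n → ⟦ z ⟧ ≤ ⟦ L ⟧ * seq x n + 1ℚ × ⟦ L ⟧ * seq x n ≤ ⟦ z ⟧ + 1ℚ

  ⟦⟧-recip : ∀ {n} → 1 ℕ.≤ n → ⟦ n ⟧ * recip ⟦ n ⟧ ≡ 1ℚ
  ⟦⟧-recip {n} 1≤n = trans (ℚₚ.*-comm ⟦ n ⟧ (recip ⟦ n ⟧)) (recip-inverse (0<⟦⟧ 1≤n))

  0<recip⟦⟧ : ∀ {n} → 1 ℕ.≤ n → 0ℚ < recip ⟦ n ⟧
  0<recip⟦⟧ 1≤n = recip-positive (0<⟦⟧ 1≤n)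

  *-mono-+recip : ∀ {L p q} → 1 ℕ.≤ L → p ≤ q + recip ⟦ L ⟧ → ⟦ L ⟧ * p ≤ ⟦ L ⟧ * q + 1ℚ
  *-mono-+recip {L} {p} {q} 1≤L p≤ = subst (⟦ L ⟧ * p ≤_)
    (trans (ℚₚ.*-distribˡ-+ ⟦ L ⟧ q (recip ⟦ L ⟧)) (cong (⟦ L ⟧ * q +_) (⟦⟧-recip 1≤L)))
    (*-monoˡ-≤ ⟦ L ⟧ (0≤⟦⟧ L) p≤)

  -- One rational term `seq x m`, within `1 / (2 L)` of all later ones, is scaled, shifted by ½ and
  -- rounded down. The shift centres the rounding so that the approximation error ½ fits into the
  -- tolerance 1 on both sides, and it keeps the argument nonnegative, since `0 ≤ x` only yields
  -- `seq x m ≥ -1 / (2 L)`.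
  binning : ∀ {L} → 1 ℕ.≤ L → ∀ x → 0ℝ R.≤ x → ∃[ z ] Bin L x z
  binning {L} 1≤L x 0≤x =
    let M , close = cauchy x u 0<u
        M′ , 0≤x+u = eventually-≤ 0≤x u 0<u
        m = M ℕ.⊔ M′
        0≤y : 0ℚ ≤ ⟦ L ⟧ * seq x m + ℚ.½
        0≤y = subst₂ _≤_ (ℚₚ.*-zeroʳ ⟦ L ⟧) (scale (seq x m))
                (*-monoˡ-≤ ⟦ L ⟧ (0≤⟦⟧ L) (0≤x+u m (ℕₚ.m≤n⊔m M M′)))
        z , z≤y , y≤z+1 = floor 0≤y
    in z , m , λ n m≤n →
      let M≤n = ℕₚ.m⊔n≤o⇒m≤o M M′ m≤n
          M≤m = ℕₚ.m≤m⊔n M M′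
      in (begin
           ⟦ z ⟧                               ≤⟨ z≤y ⟩
           ⟦ L ⟧ * seq x m + ℚ.½               ≤⟨ ℚₚ.+-monoˡ-≤ ℚ.½ (step (close m n M≤m M≤n)) ⟩
           ⟦ L ⟧ * seq x n + ℚ.½ + ℚ.½         ≡⟨ ℚₚ.+-assoc (⟦ L ⟧ * seq x n) ℚ.½ ℚ.½ ⟩
           ⟦ L ⟧ * seq x n + 1ℚ                ∎) ,
         ℚₚ.≤-trans (step (close n m M≤n M≤m)) y≤z+1
    where
    u = recip ⟦ L ⟧ * ℚ.½
    0<u : 0ℚ < u
    0<u = 0<p*q (0<recip⟦⟧ 1≤L) 0<½
    scale : ∀ p → ⟦ L ⟧ * (p + u) ≡ ⟦ L ⟧ * p + ℚ.½
    scale p = trans (solve 4 (λ L p r h → L :* (p :+ r :* h) := L :* p :+ (L :* r) :* h) refl ⟦ L ⟧ p (recip ⟦ L ⟧) ℚ.½)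
      (cong (⟦ L ⟧ * p +_) (trans (cong (_* ℚ.½) (⟦⟧-recip 1≤L)) (ℚₚ.*-identityˡ ℚ.½)))
    step : ∀ {p q} → ℚ.∣ p ℚ.- q ∣ ≤ u → ⟦ L ⟧ * p ≤ ⟦ L ⟧ * q + ℚ.½
    step {p} {q} h = subst (⟦ L ⟧ * p ≤_) (scale q) (*-monoˡ-≤ ⟦ L ⟧ (0≤⟦⟧ L) (close⇒≤ {p} {q} h))

  ⟦⟧+1 : ∀ n → ⟦ n ⟧ + 1ℚ ≡ ⟦ n ℕ.+ 1 ⟧
  ⟦⟧+1 n = sym (trans (⟦⟧-+ n 1) (cong (⟦ n ⟧ +_) ⟦1⟧))

  -- The 3 is one unit of tolerance for each bin and one for the comparison of terms, taken with
  -- slack `1 / L`.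
  bin-mono : ∀ {L x y z w} → 1 ℕ.≤ L → Bin L x z → Bin L y w → x R.≤ y → z ℕ.≤ w ℕ.+ 3
  bin-mono {L} {x} {y} {z} {w} 1≤L x∈z y∈w x≤y =
    let n , (z≤ , _) , (_ , ≤w) , xₙ≤yₙ+u = sometime (x∈z ∧ y∈w ∧ eventually-≤ x≤y (recip ⟦ L ⟧) (0<recip⟦⟧ 1≤L))
    in ⟦⟧-cancel-≤ (begin
      ⟦ z ⟧                             ≤⟨ z≤ ⟩
      ⟦ L ⟧ * seq x n + 1ℚ              ≤⟨ ℚₚ.+-monoˡ-≤ 1ℚ (*-mono-+recip {L} {seq x n} {seq y n} 1≤L xₙ≤yₙ+u) ⟩
      ⟦ L ⟧ * seq y n + 1ℚ + 1ℚ         ≤⟨ ℚₚ.+-monoˡ-≤ 1ℚ (ℚₚ.+-monoˡ-≤ 1ℚ ≤w) ⟩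
      ⟦ w ⟧ + 1ℚ + 1ℚ + 1ℚ              ≡⟨ cong (λ t → t + 1ℚ + 1ℚ) (⟦⟧+1 w) ⟩
      ⟦ w ℕ.+ 1 ⟧ + 1ℚ + 1ℚ             ≡⟨ cong (_+ 1ℚ) (⟦⟧+1 (w ℕ.+ 1)) ⟩
      ⟦ w ℕ.+ 1 ℕ.+ 1 ⟧ + 1ℚ            ≡⟨ ⟦⟧+1 (w ℕ.+ 1 ℕ.+ 1) ⟩
      ⟦ w ℕ.+ 1 ℕ.+ 1 ℕ.+ 1 ⟧           ≡⟨ cong ⟦_⟧ (collect w) ⟩
      ⟦ w ℕ.+ 3 ⟧                       ∎)
    where
    collect : ∀ w → w ℕ.+ 1 ℕ.+ 1 ℕ.+ 1 ≡ w ℕ.+ 3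
    collect = solve-∀

  bin-≤ : ∀ {L x z} → 1 ℕ.≤ L → Bin L x z → x R.≤ 1ℝ → z ℕ.≤ L ℕ.+ 2
  bin-≤ {L} {x} {z} 1≤L x∈z x≤1 =
    let n , (z≤ , _) , xₙ≤1+u = sometime (x∈z ∧ eventually-≤ x≤1 (recip ⟦ L ⟧) (0<recip⟦⟧ 1≤L))
    in ⟦⟧-cancel-≤ (begin
      ⟦ z ⟧                             ≤⟨ z≤ ⟩
      ⟦ L ⟧ * seq x n + 1ℚ              ≤⟨ ℚₚ.+-monoˡ-≤ 1ℚ (*-mono-+recip {L} {seq x n} {1ℚ} 1≤L xₙ≤1+u) ⟩
      ⟦ L ⟧ * 1ℚ + 1ℚ + 1ℚ              ≡⟨ cong (λ t → t + 1ℚ + 1ℚ) (ℚₚ.*-identityʳ ⟦ L ⟧) ⟩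
      ⟦ L ⟧ + 1ℚ + 1ℚ                   ≡⟨ cong (_+ 1ℚ) (⟦⟧+1 L) ⟩
      ⟦ L ℕ.+ 1 ⟧ + 1ℚ                  ≡⟨ ⟦⟧+1 (L ℕ.+ 1) ⟩
      ⟦ L ℕ.+ 1 ℕ.+ 1 ⟧                 ≡⟨ cong ⟦_⟧ (ℕₚ.+-assoc L 1 1) ⟩
      ⟦ L ℕ.+ 2 ⟧                       ∎)

  -- The two tolerances use up 2 of the 3 bins; the remaining one is the positive gap `1 / L` that a
  -- strict inequality has to exhibit.
  bin-< : ∀ {L x y z w} → 1 ℕ.≤ L → Bin L x z → Bin L y w → z ℕ.+ 3 ℕ.≤ w → x R.< y
  bin-< {L} {x} {y} {z} {w} 1≤L x∈z y∈w z+3≤w = <-intro (recip ⟦ L ⟧) (0<recip⟦⟧ 1≤L)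
    (eventually-map (λ n ((_ , ≤z) , (w≤ , _)) → gap n ≤z w≤) (x∈z ∧ y∈w))
    where
    gap : ∀ n → ⟦ L ⟧ * seq x n ≤ ⟦ z ⟧ + 1ℚ → ⟦ w ⟧ ≤ ⟦ L ⟧ * seq y n + 1ℚ →
      seq x n + recip ⟦ L ⟧ ≤ seq y n
    gap n ≤z w≤ = ℚₚ.*-cancelˡ-≤-pos ⟦ L ⟧ {{ℚ.positive (0<⟦⟧ 1≤L)}} (begin
      ⟦ L ⟧ * (seq x n + recip ⟦ L ⟧)   ≡⟨ trans (ℚₚ.*-distribˡ-+ ⟦ L ⟧ (seq x n) _) (cong (⟦ L ⟧ * seq x n +_) (⟦⟧-recip 1≤L)) ⟩
      ⟦ L ⟧ * seq x n + 1ℚ              ≤⟨ ℚₚ.+-monoˡ-≤ 1ℚ ≤z ⟩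
      ⟦ z ⟧ + 1ℚ + 1ℚ                   ≡⟨ add-sub ⟦ z ⟧ ⟩
      ⟦ z ⟧ + 1ℚ + 1ℚ + 1ℚ ℚ.- 1ℚ       ≡⟨ cong (ℚ._- 1ℚ) (trans (cong (λ t → t + 1ℚ + 1ℚ) (⟦⟧+1 z))
                                             (trans (cong (_+ 1ℚ) (⟦⟧+1 (z ℕ.+ 1))) (⟦⟧+1 (z ℕ.+ 1 ℕ.+ 1)))) ⟩
      ⟦ z ℕ.+ 1 ℕ.+ 1 ℕ.+ 1 ⟧ ℚ.- 1ℚ    ≤⟨ ℚₚ.+-monoˡ-≤ (ℚ.- 1ℚ) (⟦⟧-mono-≤ (subst (ℕ._≤ w) (sym (collect z)) z+3≤w)) ⟩
      ⟦ w ⟧ ℚ.- 1ℚ                      ≤⟨ ℚₚ.+-monoˡ-≤ (ℚ.- 1ℚ) w≤ ⟩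
      ⟦ L ⟧ * seq y n + 1ℚ ℚ.- 1ℚ       ≡⟨ sub-add (⟦ L ⟧ * seq y n) ⟩
      ⟦ L ⟧ * seq y n                   ∎)
      where
      collect : ∀ w → w ℕ.+ 1 ℕ.+ 1 ℕ.+ 1 ≡ w ℕ.+ 3
      collect = solve-∀
      add-sub : ∀ z → z + 1ℚ + 1ℚ ≡ z + 1ℚ + 1ℚ + 1ℚ ℚ.- 1ℚ
      add-sub = solve 1 (λ z → z :+ con 1ℚ :+ con 1ℚ := z :+ con 1ℚ :+ con 1ℚ :+ con 1ℚ :- con 1ℚ) refl
      sub-add : ∀ z → z + 1ℚ ℚ.- 1ℚ ≡ z
      sub-add = solve 1 (λ z → z :+ con 1ℚ :- con 1ℚ := z) refl

  <⇒≤ : ∀ {x y} → x R.< y → x R.≤ y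
  <⇒≤ {x} {y} (<-intro c 0<c (N , h)) = ≤-intro λ ε 0<ε → N , λ n N≤n → begin
    seq x n            ≤⟨ p≤p+q (seq x n) (ℚₚ.<⇒≤ 0<c) ⟩
    seq x n + c        ≤⟨ h n N≤n ⟩
    seq y n            ≤⟨ p≤p+q (seq y n) (ℚₚ.<⇒≤ 0<ε) ⟩
    seq y n + ε        ∎

  bins-close : ∀ {L x y z w h} → Bin L x z → Bin L y w → ℕ.∣ z - w ∣ ℕ.≤ h →
    Eventually λ n → ⟦ L ⟧ * seq x n ≤ ⟦ L ⟧ * seq y n + ⟦ h ℕ.+ 2 ⟧
  bins-close {L} {x} {y} {z} {w} {h} x∈z y∈w ∣z-w∣≤h = eventually-map (λ n ((_ , ≤z) , (w≤ , _)) → begin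
      ⟦ L ⟧ * seq x n                   ≤⟨ ≤z ⟩
      ⟦ z ⟧ + 1ℚ                        ≤⟨ ℚₚ.+-monoˡ-≤ 1ℚ (⟦⟧-mono-≤ z≤w+h) ⟩
      ⟦ w ℕ.+ h ⟧ + 1ℚ                  ≡⟨ cong (_+ 1ℚ) (⟦⟧-+ w h) ⟩
      ⟦ w ⟧ + ⟦ h ⟧ + 1ℚ                ≡⟨ ℚₚ.+-assoc ⟦ w ⟧ ⟦ h ⟧ 1ℚ ⟩
      ⟦ w ⟧ + (⟦ h ⟧ + 1ℚ)              ≤⟨ ℚₚ.+-monoˡ-≤ (⟦ h ⟧ + 1ℚ) w≤ ⟩
      ⟦ L ⟧ * seq y n + 1ℚ + (⟦ h ⟧ + 1ℚ) ≡⟨ regroup (⟦ L ⟧ * seq y n) ⟦ h ⟧ ⟩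
      ⟦ L ⟧ * seq y n + (⟦ h ⟧ + 1ℚ + 1ℚ) ≡⟨ cong (⟦ L ⟧ * seq y n +_) (trans (cong (_+ 1ℚ) (⟦⟧+1 h))
                                               (trans (⟦⟧+1 (h ℕ.+ 1)) (cong ⟦_⟧ (ℕₚ.+-assoc h 1 1)))) ⟩
      ⟦ L ⟧ * seq y n + ⟦ h ℕ.+ 2 ⟧     ∎) (x∈z ∧ y∈w)
    where
    z≤w+h : z ℕ.≤ w ℕ.+ h
    z≤w+h = ℕₚ.≤-trans (ℕₚ.m≤n+∣m-n∣ z w) (ℕₚ.+-monoʳ-≤ w ∣z-w∣≤h)
    regroup : ∀ a h → a + 1ℚ + (h + 1ℚ) ≡ a + (h + 1ℚ + 1ℚ)
    regroup = solve 2 (λ a h → a :+ con 1ℚ :+ (h :+ con 1ℚ) := a :+ (h :+ con 1ℚ :+ con 1ℚ)) refl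

  -- Bins at distance `h` leave the points within `(h + 2) / L`. As `L` is at least `H D`, this is
  -- at most `s / D` with `s = (h + 2) / H`, which does not depend on `N`, as the hypothesis on
  -- pairs requires of `s`.
  bins-close⇒≤ : ∀ {L H h x y z w} (D : R.ℝ⁺) → 1 ℕ.≤ L → 1 ℕ.≤ H →
    Eventually (λ n → 1ℚ ≤ seq (R.value D) n × ⟦ H ⟧ * seq (R.value D) n ≤ ⟦ L ⟧) →
    Bin L x z → Bin L y w → ℕ.∣ z - w ∣ ℕ.≤ h →
    R.∣ x R.- y ∣ R.≤ fromℚ (⟦ h ℕ.+ 2 ⟧ * recip ⟦ H ⟧) R./ D
  bins-close⇒≤ {L} {H} {h} {x} {y} {z} {w} D 1≤L 1≤H HD≤L x∈z y∈w ∣z-w∣≤h = ≤-intro λ ε 0<ε →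
    eventually-map (λ n ((1≤D , HD≤L) , x≤y , y≤x) → ℚₚ.≤-trans
        (≤⇒close {seq x n} {seq y n} (unscale n 1≤D HD≤L x≤y) (unscale n 1≤D HD≤L y≤x))
        (p≤p+q (σ * recip (seq (R.value D) n)) (ℚₚ.<⇒≤ 0<ε)))
      (HD≤L ∧ bins-close {L} {x} {y} {h = h} x∈z y∈w ∣z-w∣≤h
        ∧ bins-close {L} {y} {x} {h = h} y∈w x∈z (subst (ℕ._≤ h) (ℕₚ.∣-∣-comm z w) ∣z-w∣≤h))
    where
    η = recip ⟦ H ⟧
    σ = ⟦ h ℕ.+ 2 ⟧ * η
    unscale : ∀ n {p q} → 1ℚ ≤ seq (R.value D) n → ⟦ H ⟧ * seq (R.value D) n ≤ ⟦ L ⟧ →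
      ⟦ L ⟧ * p ≤ ⟦ L ⟧ * q + ⟦ h ℕ.+ 2 ⟧ → p ≤ q + σ * recip (seq (R.value D) n)
    unscale n {p} {q} 1≤D HD≤L h≤ = ℚₚ.*-cancelˡ-≤-pos ⟦ L ⟧ {{ℚ.positive (0<⟦⟧ 1≤L)}} (begin
      ⟦ L ⟧ * p                          ≤⟨ h≤ ⟩
      ⟦ L ⟧ * q + ⟦ h ℕ.+ 2 ⟧            ≡⟨ cong (⟦ L ⟧ * q +_) cancel ⟨
      ⟦ L ⟧ * q + σ * r * (⟦ H ⟧ * d)    ≤⟨ ℚₚ.+-monoʳ-≤ (⟦ L ⟧ * q) (*-monoˡ-≤ (σ * r) 0≤σr HD≤L) ⟩
      ⟦ L ⟧ * q + σ * r * ⟦ L ⟧          ≡⟨ cong (⟦ L ⟧ * q +_) (ℚₚ.*-comm (σ * r) ⟦ L ⟧) ⟩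
      ⟦ L ⟧ * q + ⟦ L ⟧ * (σ * r)        ≡⟨ ℚₚ.*-distribˡ-+ ⟦ L ⟧ q (σ * r) ⟨
      ⟦ L ⟧ * (q + σ * r)                ∎)
      where
      d = seq (R.value D) n
      r = recip d
      0<d : 0ℚ < d
      0<d = ℚₚ.<-≤-trans (ℚₚ.positive⁻¹ 1ℚ) 1≤D
      0≤σr : 0ℚ ≤ σ * r
      0≤σr = ℚₚ.<⇒≤ (0<p*q (0<p*q (0<⟦⟧ {h ℕ.+ 2} (ℕₚ.≤-trans (s≤s z≤n) (ℕₚ.m≤n+m 2 h))) (0<recip⟦⟧ 1≤H)) (recip-positive 0<d))
      cancel : σ * r * (⟦ H ⟧ * d) ≡ ⟦ h ℕ.+ 2 ⟧
      cancel = trans (solve 5 (λ s e r H d → s :* e :* r :* (H :* d) := s :* ((H :* e) :* (r :* d))) refl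
          ⟦ h ℕ.+ 2 ⟧ η r ⟦ H ⟧ d)
        (trans (cong (⟦ h ℕ.+ 2 ⟧ *_) (cong₂ _*_ (⟦⟧-recip 1≤H) (recip-inverse 0<d)))
          (ℚₚ.*-identityʳ ⟦ h ℕ.+ 2 ⟧))

  ≤-trans : ∀ {x y z} → x R.≤ y → y R.≤ z → x R.≤ z
  ≤-trans {x} {y} {z} x≤y y≤z = ≤-intro λ ε 0<ε → eventually-map
    (λ n (xₙ≤ , yₙ≤) → begin
      seq x n                               ≤⟨ xₙ≤ ⟩
      seq y n + ε * ℚ.½                     ≤⟨ ℚₚ.+-monoˡ-≤ (ε * ℚ.½) yₙ≤ ⟩
      seq z n + ε * ℚ.½ + ε * ℚ.½           ≡⟨ trans (ℚₚ.+-assoc (seq z n) (ε * ℚ.½) (ε * ℚ.½)) (cong (seq z n +_) (½+½ ε)) ⟩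
      seq z n + ε                           ∎)
    (eventually-≤ x≤y (ε * ℚ.½) (0<p*q 0<ε 0<½) ∧ eventually-≤ y≤z (ε * ℚ.½) (0<p*q 0<ε 0<½))

-- Size of the powers, the pair count, and passage from counts to frequencies.

module Estimates where

  open R using (seq; Eventually; recip; powApprox; powSeq; 0ℝ; 1ℝ; 2ℝ; <-intro)
  open R.RationalLemmas
  open Powers
  open Binning
  open import Data.Rational using (_+_; _*_; _≤_; _<_; _⊔_)
  open +-*-Solver using (solve; _:+_; _:*_; _:-_; _:=_; con)
  open ℚₚ.≤-Reasoning

  clipped-powers : ∀ N .{{_ : NonZero N}} A E E′ .{{_ : NonZero E}} .{{_ : NonZero E′}} {a b c c′} n →
    0ℚ < c → 0ℚ < c′ → c ≤ a → 1ℚ + c′ ≤ b → a + b ≡ ⟦ 2 ⟧ →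
    1ℚ ≤ c * ⟦ E ⟧ → 1ℚ ≤ c′ * ⟦ E′ ⟧ → A ℕ.^ E ℕ.≤ N → A ℕ.^ E′ ℕ.≤ N →
    ⟦ A ⟧ ≤ powApprox N (a ⊔ 0ℚ) n × ⟦ N ℕ.* A ⟧ ≤ powApprox N (b ⊔ 0ℚ) n ×
      powApprox N (a ⊔ 0ℚ) n * powApprox N (b ⊔ 0ℚ) n ≤ ⟦ N ℕ.* N ⟧
  clipped-powers N A E E′ {a} {b} {c} {c′} n 0<c 0<c′ c≤a 1+c′≤b a+b≡2 1≤cE 1≤c′E′ A^E≤N A^E′≤N
    = subst₂ (λ a b → ⟦ A ⟧ ≤ powApprox N a n × ⟦ N ℕ.* A ⟧ ≤ powApprox N b n ×
        powApprox N a n * powApprox N b n ≤ ⟦ N ℕ.* N ⟧)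
      (sym (ℚₚ.p≥q⇒p⊔q≡p 0≤a)) (sym (ℚₚ.p≥q⇒p⊔q≡p 0≤b)) (
    subst (λ t → ⟦ t ⟧ ≤ powApprox N a n) (ℕₚ.*-identityˡ A)
      (powApprox-≥ N 0 A E n 0≤a
        (subst (_≤ a) (trans (sym (ℚₚ.+-identityˡ c)) (cong (_+ c) (sym ⟦0⟧))) c≤a) 1≤cE A^E≤N) ,
    subst (λ t → ⟦ t ℕ.* A ⟧ ≤ powApprox N b n) (ℕₚ.*-identityʳ N)
      (powApprox-≥ N 1 A E′ n 0≤b (subst (λ t → t + c′ ≤ b) (sym ⟦1⟧) 1+c′≤b) 1≤c′E′ A^E′≤N) ,
    powApprox-product N n 0≤a 0≤b a+b≡2)
    where
    0≤a : 0ℚ ≤ a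
    0≤a = ℚₚ.≤-trans (ℚₚ.<⇒≤ 0<c) c≤a
    0≤b : 0ℚ ≤ b
    0≤b = ℚₚ.≤-trans (ℚₚ.+-mono-≤ (ℚₚ.<⇒≤ (ℚₚ.positive⁻¹ 1ℚ)) (ℚₚ.<⇒≤ 0<c′)) 1+c′≤b

  -- The gaps witnessing `0 < α` and `α < 1` are the surplus exponents for the two lower bounds. The
  -- second bound carries the use of `α < 1`: `N ^ (2 - α)` exceeds `N` by any prescribed factor.
  growth : ∀ {α} → 0ℝ R.< α → α R.< 1ℝ → ∀ A → ∃[ N₀ ] ∀ N .{{_ : NonZero N}} → N₀ ℕ.≤ N →
    Eventually λ n → ⟦ A ⟧ ≤ powSeq N α n × ⟦ N ℕ.* A ⟧ ≤ powSeq N (2ℝ R.- α) n ×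
      powSeq N α n * powSeq N (2ℝ R.- α) n ≤ ⟦ N ℕ.* N ⟧
  growth {α} (<-intro c 0<c c≤α) (<-intro c′ 0<c′ α+c′≤1) A =
    let e  , 1/e≤c   = archimedean 0<c
        e′ , 1/e′≤c′ = archimedean 0<c′
    in A ℕ.^ suc e ℕ.⊔ A ℕ.^ suc e′ , λ N N₀≤N → eventually-map (λ n (0+c≤a , a+c′≤1) →
      clipped-powers N A (suc e) (suc e′) {seq α n} {seq (2ℝ R.- α) n} {c} {c′} n 0<c 0<c′
        (subst (_≤ seq α n) (ℚₚ.+-identityˡ c) 0+c≤a)
        (1+c′≤2-a (seq α n) a+c′≤1)
        (trans (q+[p-q] (seq 2ℝ n) (seq α n)) (⟦⟧-def 2))
        (1≤⟦suc⟧*⇐ e 1/e≤c) (1≤⟦suc⟧*⇐ e′ 1/e′≤c′)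
        (ℕₚ.m⊔n≤o⇒m≤o (A ℕ.^ suc e) (A ℕ.^ suc e′) N₀≤N)
        (ℕₚ.m⊔n≤o⇒n≤o (A ℕ.^ suc e) (A ℕ.^ suc e′) N₀≤N)) (c≤α ∧ α+c′≤1)
    where
    1+c′≤2-a : ∀ a → a + c′ ≤ 1ℚ → 1ℚ + c′ ≤ seq 2ℝ 0 ℚ.- a
    1+c′≤2-a a h = subst₂ _≤_ (lhs a c′) (sym (ℚₚ.+-assoc 1ℚ 1ℚ (ℚ.- a))) (ℚₚ.+-monoˡ-≤ (1ℚ ℚ.- a) h)
      where
      lhs : ∀ a c → a + c + (1ℚ ℚ.- a) ≡ 1ℚ + c
      lhs = solve 2 (λ a c → a :+ c :+ (con 1ℚ :- a) := con 1ℚ :+ c) refl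

  -- The asymptotics give `k ≤ (2 h + 5) W / H`: 4 of the 5 come from `h + 2`, and 1 from the
  -- tolerance `1 / H`. Rounding in `L` costs a factor `1 + 1 / (5 H)`, since `10 ≤ D` gives
  -- `5 L ≤ (5 H + 1) D`. As `2 h + 5 ≤ 5 H`, that factor adds at most 1, which turns 5 into 6.
  pairs-bound : ∀ {N H L h k D W} → h ℕ.< H → 1ℚ ≤ W → ⟦ 15 ⟧ ≤ D → D * W ≤ ⟦ N ℕ.* N ⟧ →
    ⟦ L ⟧ ≤ ⟦ H ⟧ * D + ⟦ 2 ⟧ →
    ⟦ k ⟧ * recip W ≤ ⟦ 2 ⟧ * (⟦ h ℕ.+ 2 ⟧ * recip ⟦ H ⟧) + recip ⟦ H ⟧ →
    L ℕ.* k ℕ.≤ N ℕ.* N ℕ.* (2 ℕ.* h ℕ.+ 6)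
  pairs-bound {N} {H} {L} {h} {k} {D} {W} h<H 1≤W 15≤D DW≤N² L≤HD+2 k/W≤ =
    ℕₚ.*-cancelˡ-≤ (5 ℕ.* H) {{ℕₚ.m*n≢0 5 H {{_}} {{ℕ.>-nonZero 1≤H}}}} (ℕₚ.≤-trans main
      (subst₂ ℕ._≤_ (expand₁ H h (N ℕ.* N)) (expand₂ H h (N ℕ.* N))
        (ℕₚ.*-monoˡ-≤ (N ℕ.* N) (ℕₚ.+-monoʳ-≤ (5 ℕ.* H ℕ.* (2 ℕ.* h ℕ.+ 5)) 2h+5≤5H))))
    where
    1≤H : 1 ℕ.≤ H
    1≤H = ℕₚ.≤-trans (s≤s z≤n) h<H
    0<W : 0ℚ < W
    0<W = ℚₚ.<-≤-trans (ℚₚ.positive⁻¹ 1ℚ) 1≤W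
    0≤D : 0ℚ ≤ D
    0≤D = ℚₚ.≤-trans (0≤⟦⟧ 15) 15≤D
    η = recip ⟦ H ⟧
    c = 2 ℕ.* h ℕ.+ 5

    k≤ : ⟦ k ⟧ ≤ ⟦ c ⟧ * η * W
    k≤ = begin
      ⟦ k ⟧                            ≡⟨ ℚₚ.*-identityʳ ⟦ k ⟧ ⟨
      ⟦ k ⟧ * 1ℚ                       ≡⟨ cong (⟦ k ⟧ *_) (recip-inverse 0<W) ⟨
      ⟦ k ⟧ * (recip W * W)            ≡⟨ ℚₚ.*-assoc ⟦ k ⟧ (recip W) W ⟨
      ⟦ k ⟧ * recip W * W              ≤⟨ *-monoʳ-≤ W (ℚₚ.<⇒≤ 0<W) k/W≤ ⟩
      (⟦ 2 ⟧ * (⟦ h ℕ.+ 2 ⟧ * η) + η) * W ≡⟨ cong (_* W) (factor ⟦ 2 ⟧ ⟦ h ℕ.+ 2 ⟧ η) ⟩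
      (⟦ 2 ⟧ * ⟦ h ℕ.+ 2 ⟧ + 1ℚ) * η * W  ≡⟨ cong (λ t → t * η * W) c≡ ⟨
      ⟦ c ⟧ * η * W                    ∎
      where
      factor : ∀ a b c → a * (b * c) + c ≡ (a * b + 1ℚ) * c
      factor = solve 3 (λ a b c → a :* (b :* c) :+ c := (a :* b :+ con 1ℚ) :* c) refl
      collect : ∀ h → 2 ℕ.* h ℕ.+ 5 ≡ 2 ℕ.* (h ℕ.+ 2) ℕ.+ 1
      collect = solve-∀
      c≡ : ⟦ c ⟧ ≡ ⟦ 2 ⟧ * ⟦ h ℕ.+ 2 ⟧ + 1ℚ
      c≡ = trans (cong ⟦_⟧ (collect h)) (trans (⟦⟧-eval ([ 2 ] ⊗ [ h ℕ.+ 2 ] ⊕ [ 1 ])) (cong (⟦ 2 ⟧ * ⟦ h ℕ.+ 2 ⟧ +_) ⟦1⟧))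

    kHD≤ : ⟦ k ⟧ * (⟦ H ⟧ * D) ≤ ⟦ c ⟧ * ⟦ N ℕ.* N ⟧
    kHD≤ = begin
      ⟦ k ⟧ * (⟦ H ⟧ * D)              ≤⟨ *-monoʳ-≤ (⟦ H ⟧ * D) (0≤* (0≤⟦⟧ H) 0≤D) k≤ ⟩
      ⟦ c ⟧ * η * W * (⟦ H ⟧ * D)      ≡⟨ regroup ⟦ c ⟧ η W ⟦ H ⟧ D ⟩
      ⟦ c ⟧ * (⟦ H ⟧ * η * (D * W))    ≡⟨ cong (λ t → ⟦ c ⟧ * (t * (D * W))) (⟦⟧-recip 1≤H) ⟩
      ⟦ c ⟧ * (1ℚ * (D * W))           ≡⟨ cong (⟦ c ⟧ *_) (ℚₚ.*-identityˡ (D * W)) ⟩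
      ⟦ c ⟧ * (D * W)                  ≤⟨ *-monoˡ-≤ ⟦ c ⟧ (0≤⟦⟧ c) DW≤N² ⟩
      ⟦ c ⟧ * ⟦ N ℕ.* N ⟧              ∎
      where
      regroup : ∀ c e W H D → c * e * W * (H * D) ≡ c * (H * e * (D * W))
      regroup = solve 5 (λ c e W H D → c :* e :* W :* (H :* D) := c :* (H :* e :* (D :* W))) refl
      0≤* : ∀ {p q} → 0ℚ ≤ p → 0ℚ ≤ q → 0ℚ ≤ p * q
      0≤* {p} {q} 0≤p 0≤q = subst (_≤ p * q) (ℚₚ.*-zeroˡ q) (*-monoʳ-≤ q 0≤q 0≤p)

    5L≤ : ⟦ 5 ⟧ * ⟦ L ⟧ ≤ (⟦ 5 ⟧ * ⟦ H ⟧ + 1ℚ) * D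
    5L≤ = begin
      ⟦ 5 ⟧ * ⟦ L ⟧                    ≤⟨ *-monoˡ-≤ ⟦ 5 ⟧ (0≤⟦⟧ 5) L≤HD+2 ⟩
      ⟦ 5 ⟧ * (⟦ H ⟧ * D + ⟦ 2 ⟧)      ≡⟨ expand ⟦ 5 ⟧ ⟦ H ⟧ D ⟦ 2 ⟧ ⟩
      ⟦ 5 ⟧ * ⟦ H ⟧ * D + ⟦ 5 ⟧ * ⟦ 2 ⟧ ≡⟨ cong (⟦ 5 ⟧ * ⟦ H ⟧ * D +_) (⟦⟧-* 5 2) ⟨
      ⟦ 5 ⟧ * ⟦ H ⟧ * D + ⟦ 10 ⟧       ≤⟨ ℚₚ.+-monoʳ-≤ (⟦ 5 ⟧ * ⟦ H ⟧ * D)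
                                            (ℚₚ.≤-trans (⟦⟧-mono-≤ (ℕₚ.m≤m+n 10 5)) 15≤D) ⟩
      ⟦ 5 ⟧ * ⟦ H ⟧ * D + D            ≡⟨ collect (⟦ 5 ⟧ * ⟦ H ⟧) D ⟩
      (⟦ 5 ⟧ * ⟦ H ⟧ + 1ℚ) * D         ∎
      where
      expand : ∀ a H D b → a * (H * D + b) ≡ a * H * D + a * b
      expand = solve 4 (λ a H D b → a :* (H :* D :+ b) := a :* H :* D :+ a :* b) refl
      collect : ∀ a D → a * D + D ≡ (a + 1ℚ) * D
      collect = solve 2 (λ a D → a :* D :+ D := (a :+ con 1ℚ) :* D) refl

    main : 5 ℕ.* H ℕ.* (L ℕ.* k) ℕ.≤ (5 ℕ.* H ℕ.+ 1) ℕ.* (c ℕ.* (N ℕ.* N))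
    main = lower-≤ ([ 5 ] ⊗ [ H ] ⊗ ([ L ] ⊗ [ k ])) (([ 5 ] ⊗ [ H ] ⊕ [ 1 ]) ⊗ ([ c ] ⊗ [ N ℕ.* N ])) (begin
      ⟦ 5 ⟧ * ⟦ H ⟧ * (⟦ L ⟧ * ⟦ k ⟧)              ≡⟨ regroup₁ ⟦ 5 ⟧ ⟦ H ⟧ ⟦ L ⟧ ⟦ k ⟧ ⟩
      ⟦ H ⟧ * ⟦ k ⟧ * (⟦ 5 ⟧ * ⟦ L ⟧)              ≤⟨ *-monoˡ-≤ (⟦ H ⟧ * ⟦ k ⟧) 0≤Hk 5L≤ ⟩
      ⟦ H ⟧ * ⟦ k ⟧ * ((⟦ 5 ⟧ * ⟦ H ⟧ + 1ℚ) * D)   ≡⟨ regroup₂ ⟦ H ⟧ ⟦ k ⟧ (⟦ 5 ⟧ * ⟦ H ⟧ + 1ℚ) D ⟩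
      (⟦ 5 ⟧ * ⟦ H ⟧ + 1ℚ) * (⟦ k ⟧ * (⟦ H ⟧ * D)) ≡⟨ cong (λ t → (⟦ 5 ⟧ * ⟦ H ⟧ + t) * (⟦ k ⟧ * (⟦ H ⟧ * D))) ⟦1⟧ ⟨
      (⟦ 5 ⟧ * ⟦ H ⟧ + ⟦ 1 ⟧) * (⟦ k ⟧ * (⟦ H ⟧ * D)) ≤⟨ *-monoˡ-≤ (⟦ 5 ⟧ * ⟦ H ⟧ + ⟦ 1 ⟧) 0≤5H+1 kHD≤ ⟩
      (⟦ 5 ⟧ * ⟦ H ⟧ + ⟦ 1 ⟧) * (⟦ c ⟧ * ⟦ N ℕ.* N ⟧) ∎)
      where
      regroup₁ : ∀ a H L k → a * H * (L * k) ≡ H * k * (a * L)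
      regroup₁ = solve 4 (λ a H L k → a :* H :* (L :* k) := H :* k :* (a :* L)) refl
      regroup₂ : ∀ H k t D → H * k * (t * D) ≡ t * (k * (H * D))
      regroup₂ = solve 4 (λ H k t D → H :* k :* (t :* D) := t :* (k :* (H :* D))) refl
      0≤Hk : 0ℚ ≤ ⟦ H ⟧ * ⟦ k ⟧
      0≤Hk = subst (0ℚ ≤_) (⟦⟧-* H k) (0≤⟦⟧ (H ℕ.* k))
      0≤5H+1 : 0ℚ ≤ ⟦ 5 ⟧ * ⟦ H ⟧ + ⟦ 1 ⟧
      0≤5H+1 = subst (0ℚ ≤_) (⟦⟧-eval ([ 5 ] ⊗ [ H ] ⊕ [ 1 ])) (0≤⟦⟧ (5 ℕ.* H ℕ.+ 1))

    2h+5≤5H : c ℕ.≤ 5 ℕ.* H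
    2h+5≤5H = ℕₚ.≤-trans (ℕₚ.≤-reflexive (split h)) (ℕₚ.≤-trans (ℕₚ.+-mono-≤ (ℕₚ.*-monoʳ-≤ 2 h<H) (ℕₚ.*-monoʳ-≤ 3 1≤H))
      (ℕₚ.≤-reflexive (sym (ℕₚ.*-distribʳ-+ H 2 3))))
      where
      split : ∀ h → 2 ℕ.* h ℕ.+ 5 ≡ 2 ℕ.* (1 ℕ.+ h) ℕ.+ 3
      split = solve-∀
    expand₁ : ∀ H h M → (5 ℕ.* H ℕ.* (2 ℕ.* h ℕ.+ 5) ℕ.+ (2 ℕ.* h ℕ.+ 5)) ℕ.* M
      ≡ (5 ℕ.* H ℕ.+ 1) ℕ.* ((2 ℕ.* h ℕ.+ 5) ℕ.* M)
    expand₁ = solve-∀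
    expand₂ : ∀ H h M → (5 ℕ.* H ℕ.* (2 ℕ.* h ℕ.+ 5) ℕ.+ 5 ℕ.* H) ℕ.* M
      ≡ 5 ℕ.* H ℕ.* (M ℕ.* (2 ℕ.* h ℕ.+ 6))
    expand₂ = solve-∀

  module _ {N e H L A a b : ℕ} {p q : ℚ} (1≤N : 1 ℕ.≤ N) (1≤e : 1 ℕ.≤ e) (1≤L : 1 ℕ.≤ L)
    (2e[H+8]≤L : 2 ℕ.* e ℕ.* (H ℕ.+ 8) ℕ.≤ L) where

    private
      η = recip ⟦ e ⟧
      scale = ⟦ 2 ⟧ * ⟦ e ⟧ * ⟦ L ⟧ * ⟦ N ⟧

      0<scale : 0ℚ < scale
      0<scale = subst (0ℚ <_) (⟦⟧-eval ([ 2 ] ⊗ [ e ] ⊗ [ L ] ⊗ [ N ]))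
        (0<⟦⟧ (ℕₚ.*-mono-≤ (ℕₚ.*-mono-≤ (ℕₚ.*-mono-≤ {1} {2} (s≤s z≤n) 1≤e) 1≤L) 1≤N))

      0≤2eN : 0ℚ ≤ ⟦ 2 ⟧ * ⟦ e ⟧ * ⟦ N ⟧
      0≤2eN = subst (0ℚ ≤_) (⟦⟧-eval ([ 2 ] ⊗ [ e ] ⊗ [ N ])) (0≤⟦⟧ (2 ℕ.* e ℕ.* N))

      remainder : ⟦ 2 ⟧ * ⟦ e ⟧ * (⟦ H ⟧ + ⟦ 8 ⟧) * ⟦ N ⟧ ≤ ⟦ L ⟧ * ⟦ N ⟧
      remainder = *-monoʳ-≤ ⟦ N ⟧ (0≤⟦⟧ N) (lift-≤ ([ 2 ] ⊗ [ e ] ⊗ ([ H ] ⊕ [ 8 ])) [ L ] 2e[H+8]≤L)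

      average : ⟦ A ⟧ * recip ⟦ N ⟧ * scale ≡ ⟦ 2 ⟧ * ⟦ e ⟧ * ⟦ L ⟧ * ⟦ A ⟧
      average = trans (regroup ⟦ A ⟧ (recip ⟦ N ⟧) (⟦ 2 ⟧ * ⟦ e ⟧ * ⟦ L ⟧) ⟦ N ⟧)
        (trans (cong (⟦ 2 ⟧ * ⟦ e ⟧ * ⟦ L ⟧ * ⟦ A ⟧ *_) (⟦⟧-recip 1≤N)) (ℚₚ.*-identityʳ _))
        where
        regroup : ∀ A r t N → A * r * (t * N) ≡ t * A * (N * r)
        regroup = solve 4 (λ A r t N → A :* r :* (t :* N) := t :* A :* (N :* r)) refl

      error : ⟦ 2 ⟧ * η * scale ≡ ⟦ 4 ⟧ * (⟦ L ⟧ * ⟦ N ⟧)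
      error = trans (regroup ⟦ 2 ⟧ η ⟦ e ⟧ ⟦ L ⟧ ⟦ N ⟧)
        (trans (cong (⟦ 2 ⟧ * ⟦ 2 ⟧ * (⟦ L ⟧ * ⟦ N ⟧) *_) (⟦⟧-recip 1≤e)) (trans (ℚₚ.*-identityʳ _)
          (cong (_* (⟦ L ⟧ * ⟦ N ⟧)) (sym (⟦⟧-* 2 2)))))
        where
        regroup : ∀ t r e L N → t * r * (t * e * L * N) ≡ t * t * (L * N) * (e * r)
        regroup = solve 5 (λ t r e L N → t :* r :* (t :* e :* L :* N) := t :* t :* (L :* N) :* (e :* r)) refl

      3+1 : ⟦ 3 ⟧ * (⟦ L ⟧ * ⟦ N ⟧) + ⟦ L ⟧ * ⟦ N ⟧ ≡ ⟦ 4 ⟧ * (⟦ L ⟧ * ⟦ N ⟧)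
      3+1 = trans (collect ⟦ 3 ⟧ (⟦ L ⟧ * ⟦ N ⟧)) (cong (_* (⟦ L ⟧ * ⟦ N ⟧)) (⟦⟧+1 3))
        where
        collect : ∀ a t → a * t + t ≡ (a + 1ℚ) * t
        collect = solve 2 (λ a t → a :* t :+ t := (a :+ con 1ℚ) :* t) refl

      ⟦8⟧ : 1ℚ + (1ℚ + ⟦ 6 ⟧) ≡ ⟦ 8 ⟧
      ⟦8⟧ = trans (cong (λ t → t + (t + ⟦ 6 ⟧)) (sym ⟦1⟧)) (sym (⟦⟧-eval ([ 1 ] ⊕ ([ 1 ] ⊕ [ 6 ]))))

    -- After division by `scale` the error is `3 / (2 e)` plus `(H + 8) / L`, where 8 is 6 plus one
    -- unit for rounding each endpoint. The assumption on `L` bounds the latter by `1 / (2 e)`, for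
    -- a total of `2 / e`. The same account holds for `average-≥`.
    average-≤ : 2 ℕ.* e ℕ.* L ℕ.* A ℕ.+ 2 ℕ.* e ℕ.* a ℕ.* N ℕ.≤ 3 ℕ.* L ℕ.* N ℕ.+ 2 ℕ.* e ℕ.* (b ℕ.+ H ℕ.+ 6) ℕ.* N →
      ⟦ L ⟧ * p ≤ ⟦ a ⟧ + 1ℚ → ⟦ b ⟧ ≤ ⟦ L ⟧ * q + 1ℚ →
      ⟦ A ⟧ * recip ⟦ N ⟧ ≤ (q ℚ.- p) + ⟦ 2 ⟧ * η
    average-≤ upper Lp≤a+1 b≤Lq+1 = *-cancelʳ-≤ scale 0<scale (begin
      ⟦ A ⟧ * recip ⟦ N ⟧ * scale
        ≡⟨ average ⟩
      ⟦ 2 ⟧ * ⟦ e ⟧ * ⟦ L ⟧ * ⟦ A ⟧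
        ≡⟨ [q+ε]-q (⟦ 2 ⟧ * ⟦ e ⟧ * ⟦ a ⟧ * ⟦ N ⟧) (⟦ 2 ⟧ * ⟦ e ⟧ * ⟦ L ⟧ * ⟦ A ⟧) ⟨
      ⟦ 2 ⟧ * ⟦ e ⟧ * ⟦ a ⟧ * ⟦ N ⟧ + ⟦ 2 ⟧ * ⟦ e ⟧ * ⟦ L ⟧ * ⟦ A ⟧ ℚ.- ⟦ 2 ⟧ * ⟦ e ⟧ * ⟦ a ⟧ * ⟦ N ⟧
        ≤⟨ ℚₚ.+-monoˡ-≤ (ℚ.- (⟦ 2 ⟧ * ⟦ e ⟧ * ⟦ a ⟧ * ⟦ N ⟧))
             (subst (_≤ ⟦ 3 ⟧ * ⟦ L ⟧ * ⟦ N ⟧ + ⟦ 2 ⟧ * ⟦ e ⟧ * (⟦ b ⟧ + ⟦ H ⟧ + ⟦ 6 ⟧) * ⟦ N ⟧)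
               (ℚₚ.+-comm (⟦ 2 ⟧ * ⟦ e ⟧ * ⟦ L ⟧ * ⟦ A ⟧) (⟦ 2 ⟧ * ⟦ e ⟧ * ⟦ a ⟧ * ⟦ N ⟧))
               (lift-≤ ([ 2 ] ⊗ [ e ] ⊗ [ L ] ⊗ [ A ] ⊕ [ 2 ] ⊗ [ e ] ⊗ [ a ] ⊗ [ N ])
                 ([ 3 ] ⊗ [ L ] ⊗ [ N ] ⊕ [ 2 ] ⊗ [ e ] ⊗ ([ b ] ⊕ [ H ] ⊕ [ 6 ]) ⊗ [ N ]) upper)) ⟩
      ⟦ 3 ⟧ * ⟦ L ⟧ * ⟦ N ⟧ + ⟦ 2 ⟧ * ⟦ e ⟧ * (⟦ b ⟧ + ⟦ H ⟧ + ⟦ 6 ⟧) * ⟦ N ⟧ ℚ.- ⟦ 2 ⟧ * ⟦ e ⟧ * ⟦ a ⟧ * ⟦ N ⟧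
        ≡⟨ regroup₁ ⟦ 3 ⟧ ⟦ L ⟧ ⟦ N ⟧ (⟦ 2 ⟧ * ⟦ e ⟧) ⟦ b ⟧ (⟦ H ⟧) ⟦ 6 ⟧ ⟦ a ⟧ ⟩
      ⟦ 3 ⟧ * ⟦ L ⟧ * ⟦ N ⟧ + ⟦ 2 ⟧ * ⟦ e ⟧ * ⟦ N ⟧ * (⟦ b ⟧ ℚ.- (⟦ a ⟧ + 1ℚ) + (⟦ H ⟧ + (1ℚ + ⟦ 6 ⟧)))
        ≤⟨ ℚₚ.+-monoʳ-≤ (⟦ 3 ⟧ * ⟦ L ⟧ * ⟦ N ⟧) (*-monoˡ-≤ (⟦ 2 ⟧ * ⟦ e ⟧ * ⟦ N ⟧) 0≤2eN
             (ℚₚ.+-monoˡ-≤ (⟦ H ⟧ + (1ℚ + ⟦ 6 ⟧)) (ℚₚ.+-mono-≤ b≤Lq+1 (ℚₚ.neg-antimono-≤ Lp≤a+1)))) ⟩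
      ⟦ 3 ⟧ * ⟦ L ⟧ * ⟦ N ⟧ + ⟦ 2 ⟧ * ⟦ e ⟧ * ⟦ N ⟧ * (⟦ L ⟧ * q + 1ℚ ℚ.- ⟦ L ⟧ * p + (⟦ H ⟧ + (1ℚ + ⟦ 6 ⟧)))
        ≡⟨ regroup₂ ⟦ 3 ⟧ ⟦ L ⟧ ⟦ N ⟧ (⟦ 2 ⟧ * ⟦ e ⟧) q p ⟦ H ⟧ (1ℚ + ⟦ 6 ⟧) ⟩
      (q ℚ.- p) * scale + (⟦ 3 ⟧ * (⟦ L ⟧ * ⟦ N ⟧) + ⟦ 2 ⟧ * ⟦ e ⟧ * (⟦ H ⟧ + (1ℚ + (1ℚ + ⟦ 6 ⟧))) * ⟦ N ⟧)
        ≡⟨ cong (λ t → (q ℚ.- p) * scale + (⟦ 3 ⟧ * (⟦ L ⟧ * ⟦ N ⟧) + ⟦ 2 ⟧ * ⟦ e ⟧ * (⟦ H ⟧ + t) * ⟦ N ⟧)) ⟦8⟧ ⟩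
      (q ℚ.- p) * scale + (⟦ 3 ⟧ * (⟦ L ⟧ * ⟦ N ⟧) + ⟦ 2 ⟧ * ⟦ e ⟧ * (⟦ H ⟧ + ⟦ 8 ⟧) * ⟦ N ⟧)
        ≤⟨ ℚₚ.+-monoʳ-≤ ((q ℚ.- p) * scale) (ℚₚ.+-monoʳ-≤ (⟦ 3 ⟧ * (⟦ L ⟧ * ⟦ N ⟧)) remainder) ⟩
      (q ℚ.- p) * scale + (⟦ 3 ⟧ * (⟦ L ⟧ * ⟦ N ⟧) + ⟦ L ⟧ * ⟦ N ⟧)
        ≡⟨ cong ((q ℚ.- p) * scale +_) (trans 3+1 (sym error)) ⟩
      (q ℚ.- p) * scale + ⟦ 2 ⟧ * η * scale
        ≡⟨ ℚₚ.*-distribʳ-+ scale (q ℚ.- p) (⟦ 2 ⟧ * η) ⟨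
      ((q ℚ.- p) + ⟦ 2 ⟧ * η) * scale ∎)
      where
      regroup₁ : ∀ c L N t b H s a →
        c * L * N + t * (b + H + s) * N ℚ.- t * a * N ≡ c * L * N + t * N * (b ℚ.- (a + 1ℚ) + (H + (1ℚ + s)))
      regroup₁ = solve 8 (λ c L N t b H s a →
        c :* L :* N :+ t :* (b :+ H :+ s) :* N :- t :* a :* N
          := c :* L :* N :+ t :* N :* (b :- (a :+ con 1ℚ) :+ (H :+ (con 1ℚ :+ s)))) refl
      regroup₂ : ∀ c L N t q p H s →
        c * L * N + t * N * (L * q + 1ℚ ℚ.- L * p + (H + s))
          ≡ (q ℚ.- p) * (t * L * N) + (c * (L * N) + t * (H + (1ℚ + s)) * N)
      regroup₂ = solve 8 (λ c L N t q p H s →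
        c :* L :* N :+ t :* N :* (L :* q :+ con 1ℚ :- L :* p :+ (H :+ s))
          := (q :- p) :* (t :* L :* N) :+ (c :* (L :* N) :+ t :* (H :+ (con 1ℚ :+ s)) :* N)) refl

    average-≥ : 2 ℕ.* e ℕ.* b ℕ.* N ℕ.≤ 2 ℕ.* e ℕ.* L ℕ.* A ℕ.+ 3 ℕ.* L ℕ.* N ℕ.+ 2 ℕ.* e ℕ.* (a ℕ.+ H ℕ.+ 6) ℕ.* N →
      ⟦ a ⟧ ≤ ⟦ L ⟧ * p + 1ℚ → ⟦ L ⟧ * q ≤ ⟦ b ⟧ + 1ℚ →
      q ℚ.- p ≤ ⟦ A ⟧ * recip ⟦ N ⟧ + ⟦ 2 ⟧ * η
    average-≥ lower a≤Lp+1 Lq≤b+1 = *-cancelʳ-≤ scale 0<scale (begin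
      (q ℚ.- p) * scale
        ≡⟨ regroup₁ ⟦ L ⟧ ⟦ N ⟧ (⟦ 2 ⟧ * ⟦ e ⟧) q p ⟩
      ⟦ 2 ⟧ * ⟦ e ⟧ * ⟦ N ⟧ * (⟦ L ⟧ * q ℚ.- (⟦ L ⟧ * p + 1ℚ) + 1ℚ)
        ≤⟨ *-monoˡ-≤ (⟦ 2 ⟧ * ⟦ e ⟧ * ⟦ N ⟧) 0≤2eN
             (ℚₚ.+-monoˡ-≤ 1ℚ (ℚₚ.+-mono-≤ Lq≤b+1 (ℚₚ.neg-antimono-≤ a≤Lp+1))) ⟩
      ⟦ 2 ⟧ * ⟦ e ⟧ * ⟦ N ⟧ * (⟦ b ⟧ + 1ℚ ℚ.- ⟦ a ⟧ + 1ℚ)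
        ≡⟨ regroup₂ ⟦ N ⟧ (⟦ 2 ⟧ * ⟦ e ⟧) ⟦ a ⟧ ⟦ b ⟧ ⟩
      ⟦ 2 ⟧ * ⟦ e ⟧ * ⟦ b ⟧ * ⟦ N ⟧ + ⟦ 2 ⟧ * ⟦ e ⟧ * ⟦ N ⟧ * (1ℚ ℚ.- ⟦ a ⟧ + 1ℚ)
        ≤⟨ ℚₚ.+-monoˡ-≤ (⟦ 2 ⟧ * ⟦ e ⟧ * ⟦ N ⟧ * (1ℚ ℚ.- ⟦ a ⟧ + 1ℚ))
             (lift-≤ ([ 2 ] ⊗ [ e ] ⊗ [ b ] ⊗ [ N ])
               ([ 2 ] ⊗ [ e ] ⊗ [ L ] ⊗ [ A ] ⊕ [ 3 ] ⊗ [ L ] ⊗ [ N ] ⊕ [ 2 ] ⊗ [ e ] ⊗ ([ a ] ⊕ [ H ] ⊕ [ 6 ]) ⊗ [ N ]) lower) ⟩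
      ⟦ 2 ⟧ * ⟦ e ⟧ * ⟦ L ⟧ * ⟦ A ⟧ + ⟦ 3 ⟧ * ⟦ L ⟧ * ⟦ N ⟧ + ⟦ 2 ⟧ * ⟦ e ⟧ * (⟦ a ⟧ + ⟦ H ⟧ + ⟦ 6 ⟧) * ⟦ N ⟧
        + ⟦ 2 ⟧ * ⟦ e ⟧ * ⟦ N ⟧ * (1ℚ ℚ.- ⟦ a ⟧ + 1ℚ)
        ≡⟨ regroup₃ (⟦ 2 ⟧ * ⟦ e ⟧ * ⟦ L ⟧ * ⟦ A ⟧) ⟦ 3 ⟧ ⟦ L ⟧ ⟦ N ⟧ (⟦ 2 ⟧ * ⟦ e ⟧) ⟦ a ⟧ ⟦ H ⟧ ⟦ 6 ⟧ ⟩
      ⟦ 2 ⟧ * ⟦ e ⟧ * ⟦ L ⟧ * ⟦ A ⟧ + (⟦ 3 ⟧ * (⟦ L ⟧ * ⟦ N ⟧) + ⟦ 2 ⟧ * ⟦ e ⟧ * (⟦ H ⟧ + (1ℚ + (1ℚ + ⟦ 6 ⟧))) * ⟦ N ⟧)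
        ≡⟨ cong₂ (λ s t → s + (⟦ 3 ⟧ * (⟦ L ⟧ * ⟦ N ⟧) + ⟦ 2 ⟧ * ⟦ e ⟧ * (⟦ H ⟧ + t) * ⟦ N ⟧)) (sym average) ⟦8⟧ ⟩
      ⟦ A ⟧ * recip ⟦ N ⟧ * scale + (⟦ 3 ⟧ * (⟦ L ⟧ * ⟦ N ⟧) + ⟦ 2 ⟧ * ⟦ e ⟧ * (⟦ H ⟧ + ⟦ 8 ⟧) * ⟦ N ⟧)
        ≤⟨ ℚₚ.+-monoʳ-≤ (⟦ A ⟧ * recip ⟦ N ⟧ * scale) (ℚₚ.+-monoʳ-≤ (⟦ 3 ⟧ * (⟦ L ⟧ * ⟦ N ⟧)) remainder) ⟩
      ⟦ A ⟧ * recip ⟦ N ⟧ * scale + (⟦ 3 ⟧ * (⟦ L ⟧ * ⟦ N ⟧) + ⟦ L ⟧ * ⟦ N ⟧)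
        ≡⟨ cong (⟦ A ⟧ * recip ⟦ N ⟧ * scale +_) (trans 3+1 (sym error)) ⟩
      ⟦ A ⟧ * recip ⟦ N ⟧ * scale + ⟦ 2 ⟧ * η * scale
        ≡⟨ ℚₚ.*-distribʳ-+ scale (⟦ A ⟧ * recip ⟦ N ⟧) (⟦ 2 ⟧ * η) ⟨
      (⟦ A ⟧ * recip ⟦ N ⟧ + ⟦ 2 ⟧ * η) * scale ∎)
      where
      regroup₁ : ∀ L N t q p → (q ℚ.- p) * (t * L * N) ≡ t * N * (L * q ℚ.- (L * p + 1ℚ) + 1ℚ)
      regroup₁ = solve 5 (λ L N t q p → (q :- p) :* (t :* L :* N)
        := t :* N :* (L :* q :- (L :* p :+ con 1ℚ) :+ con 1ℚ)) refl
      regroup₂ : ∀ N t a b → t * N * (b + 1ℚ ℚ.- a + 1ℚ) ≡ t * b * N + t * N * (1ℚ ℚ.- a + 1ℚ)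
      regroup₂ = solve 4 (λ N t a b → t :* N :* (b :+ con 1ℚ :- a :+ con 1ℚ)
        := t :* b :* N :+ t :* N :* (con 1ℚ :- a :+ con 1ℚ)) refl
      regroup₃ : ∀ u c L N t a H s → u + c * L * N + t * (a + H + s) * N + t * N * (1ℚ ℚ.- a + 1ℚ)
        ≡ u + (c * (L * N) + t * (H + (1ℚ + (1ℚ + s))) * N)
      regroup₃ = solve 8 (λ u c L N t a H s → u :+ c :* L :* N :+ t :* (a :+ H :+ s) :* N :+ t :* N :* (con 1ℚ :- a :+ con 1ℚ)
        := u :+ (c :* (L :* N) :+ t :* (H :+ (con 1ℚ :+ (con 1ℚ :+ s))) :* N)) refl

  2/e≤ε/2 : ∀ {ε e} → 1 ℕ.≤ e → 1ℚ ≤ ε * ℚ.½ * ℚ.½ * ⟦ e ⟧ → ⟦ 2 ⟧ * recip ⟦ e ⟧ ≤ ε * ℚ.½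
  2/e≤ε/2 {ε} {e} 1≤e 1≤δe = begin
    ⟦ 2 ⟧ * recip ⟦ e ⟧    ≤⟨ *-monoˡ-≤ ⟦ 2 ⟧ (0≤⟦⟧ 2) 1/e≤δ ⟩
    ⟦ 2 ⟧ * δ              ≡⟨ cong (_* δ) ⟦2⟧ ⟩
    (1ℚ + 1ℚ) * δ          ≡⟨ double δ ⟩
    δ + δ                  ≡⟨ ½+½ (ε * ℚ.½) ⟩
    ε * ℚ.½                ∎
    where
    δ = ε * ℚ.½ * ℚ.½
    double : ∀ t → (1ℚ + 1ℚ) * t ≡ t + t
    double = solve 1 (λ t → (con 1ℚ :+ con 1ℚ) :* t := t :+ t) refl
    1/e≤δ : recip ⟦ e ⟧ ≤ δ
    1/e≤δ = *-cancelʳ-≤ ⟦ e ⟧ (0<⟦⟧ 1≤e) (subst (_≤ δ * ⟦ e ⟧) (sym (recip-inverse (0<⟦⟧ 1≤e))) 1≤δe)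

-- The estimate for the frequency of an interval at one fixed `N`.

module Counting where

  open R using (ℝ; seq; Eventually; fromℚ; fromℕ; recip; 0ℝ; 2ℝ; <-intro; Interval; lower; upper;
    lowerIncluded; upperIncluded; _∈ᴵ_; HasCardinality; cardinality-exists; ClosePairs; OnUnitInterval)
  open R.RationalLemmas
  open WindowCounts
  open Powers
  open Binning
  open Estimates
  open import Data.Rational using (_+_; _*_; _≤_)
  open +-*-Solver using (solve; _:+_; _:*_; _:=_; con)
  open Equivalence using (to; from)

  -- Double negation passes through a bounded quantifier by induction on the bound. The window
  -- estimate needs the pair lists for all `h < H` at once.
  ¬¬-∀< : ∀ {P : ℕ → Set} H → (∀ h → h ℕ.< H → ¬ ¬ P h) → ¬ ¬ (∀ h → h ℕ.< H → P h)
  ¬¬-∀< zero    f k = k λ _ ()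
  ¬¬-∀< {P} (suc H) f k = ¬¬-∀< H (λ h h<H → f h (ℕₚ.m<n⇒m<1+n h<H)) λ g →
    f H ℕₚ.≤-refl λ p → k λ h h<1+H → extend g p h (h ℕ.≟ H) h<1+H
    where
    extend : (∀ h → h ℕ.< H → P h) → P H → ∀ h → Relation.Nullary.Dec (h ≡ H) → h ℕ.< suc H → P h
    extend g p h (yes refl) _     = p
    extend g p h (no h≢H)   h<1+H = g h (ℕₚ.≤∧≢⇒< (ℕ.s≤s⁻¹ h<1+H) h≢H)

  ≤×≤-stable : ∀ {a b c d} → ¬ ¬ (a ℕ.≤ b × c ℕ.≤ d) → a ℕ.≤ b × c ℕ.≤ d
  ≤×≤-stable {a} {b} {c} {d} = decidable-stable (a ℕ.≤? b ×-dec c ℕ.≤? d)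

  -- The upper bound treats every interval as closed, the lower bound (through `<⇒endpoint`) as
  -- open, so the kind of endpoint needs no separate treatment.
  endpoint⇒≤ : ∀ b {x y} → (if b then x R.≤ y else x R.< y) → x R.≤ y
  endpoint⇒≤ true  x≤y = x≤y
  endpoint⇒≤ false x<y = <⇒≤ x<y

  <⇒endpoint : ∀ b {x y} → x R.< y → if b then x R.≤ y else x R.< y
  <⇒endpoint true  x<y = <⇒≤ x<y
  <⇒endpoint false x<y = x<y

  -- `D` and `W` stand for `N ^ α` and `N ^ (2 - α)`; their sizes enter through `sizes`, which holds
  -- at all late stages of the Cauchy sequences.
  module Count (x : ℕ → ℝ) (x∈[0,1] : OnUnitInterval x) (J : Interval) {e H N : ℕ}
    (1≤e : 1 ℕ.≤ e) (15e²≤H : 15 ℕ.* (e ℕ.* e) ℕ.≤ H) (1≤N : 1 ℕ.≤ N) (D W : R.ℝ⁺)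
    (sizes : Eventually λ n → ⟦ H ⟧ ≤ seq (R.value D) n × ⟦ N ℕ.* H ⟧ ≤ seq (R.value W) n ×
      seq (R.value D) n * seq (R.value W) n ≤ ⟦ N ℕ.* N ⟧)
    where

    threshold : ℕ → ℝ
    threshold h = fromℚ (⟦ h ℕ.+ 2 ⟧ * recip ⟦ H ⟧)

    15≤H : 15 ℕ.≤ H
    15≤H = ℕₚ.≤-trans (ℕₚ.*-monoʳ-≤ 15 (ℕₚ.*-mono-≤ 1≤e 1≤e)) 15e²≤H

    1≤H : 1 ℕ.≤ H
    1≤H = ℕₚ.≤-trans (s≤s z≤n) 15≤H

    abstract
      -- `binning` at scale `H` serves here to round the real number `H D` to an integer.
      bin-D : ∃[ z ] Bin H (R.value D) z
      bin-D = binning 1≤H (R.value D) (<⇒≤ (R.positive D))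

    -- The number of bins per unit length: windows of H bins have width about 1 / D.
    L : ℕ
    L = proj₁ bin-D ℕ.+ 1

    -- The 1 added to the bin number in `L` puts `L` on the upper side of `H D`, the side that
    -- `bins-close⇒≤` needs; the upper bound pays for it with 2 instead of 1.
    HD≤L≤HD+2 : Eventually λ n → ⟦ H ⟧ * seq (R.value D) n ≤ ⟦ L ⟧ × ⟦ L ⟧ ≤ ⟦ H ⟧ * seq (R.value D) n + ⟦ 2 ⟧
    HD≤L≤HD+2 = eventually-map (λ n (z≤HD+1 , HD≤z+1) → first n HD≤z+1 , second n z≤HD+1) (proj₂ bin-D)
      where
      z₀ = proj₁ bin-D
      first : ∀ n → ⟦ H ⟧ * seq (R.value D) n ≤ ⟦ z₀ ⟧ + 1ℚ → ⟦ H ⟧ * seq (R.value D) n ≤ ⟦ L ⟧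
      first n = subst (⟦ H ⟧ * seq (R.value D) n ≤_) (⟦⟧+1 z₀)
      second : ∀ n → ⟦ z₀ ⟧ ≤ ⟦ H ⟧ * seq (R.value D) n + 1ℚ → ⟦ L ⟧ ≤ ⟦ H ⟧ * seq (R.value D) n + ⟦ 2 ⟧
      second n z≤HD+1 = subst₂ _≤_ (⟦⟧+1 z₀)
        (trans (ℚₚ.+-assoc (⟦ H ⟧ * seq (R.value D) n) 1ℚ 1ℚ) (cong (⟦ H ⟧ * seq (R.value D) n +_) (sym ⟦2⟧)))
          (ℚₚ.+-monoˡ-≤ 1ℚ z≤HD+1)

    H²≤L : H ℕ.* H ℕ.≤ L
    H²≤L =
      let n , (H≤D , _) , HD≤L , _ = sometime (sizes ∧ HD≤L≤HD+2)
      in ⟦⟧-cancel-≤ (subst (_≤ ⟦ L ⟧) (sym (⟦⟧-* H H)) (ℚₚ.≤-trans (*-monoˡ-≤ ⟦ H ⟧ (0≤⟦⟧ H) H≤D) HD≤L))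

    1≤L : 1 ℕ.≤ L
    1≤L = ℕₚ.m≤n+m 1 (proj₁ bin-D)

    -- From `N H ≤ W` and `D W ≤ N²` follows `D H ≤ N`, the form in which `α < 1` reaches the
    -- diagonal term; and `L ≤ H D + 2 ≤ (1 + H) D`.
    LH≤[1+H]N : L ℕ.* H ℕ.≤ (1 ℕ.+ H) ℕ.* N
    LH≤[1+H]N =
      let n , (H≤D , NH≤W , DW≤N²) , _ , L≤HD+2 = sometime (sizes ∧ HD≤L≤HD+2)
      in lower-≤ ([ L ] ⊗ [ H ]) (([ 1 ] ⊕ [ H ]) ⊗ [ N ]) (begin
        ⟦ L ⟧ * ⟦ H ⟧                              ≤⟨ *-monoʳ-≤ ⟦ H ⟧ (0≤⟦⟧ H) L≤HD+2 ⟩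
        (⟦ H ⟧ * d n + ⟦ 2 ⟧) * ⟦ H ⟧              ≤⟨ *-monoʳ-≤ ⟦ H ⟧ (0≤⟦⟧ H) (ℚₚ.+-monoʳ-≤ (⟦ H ⟧ * d n) (2≤D n H≤D)) ⟩
        (⟦ H ⟧ * d n + d n) * ⟦ H ⟧                ≡⟨ trans (collect ⟦ H ⟧ (d n)) (cong (λ t → (t + ⟦ H ⟧) * (d n * ⟦ H ⟧)) (sym ⟦1⟧)) ⟩
        (⟦ 1 ⟧ + ⟦ H ⟧) * (d n * ⟦ H ⟧)            ≤⟨ *-monoˡ-≤ (⟦ 1 ⟧ + ⟦ H ⟧) 0≤1+H (DH≤N n H≤D NH≤W DW≤N²) ⟩
        (⟦ 1 ⟧ + ⟦ H ⟧) * ⟦ N ⟧                    ∎)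
      where
      open ℚₚ.≤-Reasoning
      d : ℕ → ℚ
      d = seq (R.value D)
      0≤1+H : 0ℚ ≤ ⟦ 1 ⟧ + ⟦ H ⟧
      0≤1+H = subst (0ℚ ≤_) (⟦⟧-+ 1 H) (0≤⟦⟧ (1 ℕ.+ H))
      collect : ∀ H d → (H * d + d) * H ≡ (1ℚ + H) * (d * H)
      collect = solve 2 (λ H d → (H :* d :+ d) :* H := (con 1ℚ :+ H) :* (d :* H)) refl
      2≤D : ∀ n → ⟦ H ⟧ ≤ d n → ⟦ 2 ⟧ ≤ d n
      2≤D n = ℚₚ.≤-trans (⟦⟧-mono-≤ (ℕₚ.≤-trans (s≤s (s≤s z≤n)) 15≤H))
      DH≤N : ∀ n → ⟦ H ⟧ ≤ d n → ⟦ N ℕ.* H ⟧ ≤ seq (R.value W) n → d n * seq (R.value W) n ≤ ⟦ N ℕ.* N ⟧ → d n * ⟦ H ⟧ ≤ ⟦ N ⟧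
      DH≤N n H≤D NH≤W DW≤N² = *-cancelʳ-≤ ⟦ N ⟧ (0<⟦⟧ 1≤N) (begin
        d n * ⟦ H ⟧ * ⟦ N ⟧        ≡⟨ trans (ℚₚ.*-assoc (d n) ⟦ H ⟧ ⟦ N ⟧) (cong (d n *_) (trans (ℚₚ.*-comm ⟦ H ⟧ ⟦ N ⟧) (sym (⟦⟧-* N H)))) ⟩
        d n * ⟦ N ℕ.* H ⟧          ≤⟨ *-monoˡ-≤ (d n) (ℚₚ.≤-trans (0≤⟦⟧ H) H≤D) NH≤W ⟩
        d n * seq (R.value W) n    ≤⟨ DW≤N² ⟩
        ⟦ N ℕ.* N ⟧                ≡⟨ ⟦⟧-* N N ⟩
        ⟦ N ⟧ * ⟦ N ⟧              ∎)

    0≤x : ∀ i → 0ℝ R.≤ x (suc i)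
    0≤x i = proj₁ (x∈[0,1] (suc i) (s≤s z≤n))

    abstract
      bin-x : ∀ i → ∃[ z ] Bin L (x (suc i)) z
      bin-x i = binning 1≤L (x (suc i)) (0≤x i)

    z : ℕ → ℕ
    -- Index 0 is not in `indices`; the value 0 merely keeps `z≤L+2` valid for all `i`.
    z zero    = 0
    z (suc i) = proj₁ (bin-x i)

    x∈z : ∀ {i} → 1 ℕ.≤ i → Bin L (x i) (z i)
    x∈z {suc i} _ = proj₂ (bin-x i)

    z≤L+2 : ∀ i → z i ℕ.≤ L ℕ.+ 2
    z≤L+2 zero    = z≤n
    z≤L+2 (suc i) = bin-≤ 1≤L (x∈z {suc i} (s≤s z≤n)) (proj₂ (x∈[0,1] (suc i) (s≤s z≤n)))

    abstract
      bin-lower : ∃[ a ] Bin L (lower J) a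
      bin-lower = binning 1≤L (lower J) (R.0≤lower J)

      bin-upper : ∃[ b ] Bin L (upper J) b
      bin-upper = binning 1≤L (upper J) (≤-trans (R.0≤lower J) (R.lower≤upper J))

    a b : ℕ
    a = proj₁ bin-lower
    b = proj₁ bin-upper

    indices : List ℕ
    indices = applyUpTo suc N

    indices! : Unique indices
    indices! = applyUpTo⁺₁ suc N λ i<j _ → ℕₚ.<⇒≢ i<j ∘ ℕₚ.suc-injective

    ∈indices⇒ : ∀ {i} → i ∈ indices → 1 ℕ.≤ i × i ℕ.≤ N
    ∈indices⇒ i∈ with j , j<N , refl ← ∈-applyUpTo⁻ suc i∈ = s≤s z≤n , j<N

    ⇒∈indices : ∀ {i} → 1 ℕ.≤ i → i ℕ.≤ N → i ∈ indices
    ⇒∈indices {suc i} _ i<N = ∈-applyUpTo⁺ suc i<N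

    -- What the hypothesis supplies at this `N`: the finitely many values `s = (h + 2) / H`, each
    -- with tolerance `1 / H`.
    PairAsymptotics : Set
    PairAsymptotics = ∀ h → h ℕ.< H → ∀ k → HasCardinality (ClosePairs x N (threshold h R./ D)) k →
      R.∣ fromℕ k R./ W R.- 2ℝ R.* threshold h ∣ R.< fromℚ (recip ⟦ H ⟧)

    FewPairs : ℕ → Set
    FewPairs h = ∃[ ps ]
      (∀ m n → m ∈ indices → n ∈ indices → m ≢ n → ℕ.∣ z m - z n ∣ ℕ.≤ h → (m , n) ∈ ps) ×
      L ℕ.* length ps ℕ.≤ N ℕ.* N ℕ.* (2 ℕ.* h ℕ.+ 6)

    -- The close pairs can be listed only up to double negation, which the decidable
    -- bounds of count-close absorb.
    fewPairs : PairAsymptotics → ∀ h → h ℕ.< H → ¬ ¬ FewPairs h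
    fewPairs asymptotics h h<H none = cardinality-exists (cartesianProduct indices indices) (cartesianProduct⁺ indices! indices!)
      (λ (m , n) (1≤m , m≤N , 1≤n , n≤N , _) → ∈-cartesianProduct⁺ (⇒∈indices 1≤m m≤N) (⇒∈indices 1≤n n≤N))
      λ (k , ps , ps! , ∣ps∣≡k , ps⇔) → none (ps
        , (λ m n m∈ n∈ m≢n zₘ-zₙ≤h →
            let 1≤m , m≤N = ∈indices⇒ m∈
                1≤n , n≤N = ∈indices⇒ n∈
            in to (ps⇔ (m , n)) (1≤m , m≤N , 1≤n , n≤N , m≢n ,
                 bins-close⇒≤ {L} {H} {h} {x m} {x n} D 1≤L 1≤H
                   (eventually-map (λ j ((H≤D , _) , HD≤L , _) → 1≤D j H≤D , HD≤L) (sizes ∧ HD≤L≤HD+2))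
                   (x∈z 1≤m) (x∈z 1≤n) zₘ-zₙ≤h))
        , subst (λ t → L ℕ.* t ℕ.≤ N ℕ.* N ℕ.* (2 ℕ.* h ℕ.+ 6)) (sym ∣ps∣≡k)
            (few k (asymptotics h h<H k (ps , ps! , ∣ps∣≡k , ps⇔))))
      where
      1≤D : ∀ n → ⟦ H ⟧ ≤ seq (R.value D) n → 1ℚ ≤ seq (R.value D) n
      1≤D n H≤D = ℚₚ.≤-trans (subst (_≤ ⟦ H ⟧) ⟦1⟧ (⟦⟧-mono-≤ 1≤H)) H≤D
      few : ∀ k → R.∣ fromℕ k R./ W R.- 2ℝ R.* threshold h ∣ R.< fromℚ (recip ⟦ H ⟧) →
        L ℕ.* k ℕ.≤ N ℕ.* N ℕ.* (2 ℕ.* h ℕ.+ 6)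
      few k (<-intro c 0<c close) =
        let n , close , (H≤D , NH≤W , DW≤N²) , _ , L≤HD+2 = sometime (close ∧ sizes ∧ HD≤L≤HD+2)
        in pairs-bound {N} {W = seq (R.value W) n} h<H
          (ℚₚ.≤-trans (subst (_≤ ⟦ N ℕ.* H ⟧) ⟦1⟧ (⟦⟧-mono-≤ (ℕₚ.*-mono-≤ 1≤N 1≤H))) NH≤W)
          (ℚₚ.≤-trans (⟦⟧-mono-≤ 15≤H) H≤D) DW≤N² L≤HD+2
          (close⇒≤ {⟦ k ⟧ * recip (seq (R.value W) n)} {⟦ 2 ⟧ * (⟦ h ℕ.+ 2 ⟧ * recip ⟦ H ⟧)}
            (subst₂ (λ s t → ℚ.∣ s * recip (seq (R.value W) n) ℚ.- t * (⟦ h ℕ.+ 2 ⟧ * recip ⟦ H ⟧) ∣ ≤ recip ⟦ H ⟧)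
              (⟦⟧-def k) (⟦⟧-def 2) (ℚₚ.≤-trans (p≤p+q _ (ℚₚ.<⇒≤ 0<c)) close)))

    10e²≤H : 10 ℕ.* (e ℕ.* e) ℕ.≤ H
    10e²≤H = ℕₚ.≤-trans (ℕₚ.*-monoˡ-≤ (e ℕ.* e) (ℕₚ.m≤m+n 10 5)) 15e²≤H

    2e[H+8]≤L : 2 ℕ.* e ℕ.* (H ℕ.+ 8) ℕ.≤ L
    2e[H+8]≤L = begin
      2 ℕ.* e ℕ.* (H ℕ.+ 8)     ≤⟨ ℕₚ.*-monoʳ-≤ (2 ℕ.* e) (ℕₚ.+-monoʳ-≤ H (ℕₚ.≤-trans (ℕₚ.m≤m+n 8 7) 15≤H)) ⟩
      2 ℕ.* e ℕ.* (H ℕ.+ H)     ≡⟨ regroup e H ⟩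
      4 ℕ.* (e ℕ.* 1) ℕ.* H     ≤⟨ ℕₚ.*-monoˡ-≤ H (ℕₚ.≤-trans (ℕₚ.*-mono-≤ (ℕₚ.m≤m+n 4 11) (ℕₚ.*-monoʳ-≤ e 1≤e)) 15e²≤H) ⟩
      H ℕ.* H                   ≤⟨ H²≤L ⟩
      L                         ∎
      where
      open ℕₚ.≤-Reasoning
      regroup : ∀ e H → 2 ℕ.* e ℕ.* (H ℕ.+ H) ≡ 4 ℕ.* (e ℕ.* 1) ℕ.* H
      regroup = solve-∀

    -- The inequalities `bounds` between natural numbers do not depend on the stage `n`; only the
    -- comparison of `a` and `b` with the scaled endpoints does, and it holds at all late stages.
    count-close : PairAsymptotics → ∀ {k} → HasCardinality (λ i → 1 ℕ.≤ i × i ℕ.≤ N × x i ∈ᴵ J) k →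
      Eventually λ n → ℚ.∣ ⟦ k ⟧ * recip ⟦ N ⟧ ℚ.- (seq (upper J) n ℚ.- seq (lower J) n) ∣ ≤ ⟦ 2 ⟧ * recip ⟦ e ⟧
    count-close asymptotics (xs , xs! , refl , xs⇔) =
      let above , below = bounds
      in eventually-map (λ n ((a≤ , ≤a) , (b≤ , ≤b)) →
          ≤⇒close (average-≤ {H = H} {a = a} {b} {seq (lower J) n} {seq (upper J) n} 1≤N 1≤e 1≤L 2e[H+8]≤L above ≤a b≤)
                  (average-≥ {H = H} {a = a} {b} {seq (lower J) n} {seq (upper J) n} 1≤N 1≤e 1≤L 2e[H+8]≤L below a≤ ≤b))
        (proj₂ bin-lower ∧ proj₂ bin-upper)
      where
      xs⊆indices : ∀ {i} → i ∈ xs → i ∈ indices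
      xs⊆indices {i} i∈ = let 1≤i , i≤N , _ = from (xs⇔ i) i∈ in ⇒∈indices 1≤i i≤N
      near : ∀ i → i ∈ xs → a ℕ.≤ z i ℕ.+ 3 × z i ℕ.≤ b ℕ.+ 3
      near i i∈ = let 1≤i , _ , lower≤x , x≤upper = from (xs⇔ i) i∈ in
        bin-mono 1≤L (proj₂ bin-lower) (x∈z 1≤i) (endpoint⇒≤ (lowerIncluded J) lower≤x) ,
        bin-mono 1≤L (x∈z 1≤i) (proj₂ bin-upper) (endpoint⇒≤ (upperIncluded J) x≤upper)
      inner : ∀ i → i ∈ indices → a ℕ.+ 3 ℕ.≤ z i → z i ℕ.+ 3 ℕ.≤ b → i ∈ xs
      inner i i∈ a+3≤z z+3≤b = let 1≤i , i≤N = ∈indices⇒ i∈ in to (xs⇔ i) (1≤i , i≤N ,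
        <⇒endpoint (lowerIncluded J) (bin-< 1≤L (proj₂ bin-lower) (x∈z 1≤i) a+3≤z) ,
        <⇒endpoint (upperIncluded J) (bin-< 1≤L (x∈z 1≤i) (proj₂ bin-upper) z+3≤b))
      a≤b+6 : a ℕ.≤ b ℕ.+ 6
      a≤b+6 = ℕₚ.≤-trans (bin-mono 1≤L (proj₂ bin-lower) (proj₂ bin-upper) (R.lower≤upper J))
        (ℕₚ.+-monoʳ-≤ b (ℕₚ.m≤m+n 3 3))
      b≤L+2 : b ℕ.≤ L ℕ.+ 2
      b≤L+2 = bin-≤ 1≤L (proj₂ bin-upper) (R.upper≤1 J)
      bounds : 2 ℕ.* e ℕ.* L ℕ.* length xs ℕ.+ 2 ℕ.* e ℕ.* a ℕ.* N ℕ.≤ 3 ℕ.* L ℕ.* N ℕ.+ 2 ℕ.* e ℕ.* (b ℕ.+ H ℕ.+ 6) ℕ.* N ×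
        2 ℕ.* e ℕ.* b ℕ.* N ℕ.≤ 2 ℕ.* e ℕ.* L ℕ.* length xs ℕ.+ 3 ℕ.* L ℕ.* N ℕ.+ 2 ℕ.* e ℕ.* (a ℕ.+ H ℕ.+ 6) ℕ.* N
      bounds = ≤×≤-stable λ k → ¬¬-∀< H (fewPairs asymptotics) λ few →
        let open Estimate indices indices! (Listₚ.length-applyUpTo suc N) z e H L z≤L+2 1≤H 10e²≤H
              (ℕₚ.≤-trans (ℕₚ.m≤m+n 3 12) 15≤H) H²≤L 1≤N LH≤[1+H]N few
        in k (count-upper xs xs! xs⊆indices a b a≤b+6 b≤L+2 near ,
              count-lower xs xs! xs⊆indices a b 1≤e b≤L+2 inner)


-- Choice of the parameters, and the theorem.

open import Defs
open RationalLemmas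
open Powers
open Binning
open Estimates
open Counting

supremum : (ℕ → ℕ) → ℕ → ℕ
supremum f zero    = 0
supremum f (suc n) = f n ℕ.⊔ supremum f n

≤-supremum : ∀ f n {i} → i ℕ.< n → f i ℕ.≤ supremum f n
≤-supremum f (suc n) {i} i<1+n with i ℕ.≟ n
... | yes refl = ℕₚ.m≤m⊔n (f n) (supremum f n)
... | no  i≢n  = ℕₚ.≤-trans (≤-supremum f n (ℕₚ.≤∧≢⇒< (ℕ.s≤s⁻¹ i<1+n) i≢n)) (ℕₚ.m≤n⊔m (f n) (supremum f n))

0<fromℚ : ∀ {p} → 0ℚ ℚ.< p → 0ℝ < fromℚ p
0<fromℚ {p} 0<p = <-intro p 0<p (0 , λ _ _ → ℚₚ.≤-reflexive (ℚₚ.+-identityˡ p))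

corollary4 :
  (x : ℕ → ℝ) → OnUnitInterval x →
  (α : ℝ) (0<α : 0ℝ < α) (α<1 : α < 1ℝ) →
  ((s : ℝ) → 0ℝ < s →
    CountingLimit
      (λ N → ClosePairs x N (s / (N ^ (α ,>0 0<α))))
      (λ N → N ^ ((2ℝ - α) ,>0 0<2-α α<1))
      (2ℝ * s)) →
  UniformlyDistributed x
corollary4 x x∈[0,1] α 0<α α<1 pairs J ε (<-intro g 0<g (n₀ , g≤ε)) = N₀ , λ N N₀≤N k k# →
  let grow  = proj₂ powers N (ℕₚ.m⊔n≤o⇒m≤o (proj₁ powers) (supremum pairs₀ H) N₀≤N)
      pairs₀≤N = ℕₚ.m⊔n≤o⇒n≤o (proj₁ powers) (supremum pairs₀ H) N₀≤N
      open Count x x∈[0,1] J {e} {H} {N} (s≤s z≤n) ℕₚ.≤-refl (ℕ.>-nonZero⁻¹ N)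
        (N ^ (α ,>0 0<α)) (N ^ ((2ℝ - α) ,>0 0<2-α α<1)) grow
  -- Half of the gap `g` below `ε` absorbs the error `2 / e`; the other half witnesses the strict
  -- inequality.
  in <-intro (g ℚ.* ℚ.½) (0<p*q 0<g 0<½) (eventually-map
    (λ n (close , 0+g≤ε) → conclude N k n close 0+g≤ε)
    (count-close (λ h h<H → proj₂ (limit h) N (ℕₚ.≤-trans (≤-supremum pairs₀ H h<H) pairs₀≤N)) k# ∧ (n₀ , g≤ε)))
  where
  -- A quarter of the gap: `1 / e ≤ g / 4` makes the final error `2 / e` at most `g / 2`.
  δ = g ℚ.* ℚ.½ ℚ.* ℚ.½
  0<δ : 0ℚ ℚ.< δ
  0<δ = 0<p*q (0<p*q 0<g 0<½) 0<½
  e = suc (proj₁ (archimedean 0<δ))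
  1≤δe : 1ℚ ℚ.≤ δ ℚ.* ⟦ e ⟧
  1≤δe = 1≤⟦suc⟧*⇐ (proj₁ (archimedean 0<δ)) (proj₂ (archimedean 0<δ))
  -- The variance needs `10 e² ≤ H`. Taking 15 also ensures `15 ≤ H` even for `e = 1`, from which
  -- the absolute bounds follow: `3 ≤ H` and `8 ≤ H`, and `15 ≤ D` because `H ≤ D`.
  H = 15 ℕ.* (e ℕ.* e)
  1≤H : 1 ℕ.≤ H
  1≤H = s≤s z≤n
  powers = growth 0<α α<1 H
  limit = λ h → pairs (fromℚ (⟦ h ℕ.+ 2 ⟧ ℚ.* recip ⟦ H ⟧))
    (0<fromℚ (0<p*q (0<⟦⟧ {h ℕ.+ 2} (ℕₚ.≤-trans (s≤s z≤n) (ℕₚ.m≤n+m 2 h))) (0<recip⟦⟧ 1≤H)))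
    (fromℚ (recip ⟦ H ⟧)) (0<fromℚ (0<recip⟦⟧ 1≤H))
  pairs₀ : ℕ → ℕ
  pairs₀ h = proj₁ (limit h)
  -- `H` depends only on `ε`, so just finitely many instances of the hypothesis are used and their
  -- thresholds have a maximum.
  N₀ = proj₁ powers ℕ.⊔ supremum pairs₀ H
  conclude : ∀ N .{{_ : NonZero N}} k n →
    ℚ.∣ ⟦ k ⟧ ℚ.* recip ⟦ N ⟧ ℚ.- (seq (upper J) n ℚ.- seq (lower J) n) ∣ ℚ.≤ ⟦ 2 ⟧ ℚ.* recip ⟦ e ⟧ →
    0ℚ ℚ.+ g ℚ.≤ seq ε n →
    seq (∣ fromℕ k / fromℕ⁺ N - intervalLength J ∣) n ℚ.+ g ℚ.* ℚ.½ ℚ.≤ seq ε n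
  conclude N k n close 0+g≤ε = subst₂ (λ s t → ℚ.∣ s ℚ.* recip t ℚ.- (seq (upper J) n ℚ.- seq (lower J) n) ∣ ℚ.+ g ℚ.* ℚ.½ ℚ.≤ seq ε n)
    (sym (⟦⟧-def k)) (sym (⟦⟧-def N)) (begin
    ℚ.∣ ⟦ k ⟧ ℚ.* recip ⟦ N ⟧ ℚ.- (seq (upper J) n ℚ.- seq (lower J) n) ∣ ℚ.+ g ℚ.* ℚ.½
      ≤⟨ ℚₚ.+-monoˡ-≤ (g ℚ.* ℚ.½) (ℚₚ.≤-trans close (2/e≤ε/2 {g} {e} (s≤s z≤n) 1≤δe)) ⟩
    g ℚ.* ℚ.½ ℚ.+ g ℚ.* ℚ.½      ≡⟨ ½+½ g ⟩
    g                            ≡⟨ ℚₚ.+-identityˡ g ⟨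
    0ℚ ℚ.+ g                     ≤⟨ 0+g≤ε ⟩
    seq ε n                      ∎)
    where open ℚₚ.≤-Reasoning
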